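{- Let $0\le k\le n-1$ and $\mathbf{m}=(1,\dots,1,n-k)\in\mathbb{N}^{k+1}$. For $\mathbf{b}=(b_1,\dots,b_n)\in\mathbb{N}^n$ and $1\le i\le n-1$, let $\beta_{i-1,\mathbf{b}}(\mathcal{M}_{K_{n+1}}^{(k)})$ be the $(i-1)$-th multigraded Betti number of the $k$-skeleton ideal $\mathcal{M}_{K_{n+1}}^{(k)}$ in degree $\mathbf{b}$. Then the following hold. (i) For $J=\{j_1,\dots,j_t\}\in\mathcal{I}_{\mathbf{m}}^{*,1}\langle i-1\rangle$, $\beta_{i-1,\mathbf{b}(J)}(\mathcal{M}_{K_{n+1}}^{(k)})=1$, where $t=i$. (ii) For $J=\{j_1,\dots,j_t\}\in\mathcal{I}_{\mathbf{m}}^{*,2}\langle i-1\rangle$, $\beta_{i-1,\mathbf{b}(J)}(\mathcal{M}_{K_{n+1}}^{(k)})=\binom{j_t-j_{t-1}-1}{k-j_{t-1}}$, where $t+j_t-k=i$. (iii) If $\mathbf{b}=\pi\mathbf{b}(J)$ is a permutation of $\mathbf{b}(J)$ for some $J\in\mathcal{I}_{\mathbf{m}}^{*}\langle i-1\rangle$ and some permutation $\pi$ of $[n]$, then $\beta_{i-1,\mathbf{b}}(\mathcal{M}_{K_{n+1}}^{(k)})=\beta_{i-1,\mathbf{b}(J)}(\mathcal{M}_{K_{n+1}}^{(k)})$. Otherwise, $\beta_{i-1,\mathbf{b}}(\mathcal{M}_{K_{n+1}}^{(k)})=0$. (iv) The $(i-1)$-th Betti number of $\mathcal{M}_{K_{n+1}}^{(k)}$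 is \[ \beta_{i-1}(\mathcal{M}_{K_{n+1}}^{(k)})=\beta_i\!\left(\frac{R}{\mathcal{M}_{K_{n+1}}^{(k)}}\right)=\sum_{J\in\mathcal{I}_{\mathbf{m}}^{*,1}\langle i-1\rangle}\beta_{i-1}^{J}+\sum_{\tilde J\in\mathcal{I}_{\mathbf{m}}^{*,2}\langle i-1\rangle}\beta_{i-1}^{\tilde J}, \] where $\beta_{i-1}^{J}=\prod_{\alpha=1}^{i}\binom{j_{\alpha+1}}{j_\alpha}$ for $J=\{j_1,\dots,j_i\}\in\mathcal{I}_{\mathbf{m}}^{*,1}\langle i-1\rangle$ and $\beta_{i-1}^{\tilde J}=\left[\prod_{\alpha=1}^{t}\binom{l_{\alpha+1}}{l_\alpha}\right]\binom{l_t-l_{t-1}-1}{k-l_{t-1}}$ for $\tilde J=\{l_1,\dots,l_t\}\in\mathcal{I}_{\mathbf{m}}^{*,2}\langle i-1\rangle$. Here $j_{i+1}=l_{t+1}=n$.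
   Context: $\mathbb{N}=\{0,1,2,\dots\}$, $[n]=\{1,\dots,n\}$; $R=\mathbb{K}[x_1,\dots,x_n]$ over a field $\mathbb{K}$ with its $\mathbb{N}^n$-grading. The $k$-skeleton ideal of the complete graph $K_{n+1}$ on $\{0,1,\dots,n\}$ with root $0$ is \[ \mathcal{M}_{K_{n+1}}^{(k)}=\Big\langle \Big(\prod_{j\in A}x_j\Big)^{n-|A|+1}:\ \emptyset\ne A\subseteq[n],\ |A|\le k+1\Big\rangle\subseteq R. \] Betti numbers are those of the minimal (multigraded) free resolution over $R$. Dual $\mathbf{m}$-isolated subsets for $\mathbf{m}=(1,\dots,1,n-k)\in\mathbb{N}^{k+1}$: let $J=\{j_1,\dots,j_t\}\subseteq[n]$ be non-empty with $0=j_0<j_1<\cdots<j_t$ (elements are always listed increasingly, with $j_0=0$, and likewise $l_0=0$). (1) $J$ is dual $\mathbf{m}$-isolated of type-1 if $J\subseteq[k+1]$; its dual weight is $\mathrm{dwt}(J)=t-1$. (2) $J$ is dual $\mathbf{m}$-isolated of type-2 if $J\setminus\{j_t\}\subseteq[k]$ and $k+1<j_t\le n$; its dual weight is $\mathrm{dwt}(J)=(t-1)+(j_t-k)$. $\mathcal{I}_{\mathbf{m}}^{*,1}\langle i\rangle$ and $\mathcal{I}_{\mathbf{m}}^{*,2}\langle i\rangle$ denote the sets of dual $\mathbf{m}$-isolated subsets of type-1, respectively type-2, of dual weight $i$, and $\mathcal{I}_{\mathbf{m}}^{*}\langle i\rangle$ is their disjoint union. Degrees: set $\lambda_i=n-i+1$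 for $1\le i\le k$ and $\lambda_i=n-k$ for $k+1\le i\le n$. Let $e_1,\dots,e_n$ be the standard basis vectors of $\mathbb{R}^n$ and $\varepsilon(i,j)=\sum_{l=i+1}^{j}e_l$ for $0\le i<j\le n$. For a dual $\mathbf{m}$-isolated subset $J=\{j_1,\dots,j_t\}$, $\mathbf{b}(J)=\sum_{\alpha=1}^{t}\lambda_{j_\alpha}\,\varepsilon(j_{\alpha-1},j_\alpha)\in\mathbb{N}^n$.
   Formalization: The type-2 dual weight is taken as (t-1)+(j_t-(k+1)), and (ii) has t+j_t-(k+1)=i, instead of j_t-k; with j_t-k the claim fails: for n=3, k=0, i=2 no J has dual weight 1, although β_1=3 for (x_1^3,x_2^3,x_3^3). -}

module Defs where

open import Algebra.Apartness.Bundles using (HeytingField)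
open import Algebra.Bundles using (RawRing)
open import Algebra.Definitions.RawMonoid using (sum)
open import Algebra.Module.Bundles.Raw using (RawLeftModule)
open import Data.Bool using (if_then_else_; _∧_)
open import Data.Fin using (Fin; toℕ)
open import Data.Fin.Permutation using (Permutation′; _⟨$⟩ʳ_)
open import Data.Fin.Properties using (decFinSubset)
open import Data.Fin.Subset using (Subset; inside; outside; Nonempty; ∣_∣; _∈_)
open import Data.Fin.Subset.Properties using (_∈?_; nonempty?)
open import Data.List using (List; []; _∷_; _++_; map; filter; length; lookup; allFin; upTo; head; drop; foldr; cartesianProductWith)
open import Data.Maybe using (fromMaybe)
open import Data.Nat using (ℕ; zero; suc; _+_; _*_; _∸_; _≤_; _<_; _≤?_; _<?_; _≤ᵇ_; _<ᵇ_; _≟_)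
open import Data.Nat.Combinatorics using (_C_)
open import Data.Product using (Σ; ∃-syntax; _×_; _,_)
open import Data.Sum using (_⊎_)
open import Data.Vec using (Vec; tabulate; zipWith; replicate)
open import Data.Vec.Functional using (Vector)
open import Data.Vec.Properties using (≡-dec)
open import Level using (_⊔_; 0ℓ) renaming (suc to lsuc)
open import Relation.Binary.PropositionalEquality using (_≡_; _≢_)
open import Relation.Nullary using (Dec; yes; no; ¬?)
open import Relation.Nullary.Decidable using (_×-dec_; _→-dec_)
open import Relation.Unary using (Pred; Decidable)
import Data.Nat.ListAction as ℕ
import Data.Vec as Vec

------------------------------------------------------------------------
-- Exponent vectors

Multidegree : ℕ → Set
Multidegree n = Vec ℕ n

module _ {n : ℕ} where

  infixl 6 _⊕_
  infixr 7 _⊙_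
  infix  4 _≟ᵈ_

  _⊕_ : Multidegree n → Multidegree n → Multidegree n
  _⊕_ = zipWith _+_

  _⊙_ : ℕ → Multidegree n → Multidegree n
  c ⊙ a = Vec.map (c *_) a

  𝟎 : Multidegree n
  𝟎 = replicate n 0

  _≟ᵈ_ : (a b : Multidegree n) → Dec (a ≡ b)
  _≟ᵈ_ = ≡-dec _≟_

------------------------------------------------------------------------
-- The polynomial ring K[x₁,…,xₙ], its ℕⁿ-graded modules, and minimal
-- multigraded free resolutions

module Graded {c ℓ₁ ℓ₂} (K : HeytingField c ℓ₁ ℓ₂) (n : ℕ) where

  private module K = HeytingField K

  -- A polynomial is a list of terms.  Neither repeated exponents nor zero
  -- coefficients are excluded: equality compares total coefficients.
  Poly : Set c
  Poly = List (K.Carrier × Multidegree n)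

  coeff : Poly → Multidegree n → K.Carrier
  coeff []            a = K.0#
  coeff ((r , b) ∷ p) a with b ≟ᵈ a
  ... | yes _ = r K.+ coeff p a
  ... | no  _ = coeff p a

  mulTerm : K.Carrier × Multidegree n → K.Carrier × Multidegree n → K.Carrier × Multidegree n
  mulTerm (r , a) (s , b) = r K.* s , a ⊕ b

  negTerm : K.Carrier × Multidegree n → K.Carrier × Multidegree n
  negTerm (r , a) = K.- r , a

  polyRing : RawRing c ℓ₁
  polyRing = record
    { Carrier = Poly
    ; _≈_     = λ p q → ∀ a → coeff p a K.≈ coeff q a
    ; _+_     = _++_
    ; _*_     = cartesianProductWith mulTerm
    ; -_      = map negTerm
    ; 0#      = []
    ; 1#      = (K.1# , 𝟎) ∷ []
    }

  module R = RawRing polyRing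

  x^ : Multidegree n → Poly
  x^ a = (K.1# , a) ∷ []

  record RawGradedModule m ℓm ℓd : Set (c ⊔ lsuc (m ⊔ ℓm ⊔ ℓd)) where
    field
      rawLeftModule : RawLeftModule Poly m ℓm
    open RawLeftModule rawLeftModule public
    field
      -- x ∈ᵈ b : the element x lies in the homogeneous component of degree b
      _∈ᵈ_ : Carrierᴹ → Multidegree n → Set ℓd

    -- The R-linear map from a free module sending the p-th basis vector to g p.
    linear : ∀ {r} → Vector Carrierᴹ r → Vector Poly r → Carrierᴹ
    linear g v = sum +ᴹ-rawMonoid (λ p → v p *ₗ g p)

  HomogeneousPoly : Poly → Multidegree n → Set ℓ₁
  HomogeneousPoly p b = ∀ a → a ≢ b → coeff p a K.≈ K.0#

  -- ⨁ R(−a), one summand for each entry a of the list: the basis vector of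
  -- the summand R(−a) has degree a, so its multiple by x^e has degree e + a.
  freeModule : List (Multidegree n) → RawGradedModule c ℓ₁ ℓ₁
  freeModule as = record
    { rawLeftModule = record
      { Carrierᴹ = Vector Poly (length as)
      ; _≈ᴹ_     = λ v w → ∀ p → v p R.≈ w p
      ; _+ᴹ_     = λ v w p → v p R.+ w p
      ; _*ₗ_     = λ f v p → f R.* v p
      ; 0ᴹ       = λ p → R.0#
      ; -ᴹ_      = λ v p → R.- v p
      }
    ; _∈ᵈ_ = λ v b → ∀ p e → e ⊕ lookup as p ≢ b → coeff (v p) e K.≈ K.0#
    }

  data Ideal {X : Set} (g : X → Poly) : Poly → Set (c ⊔ ℓ₁) where
    gen  : ∀ x → Ideal g (g x)
    zero : Ideal g R.0#
    add  : ∀ {p q} → Ideal g p → Ideal g q → Ideal g (p R.+ q)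
    mul  : ∀ p {q} → Ideal g q → Ideal g (p R.* q)
    resp : ∀ {p q} → p R.≈ q → Ideal g p → Ideal g q

  module _ {X : Set} (g : X → Poly) where

    idealModule : RawGradedModule (c ⊔ ℓ₁) ℓ₁ ℓ₁
    idealModule = record
      { rawLeftModule = record
        { Carrierᴹ = Σ Poly (Ideal g)
        ; _≈ᴹ_     = λ (p , _) (q , _) → p R.≈ q
        ; _+ᴹ_     = λ (p , p∈I) (q , q∈I) → p R.+ q , add p∈I q∈I
        ; _*ₗ_     = λ f (p , p∈I) → f R.* p , mul f p∈I
        ; 0ᴹ       = R.0# , zero
        ; -ᴹ_      = λ (p , p∈I) → (R.- R.1#) R.* p , mul (R.- R.1#) p∈I
        }
      ; _∈ᵈ_ = λ (p , _) b → HomogeneousPoly p b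
      }

    quotientModule : RawGradedModule c (c ⊔ ℓ₁) (c ⊔ ℓ₁)
    quotientModule = record
      { rawLeftModule = record
        { Carrierᴹ = Poly
        ; _≈ᴹ_     = λ p q → Ideal g (p R.+ (R.- q))
        ; _+ᴹ_     = R._+_
        ; _*ₗ_     = R._*_
        ; 0ᴹ       = R.0#
        ; -ᴹ_      = R.-_
        }
      ; _∈ᵈ_ = λ p b → ∃[ q ] (HomogeneousPoly q b × Ideal g (p R.+ (R.- q)))
      }

  record MinimalFreeResolution {m ℓm ℓd} (M : RawGradedModule m ℓm ℓd) : Set (c ⊔ ℓ₁ ⊔ m ⊔ ℓm ⊔ ℓd) where
    private module M = RawGradedModule M
    field
      degrees : ℕ → List (Multidegree n)

    F : ℕ → RawGradedModule c ℓ₁ ℓ₁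
    F i = freeModule (degrees i)

    module F (i : ℕ) = RawGradedModule (F i)

    rank : ℕ → ℕ
    rank i = length (degrees i)

    field
      ε : Vector M.Carrierᴹ (rank 0)
      d : ∀ i → Vector (F.Carrierᴹ i) (rank (suc i))

      ε-homogeneous : ∀ q → ε q M.∈ᵈ lookup (degrees 0) q
      d-homogeneous : ∀ i q → F._∈ᵈ_ i (d i q) (lookup (degrees (suc i)) q)

      ε-surjective : ∀ x → ∃[ v ] M.linear ε v M.≈ᴹ x

      ε∘d≈0    : ∀ w → M.linear ε (F.linear 0 (d 0) w) M.≈ᴹ M.0ᴹ
      ker-ε⊆im : ∀ v → M.linear ε v M.≈ᴹ M.0ᴹ →
                 ∃[ w ] F._≈ᴹ_ 0 (F.linear 0 (d 0) w) v

      d∘d≈0    : ∀ i w → F._≈ᴹ_ i (F.linear i (d i) (F.linear (suc i) (d (suc i)) w)) (F.0ᴹ i)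
      ker-d⊆im : ∀ i v → F._≈ᴹ_ i (F.linear i (d i) v) (F.0ᴹ i) →
                 ∃[ w ] F._≈ᴹ_ (suc i) (F.linear (suc i) (d (suc i)) w) v

      -- d(Fᵢ₊₁) ⊆ (x₁,…,xₙ) Fᵢ: no matrix entry has a constant term
      minimal : ∀ i q p → coeff (d i q p) 𝟎 K.≈ K.0#

    β : ℕ → ℕ
    β = rank

    βᵈ : ℕ → Multidegree n → ℕ
    βᵈ i b = length (filter (_≟ᵈ b) (degrees i))

------------------------------------------------------------------------
-- The k-skeleton ideal of the complete graph on {0,…,n}
-- (the element x of Fin n stands for the vertex suc (toℕ x) of [n])

module Skeleton {c ℓ₁ ℓ₂} (K : HeytingField c ℓ₁ ℓ₂) (n k : ℕ) where

  open Graded K n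

  SkeletonIndex : Set
  SkeletonIndex = ∃[ A ] (Nonempty {n} A × ∣ A ∣ ≤ suc k)

  skeletonExponent : Subset n → Multidegree n
  skeletonExponent A = Vec.map (λ s → if s then n ∸ ∣ A ∣ + 1 else 0) A

  skeletonGenerator : SkeletonIndex → Poly
  skeletonGenerator (A , _) = x^ (skeletonExponent A)

  𝓜 : RawGradedModule (c ⊔ ℓ₁) ℓ₁ ℓ₁
  𝓜 = idealModule skeletonGenerator

  R/𝓜 : RawGradedModule c (c ⊔ ℓ₁) (c ⊔ ℓ₁)
  R/𝓜 = quotientModule skeletonGenerator

------------------------------------------------------------------------
-- Subsets of [n], listed increasingly

pos : ∀ {n} → Fin n → ℕ
pos x = suc (toℕ x)

elements : ∀ {n} → Subset n → List ℕ
elements {n} J = map pos (filter (_∈? J) (allFin n))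

-- For J = {j₁ < … < j_t}, j J α is j_α, where j₀ = 0 and j_α = n for α > t.
j : ∀ {n} → Subset n → ℕ → ℕ
j     J zero    = 0
j {n} J (suc α) = fromMaybe n (head (drop α (elements J)))

max : ∀ {n} → Subset n → ℕ
max J = j J ∣ J ∣

subsets : ∀ n → List (Subset n)
subsets zero    = Vec.[] ∷ []
subsets (suc n) = map (outside Vec.∷_) (subsets n) ++ map (inside Vec.∷_) (subsets n)

------------------------------------------------------------------------
-- Dual 𝐦-isolated subsets for 𝐦 = (1,…,1,n−k) ∈ ℕᵏ⁺¹

module Isolated (n k : ℕ) where

  Type1 : Pred (Subset n) 0ℓ
  Type1 J = Nonempty J × (∀ {x} → x ∈ J → pos x ≤ k + 1)

  Type2 : Pred (Subset n) 0ℓ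
  Type2 J = Nonempty J × (∀ {x} → x ∈ J → pos x ≢ max J → pos x ≤ k) × k + 1 < max J

  dwt₁ : Subset n → ℕ
  dwt₁ J = ∣ J ∣ ∸ 1

  -- (t − 1) + (j_t − (k+1)), and not (t − 1) + (j_t − k): the excess of j_t is
  -- counted over the largest element k + 1 allowed in type 1.  For k = 0 the
  -- ideal is (x₁ⁿ,…,xₙⁿ), whose Koszul resolution has its generators of degree
  -- 𝐛({j}) = n(e₁+…+e_j) in homological degree j − 1.
  dwt₂ : Subset n → ℕ
  dwt₂ J = (∣ J ∣ ∸ 1) + (max J ∸ (k + 1))

  𝓘₁⟨_⟩ : ℕ → Pred (Subset n) 0ℓ
  𝓘₁⟨ w ⟩ J = Type1 J × dwt₁ J ≡ w

  𝓘₂⟨_⟩ : ℕ → Pred (Subset n) 0ℓ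
  𝓘₂⟨ w ⟩ J = Type2 J × dwt₂ J ≡ w

  𝓘⟨_⟩ : ℕ → Pred (Subset n) 0ℓ
  𝓘⟨ w ⟩ J = 𝓘₁⟨ w ⟩ J ⊎ 𝓘₂⟨ w ⟩ J

  𝓘₁? : ∀ w → Decidable 𝓘₁⟨ w ⟩
  𝓘₁? w J = (nonempty? J ×-dec decFinSubset (_∈? J) (λ {x} _ → pos x ≤? k + 1))
            ×-dec (dwt₁ J ≟ w)

  𝓘₂? : ∀ w → Decidable 𝓘₂⟨ w ⟩
  𝓘₂? w J = (nonempty? J
             ×-dec decFinSubset (_∈? J) (λ {x} _ → ¬? (pos x ≟ max J) →-dec (pos x ≤? k))
             ×-dec (k + 1 <? max J))
            ×-dec (dwt₂ J ≟ w)

  λ[_] : ℕ → ℕ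
  λ[ i ] = if i ≤ᵇ k then n ∸ i + 1 else n ∸ k

  -- e_{a+1} + … + e_b
  ε⟨_,_⟩ : ℕ → ℕ → Multidegree n
  ε⟨ a , b ⟩ = tabulate (λ x → if (a <ᵇ pos x) ∧ (pos x ≤ᵇ b) then 1 else 0)

  𝐛 : Subset n → Multidegree n
  𝐛 J = foldr _⊕_ 𝟎 (map (λ α → λ[ j J (suc α) ] ⊙ ε⟨ j J α , j J (suc α) ⟩) (upTo ∣ J ∣))

  permute : Permutation′ n → Multidegree n → Multidegree n
  permute π b = tabulate (λ x → Vec.lookup b (π ⟨$⟩ʳ x))

  -- β^J = ∏ C(j_{α+1}, j_α) over 1 ≤ α ≤ t, where j_{t+1} = n
  βᴶ₁ : Subset n → ℕ
  βᴶ₁ J = ℕ.product (map (λ α → j J (suc (suc α)) C j J (suc α)) (upTo ∣ J ∣))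

  lastBinomial : Subset n → ℕ
  lastBinomial J = (max J ∸ j J (∣ J ∣ ∸ 1) ∸ 1) C (k ∸ j J (∣ J ∣ ∸ 1))

  βᴶ₂ : Subset n → ℕ
  βᴶ₂ J = βᴶ₁ J * lastBinomial J

  ∑[_]_ : ∀ {P : Pred (Subset n) 0ℓ} → Decidable P → (Subset n → ℕ) → ℕ
  ∑[ P? ] f = ℕ.sum (map f (filter P? (subsets n)))

-- Tensoring a minimal resolution of R/I with R/(x_j : j ∈ X), one variable at a time, gives in each
-- degree b a complex of K-vector spaces.  For X = ∅ its homology is the degree b part of R/I, for
-- X = [n] its differential vanishes and it counts the generators of degree b, and adding x to X gives
-- a long exact sequence linking the degrees b − e_x and b.
--
-- For the skeleton ideal, whether x^{b−σ} ∈ I for σ squarefree depends only on how many elements of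
-- each level {x : b_x = n + 1 − a}, a ≤ k + 1, are met by σ.  Either some coordinate can be toggled, or
-- everything lies in I, and the homology vanishes; or each level a ≤ k has to be hit and the top level,
-- with v elements, has to be hit r times.  Then each lower level contributes one homological degree, the
-- top level contributes r degrees and the factor C(v−1,r−1) by Pascal's rule, and nothing cancels
-- because all connecting maps join complexes with homology in different degrees.
--
-- So the Betti numbers depend only on the thresholds #{x : b_x ≥ n + 1 − a}, and those that give
-- non-zero values are the thresholds of the 𝐛 J.  The total is obtained by counting the vectors with
-- given thresholds.

module Submission where

open import Algebra.Apartness.Bundles using (HeytingField; HeytingCommutativeRing)
open import Algebra.Bundles using (CommutativeRing)
open import Data.Bool using (Bool; true; false; if_then_else_; _∧_; not)
open import Data.Fin using (Fin; zero; suc; _↑ˡ_; _↑ʳ_)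
import Data.Fin as Fin
open import Data.Fin.Permutation using (Permutation′; _⟨$⟩ʳ_)
import Data.Fin.Permutation as Perm
import Data.Fin.Properties as Finₚ
open import Data.List using (List; []; _∷_; length)
import Data.List as List
open import Data.List.Membership.Propositional using (_∈_; _∉_)
import Data.List.Membership.Propositional.Properties as ∈ₚ
open import Data.List.Relation.Unary.All as All using (All; []; _∷_)
open import Data.List.Relation.Unary.Any using (Any; here; there)
open import Data.List.Relation.Unary.AllPairs using ([]; _∷_)
open import Data.List.Relation.Unary.Unique.Propositional using (Unique)
import Data.List.Relation.Unary.Unique.Propositional.Properties as Uniqueₚ
import Data.Unit
open import Data.Maybe using (Maybe; just; nothing; fromMaybe; maybe′)
import Data.Maybe as Maybe
open import Data.Nat using (ℕ; zero; suc; pred; _+_; _*_; _∸_; _≤_; _<_; s≤s; z≤n)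
import Data.Nat as ℕ
import Data.Nat.ListAction as ℕL
import Data.Nat.Properties as ℕₚ
open import Data.Product using (∃; ∃-syntax; Σ; _×_; _,_; proj₁; proj₂)
open import Data.Sum using (_⊎_; inj₁; inj₂)
open import Data.Vec.Functional using (Vector; _++_)
open import Data.Vec.Functional.Properties using (lookup-++ˡ; lookup-++ʳ)
open import Function using (_∘_; id)
open import Level using (Level; _⊔_)
open import Relation.Binary.Definitions using (Decidable; tri<; tri≈; tri>)
open import Relation.Binary.PropositionalEquality using (_≡_; _≢_)
import Relation.Binary.PropositionalEquality as ≡
open import Relation.Nullary using (¬_; ¬?; Dec; yes; no; does; contradiction)
open import Relation.Nullary.Decidable using (_×-dec_; _⊎-dec_; dec-true; dec-false)
open import Data.Vec using (Vec; lookup; tabulate)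
import Data.Vec as Vec
import Data.Vec.Properties as Vecₚ
open import Data.Fin.Subset using (Subset; inside; outside; Nonempty; ∣_∣)
import Data.Fin.Subset as Subset
import Data.List.Properties as Listₚ
import Data.Fin.Subset.Properties as Subsetₚ
open import Defs

-- Linear algebra over a discrete field

-- Neither tensor products nor Tor are built as modules. Every complex that occurs is a subquotient
-- of one fixed scalar complex: keep the basis elements whose degree lies in a box l ⊑ deg ⊑ b and
-- read homology off explicit bases. Raising one coordinate of l from 0 to `b x` splits the box into
-- a sub-box and a quotient box, which is how multiplication by a variable is expressed. The link
-- from homology to the number of generators is the one-point box [b,b]: there a minimal
-- differential is zero, and `basis-size` compares a basis of homology with the generators of degree
-- b. This comparison is Gaussian elimination, hence the demand that apartness be decidable.
-- Resolutions of the ideal and of the quotient enter through the single interface `Resolves` and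
-- differ by a shift of one.

⟦_⟧ : Bool → ℕ
⟦ true  ⟧ = 1
⟦ false ⟧ = 0

count : ∀ {n} → (Fin n → Bool) → ℕ
count {zero}  P = 0
count {suc n} P = ⟦ P zero ⟧ + count (P ∘ suc)

_∖_ : ∀ {n} → (Fin n → Bool) → Fin n → Fin n → Bool
(P ∖ j) i = not (does (i Fin.≟ j)) ∧ P i

count-cong : ∀ {n} {P Q : Fin n → Bool} → (∀ i → P i ≡ Q i) → count P ≡ count Q
count-cong {zero}  P≗Q = ≡.refl
count-cong {suc n} P≗Q = ≡.cong₂ _+_ (≡.cong ⟦_⟧ (P≗Q zero)) (count-cong (P≗Q ∘ suc))

count-∖ : ∀ {n} (P : Fin n → Bool) j → P j ≡ true → count P ≡ suc (count (P ∖ j))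
count-∖ P zero    Pj rewrite Pj = ≡.refl
count-∖ P (suc j) Pj = ≡.trans (≡.cong (⟦ P zero ⟧ +_) (count-∖ (P ∘ suc) j Pj)) (ℕₚ.+-suc ⟦ P zero ⟧ _)

∖-true : ∀ {n} (P : Fin n → Bool) j i → P i ≡ true → i ≢ j → (P ∖ j) i ≡ true
∖-true P j i Pi i≢j with i Fin.≟ j
... | yes i≡j = contradiction i≡j i≢j
... | no  _   = Pi

∖-false : ∀ {n} (P : Fin n → Bool) j i → P i ≡ false → (P ∖ j) i ≡ false
∖-false P j i Pi with i Fin.≟ j
... | yes _ = ≡.refl
... | no  _ = Pi

∖-self : ∀ {n} (P : Fin n → Bool) j → (P ∖ j) j ≡ false
∖-self P j with j Fin.≟ j
... | yes _   = ≡.refl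
... | no  j≢j = contradiction ≡.refl j≢j

0<count⇒∃ : ∀ {n} (P : Fin n → Bool) → 0 < count P → ∃ λ i → P i ≡ true
0<count⇒∃ {suc n} P 0<c with P zero in eq
... | true  = zero , eq
... | false with i , Pi ← 0<count⇒∃ (P ∘ suc) 0<c = suc i , Pi

module LinearAlgebra {c ℓ₁ ℓ₂ : Level} (K : HeytingField c ℓ₁ ℓ₂)
                     (_#?_ : Decidable (HeytingField._#_ K)) where

  open HeytingField K using (_#_; tight; #⇒invertible; invertible⇒#)
  open CommutativeRing (HeytingCommutativeRing.commutativeRing (HeytingField.heytingCommutativeRing K)) public
    hiding (zero) renaming (_+_ to _+ᴷ_; _*_ to _*ᴷ_; -_ to -ᴷ_; _-_ to _-ᴷ_)
  import Algebra.Properties.Semiring.Sum semiring as Sum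
  open import Algebra.Properties.Ring ring public
    using (-‿distribˡ-*; -‿distribʳ-*; -0#≈0#; -‿+-comm; x∙y⁻¹≈ε⇒x≈y; -1*x≈-x)
  open import Relation.Binary.Reasoning.Setoid setoid

  1≉0 : ¬ 1# ≈ 0#
  1≉0 1≈0 = proj₂ (tight 1# 0#) 1≈0 (invertible⇒# (1# , 1*[1-0] , trans (*-comm _ _) 1*[1-0]))
    where
    1*[1-0] : 1# *ᴷ (1# -ᴷ 0#) ≈ 1#
    1*[1-0] = trans (*-identityˡ _) (trans (+-congˡ -0#≈0#) (+-identityʳ 1#))

  zero-or-unit : ∀ x → x ≈ 0# ⊎ ∃ λ y → x *ᴷ y ≈ 1#
  zero-or-unit x with x #? 0#
  ... | no ¬x#0 = inj₁ (proj₁ (tight x 0#) ¬x#0)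
  ... | yes x#0 with y , _ , r ← #⇒invertible x#0 =
    inj₂ (y , trans (*-congʳ (sym (trans (+-congˡ -0#≈0#) (+-identityʳ x)))) r)

  δ : ∀ {n} → Fin n → Vector Carrier n
  δ i j = if does (i Fin.≟ j) then 1# else 0#

  opaque
    ∑ : ∀ {n} → Vector Carrier n → Carrier
    ∑ = Sum.sum

    ∑-cong : ∀ {n} {f g : Vector Carrier n} → (∀ i → f i ≈ g i) → ∑ f ≈ ∑ g
    ∑-cong = Sum.sum-cong-≋

    ∑-zero : ∀ {n} {f : Vector Carrier n} → (∀ i → f i ≈ 0#) → ∑ f ≈ 0#
    ∑-zero {n} f≈0 = trans (∑-cong f≈0) (Sum.sum-replicate-zero n)

    ∑-+ : ∀ {n} (f g : Vector Carrier n) → ∑ (λ i → f i +ᴷ g i) ≈ ∑ f +ᴷ ∑ g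
    ∑-+ = Sum.∑-distrib-+

    ∑-comm : ∀ {m n} (f : Fin m → Fin n → Carrier) → ∑ (λ i → ∑ (f i)) ≈ ∑ (λ j → ∑ λ i → f i j)
    ∑-comm = Sum.∑-comm

    ∑-*ˡ : ∀ {n} x (f : Vector Carrier n) → ∑ (λ i → x *ᴷ f i) ≈ x *ᴷ ∑ f
    ∑-*ˡ x f = sym (Sum.*-distribˡ-sum x f)

    ∑-*ʳ : ∀ {n} (f : Vector Carrier n) x → ∑ (λ i → f i *ᴷ x) ≈ ∑ f *ᴷ x
    ∑-*ʳ f x = sym (Sum.*-distribʳ-sum x f)

    ∑-split : ∀ m {n} (f : Vector Carrier (m + n)) →
              ∑ f ≈ ∑ (λ i → f (i ↑ˡ n)) +ᴷ ∑ (λ i → f (m ↑ʳ i))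
    ∑-split zero    f = sym (+-identityˡ _)
    ∑-split (suc m) f = trans (+-congˡ (∑-split m (f ∘ suc))) (sym (+-assoc _ _ _))

    ∑-δ : ∀ {n} (f : Vector Carrier n) i → ∑ (λ j → f j *ᴷ δ i j) ≈ f i
    ∑-δ {suc n} f zero = trans (+-cong (*-identityʳ _) (∑-zero λ j → zeroʳ (f (suc j)))) (+-identityʳ _)
    ∑-δ {suc n} f (suc i) = trans (+-cong (zeroʳ _) (∑-δ (f ∘ suc) i)) (+-identityˡ _)

    ∑-suc : ∀ {n} (f : Vector Carrier (suc n)) → ∑ f ≈ f zero +ᴷ ∑ (f ∘ suc)
    ∑-suc f = refl

  x-y+y≈x : ∀ x y → (x -ᴷ y) +ᴷ y ≈ x
  x-y+y≈x x y = trans (+-assoc _ _ _) (trans (+-congˡ (-‿inverseˡ y)) (+-identityʳ x))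

  ∑-neg : ∀ {n} (f : Vector Carrier n) → ∑ (λ i → -ᴷ f i) ≈ -ᴷ ∑ f
  ∑-neg f = trans (∑-cong λ i → sym (-1*x≈-x (f i))) (trans (∑-*ˡ _ f) (-1*x≈-x _))

  δ-diag : ∀ {n} (i : Fin n) → δ i i ≈ 1#
  δ-diag i with i Fin.≟ i
  ... | yes _   = refl
  ... | no  i≢i = contradiction ≡.refl i≢i

  δ-off : ∀ {n} (i j : Fin n) → i ≢ j → δ i j ≈ 0#
  δ-off i j i≢j with i Fin.≟ j
  ... | yes i≡j = contradiction i≡j i≢j
  ... | no  _   = refl

  lin : ∀ {m n} → Vector Carrier m → (Fin m → Vector Carrier n) → Vector Carrier n
  lin a z p = ∑ λ j → a j *ᴷ z j p

  -- Rows and columns are masked rather than deleted, so elimination never reindexes columns, and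
  -- `basis-size` can restrict rows or columns to the coordinates in S.
  Dependency : ∀ {m n} (B : Fin m → Fin n → Carrier) (R : Fin m → Bool) (S : Fin n → Bool) → Set (c ⊔ ℓ₁)
  Dependency {n = n} B R S = ∃ λ (a : Vector Carrier n) → (∃ λ j → ¬ a j ≈ 0#) × (∀ j → S j ≡ false → a j ≈ 0#)
                           × (∀ r → R r ≡ true → ∑ (λ j → B r j *ᴷ a j) ≈ 0#)

  private
    pivot? : ∀ {n} (S : Fin n → Bool) (f : Vector Carrier n) →
             (∀ j → S j ≡ true → f j ≈ 0#) ⊎ (∃ λ j → S j ≡ true × ∃ λ y → f j *ᴷ y ≈ 1#)
    pivot? {zero}  S f = inj₁ λ ()
    pivot? {suc n} S f with S zero in eq | zero-or-unit (f zero) | pivot? (S ∘ suc) (f ∘ suc)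
    ... | true  | inj₂ u | _ = inj₂ (zero , eq , u)
    ... | _     | _      | inj₂ (j , Sj , u) = inj₂ (suc j , Sj , u)
    ... | _     | inj₁ z | inj₁ zs = inj₁ λ { zero _ → z ; (suc j) → zs j }
    ... | false | _      | inj₁ zs = inj₁
        λ { zero S0 → contradiction (≡.trans (≡.sym eq) S0) λ () ; (suc j) → zs j }

  -- More unknowns than equations. A first row that vanishes on S imposes nothing; otherwise one of
  -- its units is a pivot, whose column leaves S together with the row, so the strict inequality
  -- survives.
  dependency : ∀ {m n} (B : Fin m → Fin n → Carrier) (R : Fin m → Bool) (S : Fin n → Bool) →
               count R < count S → Dependency B R S
  dependency {zero} B R S R<S with j , Sj ← 0<count⇒∃ S R<S =
    δ j , (j , λ δ≈0 → 1≉0 (trans (sym (δ-diag j)) δ≈0)) ,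
    (λ i Si → δ-off j i λ { ≡.refl → contradiction (≡.trans (≡.sym Sj) Si) λ () }) , λ ()
  dependency {suc m} B R S R<S with R zero in R0
  ... | false with a , a≢0 , supp , rel ← dependency (B ∘ suc) (R ∘ suc) S R<S =
    a , a≢0 , supp , λ { zero R0′ → contradiction (≡.trans (≡.sym R0) R0′) λ () ; (suc r) → rel r }
  ... | true with pivot? S (B zero)
  ...   | inj₁ row≈0 with a , a≢0 , supp , rel ← dependency (B ∘ suc) (R ∘ suc) S (ℕₚ.<-trans (ℕₚ.n<1+n _) R<S) =
    a , a≢0 , supp , λ { zero _ → ∑-zero λ j → term≈0 j (S j) ≡.refl ; (suc r) → rel r }
    where
    term≈0 : ∀ j s → S j ≡ s → B zero j *ᴷ a j ≈ 0#
    term≈0 j true  Sj = trans (*-congʳ (row≈0 j Sj)) (zeroˡ _)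
    term≈0 j false Sj = trans (*-congˡ (supp j Sj)) (zeroʳ _)
  ...   | inj₂ (j , Sj , y , B0j*y≈1) =
    a , (i₀ , a≢0) , supp , λ { zero _ → row0 ; (suc r) → row r }
    where
    -- The remaining rows after subtracting the multiple of row zero that clears column j.
    B′ : Fin m → Fin _ → Carrier
    B′ r l = B (suc r) l +ᴷ (-ᴷ (B (suc r) j *ᴷ y)) *ᴷ B zero l
    ih : Dependency B′ (R ∘ suc) (S ∖ j)
    ih = dependency B′ (R ∘ suc) (S ∖ j) (ℕₚ.≤-pred (≡.subst (suc (suc _) ≤_) (count-∖ S j Sj) R<S))
    a′ : Vector Carrier _
    a′ = proj₁ ih
    i₀ : Fin _
    i₀ = proj₁ (proj₁ (proj₂ ih))
    s : Carrier
    s = ∑ λ l → B zero l *ᴷ a′ l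
    -- The value at the pivot is forced: it has to cancel s in row zero, where the pivot entry has
    -- inverse y.
    t : Carrier
    t = -ᴷ (y *ᴷ s)
    a : Vector Carrier _
    a l = a′ l +ᴷ t *ᴷ δ j l
    a≈a′ : ∀ l → l ≢ j → a l ≈ a′ l
    a≈a′ l l≢j = trans (+-congˡ (trans (*-congˡ (δ-off j l (l≢j ∘ ≡.sym))) (zeroʳ _))) (+-identityʳ _)
    a′j≈0 : a′ j ≈ 0#
    a′j≈0 = proj₁ (proj₂ (proj₂ ih)) j (∖-self S j)
    a≢0 : ¬ a i₀ ≈ 0#
    a≢0 a≈0 with i₀ Fin.≟ j
    ... | yes i₀≡j = proj₂ (proj₁ (proj₂ ih)) (≡.subst (λ i → a′ i ≈ 0#) (≡.sym i₀≡j) a′j≈0)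
    ... | no  i₀≢j = proj₂ (proj₁ (proj₂ ih)) (trans (sym (a≈a′ i₀ i₀≢j)) a≈0)
    supp : ∀ i → S i ≡ false → a i ≈ 0#
    supp i Si = trans (a≈a′ i λ { ≡.refl → contradiction (≡.trans (≡.sym Sj) Si) λ () })
                      (proj₁ (proj₂ (proj₂ ih)) i (∖-false S j i Si))
    expand : ∀ (f : Vector Carrier _) → ∑ (λ l → f l *ᴷ a l) ≈ ∑ (λ l → f l *ᴷ a′ l) +ᴷ f j *ᴷ t
    expand f = begin
      ∑ (λ l → f l *ᴷ a l)                                       ≈⟨ ∑-cong
          (λ l → trans (distribˡ (f l) _ _) (+-congˡ (sym (*-assoc _ _ _)))) ⟩
      ∑ (λ l → f l *ᴷ a′ l +ᴷ f l *ᴷ t *ᴷ δ j l)                ≈⟨ ∑-+ _ _ ⟩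
      ∑ (λ l → f l *ᴷ a′ l) +ᴷ ∑ (λ l → f l *ᴷ t *ᴷ δ j l)   ≈⟨ +-congˡ (∑-δ (λ l → f l *ᴷ t) j) ⟩
      ∑ (λ l → f l *ᴷ a′ l) +ᴷ f j *ᴷ t                         ∎
    row0 : ∑ (λ l → B zero l *ᴷ a l) ≈ 0#
    row0 = begin
      ∑ (λ l → B zero l *ᴷ a l)      ≈⟨ expand (B zero) ⟩
      s +ᴷ B zero j *ᴷ -ᴷ (y *ᴷ s)    ≈⟨ +-congˡ
          (trans (sym (-‿distribʳ-* _ _))
              (-‿cong (trans (sym (*-assoc _ _ _)) (trans (*-congʳ B0j*y≈1) (*-identityˡ _))))) ⟩
      s -ᴷ s                           ≈⟨ -‿inverseʳ s ⟩
      0#                               ∎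
    row : ∀ r → R (suc r) ≡ true → ∑ (λ l → B (suc r) l *ᴷ a l) ≈ 0#
    row r Rr = begin
      ∑ (λ l → B (suc r) l *ᴷ a l)                               ≈⟨ expand (B (suc r)) ⟩
      ∑ (λ l → B (suc r) l *ᴷ a′ l) +ᴷ B (suc r) j *ᴷ t         ≈⟨ +-congˡ same ⟩
      ∑ (λ l → B (suc r) l *ᴷ a′ l) +ᴷ ∑ (λ l → u *ᴷ (B zero l *ᴷ a′ l))  ≈⟨ ∑-+ _ _ ⟨
      ∑ (λ l → B (suc r) l *ᴷ a′ l +ᴷ u *ᴷ (B zero l *ᴷ a′ l))  ≈⟨ ∑-cong
          (λ l → trans (+-congˡ (sym (*-assoc _ _ _))) (sym (distribʳ (a′ l) _ _))) ⟩
      ∑ (λ l → B′ r l *ᴷ a′ l)                                   ≈⟨ proj₂ (proj₂ (proj₂ ih)) r Rr ⟩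
      0#                                                           ∎
      where
      u : Carrier
      u = -ᴷ (B (suc r) j *ᴷ y)
      same : B (suc r) j *ᴷ t ≈ ∑ (λ l → u *ᴷ (B zero l *ᴷ a′ l))
      same = begin
        B (suc r) j *ᴷ -ᴷ (y *ᴷ s)    ≈⟨ -‿distribʳ-* _ _ ⟨
        -ᴷ (B (suc r) j *ᴷ (y *ᴷ s))  ≈⟨ -‿cong (*-assoc _ _ _) ⟨
        -ᴷ (B (suc r) j *ᴷ y *ᴷ s)    ≈⟨ -‿distribˡ-* _ _ ⟩
        u *ᴷ s                         ≈⟨ ∑-*ˡ u _ ⟨
        ∑ (λ l → u *ᴷ (B zero l *ᴷ a′ l)) ∎

  -- Either strict inequality would produce, by elimination, a forbidden linear relation.
  basis-size : ∀ {m n} (S : Fin n → Bool) (z : Fin m → Vector Carrier n) →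
               (∀ j p → S p ≡ false → z j p ≈ 0#) →
               (∀ v → (∀ p → S p ≡ false → v p ≈ 0#) → ∃ λ a → ∀ p → v p ≈ lin a z p) →
               (∀ a → (∀ p → lin a z p ≈ 0#) → ∀ j → a j ≈ 0#) →
               count S ≡ m
  basis-size {m} {n} S z z-supp span indep = ℕₚ.≤-antisym (ℕₚ.≮⇒≥ too-few) (ℕₚ.≮⇒≥ too-many)
    where
    full : ∀ m → count {m} (λ _ → true) ≡ m
    full zero    = ≡.refl
    full (suc m) = ≡.cong suc (full m)
    too-many : ¬ count S < m
    too-many S<m with a , (j , aj≢0) , _ , rel ← dependency (λ p i → z i p) S (λ _ → true) (≡.subst (count S <_) (≡.sym (full m)) S<m) =
      aj≢0 (indep a (λ p → zero-at p (S p) ≡.refl) j)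
      where
      zero-at : ∀ p s → S p ≡ s → lin a z p ≈ 0#
      zero-at p true  Sp = trans (∑-cong λ j → *-comm (a j) (z j p)) (rel p Sp)
      zero-at p false Sp = ∑-zero λ j → trans (*-congˡ (z-supp j p Sp)) (zeroʳ _)
    -- Zero for q outside S, so that every `e q` meets the support condition of `span` and can be
    -- expanded in z.
    e : Fin n → Vector Carrier n
    e q p = if S q then δ q p else 0#
    e-supp : ∀ q p → S p ≡ false → e q p ≈ 0#
    e-supp q p Sp with S q in Sq
    ... | false = refl
    ... | true  = δ-off q p λ { ≡.refl → contradiction (≡.trans (≡.sym Sq) Sp) λ () }
    A : Fin m → Fin n → Carrier
    A j q = proj₁ (span (e q) (e-supp q)) j
    -- Some non-trivial combination of the `e q` has all its z-coordinates zero, hence is zero, yet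
    -- its q-th entry is the non-zero `a q`.
    too-few : ¬ m < count S
    too-few m<S with a , (q , aq≢0) , supp , rel ← dependency A (λ _ → true) S (≡.subst (_< count S) (≡.sym (full m)) m<S) =
      aq≢0 (≈0 (S q) ≡.refl)
      where
      ≈0 : ∀ s → S q ≡ s → a q ≈ 0#
      ≈0 false Sq = supp q Sq
      ≈0 true  Sq = begin
        a q                                             ≈⟨ ∑-δ a q ⟨
        ∑ (λ i → a i *ᴷ δ q i)                        ≈⟨ ∑-cong swap ⟩
        ∑ (λ i → a i *ᴷ e i q)                        ≈⟨ ∑-cong (λ i → *-congˡ (proj₂ (span (e i) (e-supp i)) q)) ⟩
        ∑ (λ i → a i *ᴷ ∑ (λ j → A j i *ᴷ z j q))  ≈⟨ ∑-cong (λ i → sym (∑-*ˡ (a i) _)) ⟩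
        ∑ (λ i → ∑ (λ j → a i *ᴷ (A j i *ᴷ z j q))) ≈⟨ ∑-comm _ ⟩
        ∑ (λ j → ∑ (λ i → a i *ᴷ (A j i *ᴷ z j q))) ≈⟨ ∑-zero
            (λ j → trans (∑-cong λ i → trans (sym (*-assoc _ _ _)) (*-congʳ (*-comm (a i) (A j i))))
                (trans (∑-*ʳ _ (z j q)) (trans (*-congʳ (rel j ≡.refl)) (zeroˡ _)))) ⟩
        0#                                              ∎
        where
        swap : ∀ i → a i *ᴷ δ q i ≈ a i *ᴷ e i q
        swap i with S i in Si
        ... | false = trans (trans (*-congʳ (supp i Si)) (zeroˡ _)) (sym (zeroʳ _))
        ... | true with q Fin.≟ i
        ...   | yes ≡.refl = *-congˡ (sym (δ-diag i))
        ...   | no  q≢i    = *-congˡ (sym (δ-off i q (q≢i ∘ ≡.sym)))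

-- Strands of multigraded complexes

Degree : ℕ → Set
Degree n = Fin n → ℕ

infix 4 _⊑_ _⊑?_

_⊑_ : ∀ {n} → Degree n → Degree n → Set
a ⊑ b = ∀ x → a x ≤ b x

opaque
  _⊑?_ : ∀ {n} (a b : Degree n) → Dec (a ⊑ b)
  a ⊑? b = Finₚ.all? λ x → a x ℕ.≤? b x

⊑-refl : ∀ {n} {a : Degree n} → a ⊑ a
⊑-refl x = ℕₚ.≤-refl

⊑-trans : ∀ {n} {a b c : Degree n} → a ⊑ b → b ⊑ c → a ⊑ c
⊑-trans a⊑b b⊑c x = ℕₚ.≤-trans (a⊑b x) (b⊑c x)

module GradedComplex {c ℓ₁ ℓ₂ : Level} (K : HeytingField c ℓ₁ ℓ₂)
                     (_#?_ : Decidable (HeytingField._#_ K)) (n : ℕ) where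

  open LinearAlgebra K _#?_ public
  open import Relation.Binary.Reasoning.Setoid setoid

  -- A complex of ℕⁿ-graded free modules over K[x₁,…,xₙ]: a homogeneous map
  -- ⨁ R(−a_q) → ⨁ R(−b_p) has entries (scalar)·x^{a_q−b_p}, and only the scalars are recorded.
  record Complex : Set (c ⊔ ℓ₁) where
    field
      rank : ℕ → ℕ
      deg  : ∀ i → Fin (rank i) → Degree n
      ∂    : ∀ i → Fin (rank i) → Fin (rank (suc i)) → Carrier

    V : ℕ → Set c
    V i = Vector Carrier (rank i)

    D : ∀ i → V (suc i) → V i
    D i v p = ∑ λ q → ∂ i p q *ᴷ v q

    -- The vectors supported below b form the strand of degree b.
    Supp : ∀ i → Degree n → V i → Set ℓ₁
    Supp i b v = ∀ p → ¬ deg i p ⊑ b → v p ≈ 0#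

    field
      -- Composites are only required to vanish inside a strand: a scalar vector is lifted to
      -- polynomials by homogenizing it in some degree b, and b must lie above its support.
      ∂-mono : ∀ i p q → ¬ deg i p ⊑ deg (suc i) q → ∂ i p q ≈ 0#
      ∂∂     : ∀ i b w → Supp (suc (suc i)) b w → ∀ p → D i (D (suc i) w) p ≈ 0#

    𝟘 : ∀ i → V i
    𝟘 i _ = 0#

    _⊞_ : ∀ {m} → Vector Carrier m → Vector Carrier m → Vector Carrier m
    (v ⊞ w) p = v p +ᴷ w p

    _⊟_ : ∀ {m} → Vector Carrier m → Vector Carrier m → Vector Carrier m
    (v ⊟ w) p = v p -ᴷ w p

    -- Equality in the quotient by the basis elements of degree not above l.  For l equal to b on a
    -- set X of coordinates and to 0 elsewhere, the strand of degree b modulo Eq l is the strand of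
    -- the complex tensored with R/(x_j : j ∈ X).
    Eq : ∀ i → Degree n → V i → V i → Set ℓ₁
    Eq i l v w = ∀ p → l ⊑ deg i p → v p ≈ w p

    Cycle : ∀ i → Degree n → V (suc i) → Set ℓ₁
    Cycle i l v = Eq i l (D i v) (𝟘 i)

    -- Homology at `V (suc i)`: the index is that of the outgoing differential. The dimension is
    -- witnessed by cycles forming a basis modulo boundaries.
    record Hdim (l b : Degree n) (i g : ℕ) : Set (c ⊔ ℓ₁) where
      field
        z       : Fin g → V (suc i)
        z-supp  : ∀ j → Supp (suc i) b (z j)
        z-cycle : ∀ j → Cycle i l (z j)
        span    : ∀ v → Supp (suc i) b v → Cycle i l v →
                  ∃ λ a → ∃ λ w → Supp (suc (suc i)) b w × Eq (suc i) l v (lin a z ⊞ D (suc i) w)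
        indep   : ∀ a w → Supp (suc (suc i)) b w → Eq (suc i) l (lin a z) (D (suc i) w) → ∀ j → a j ≈ 0#

    Acyclic : Degree n → Degree n → Set (c ⊔ ℓ₁)
    Acyclic l b = ∀ i → Hdim l b i 0

    Concentrated : Degree n → Degree n → ℕ → ℕ → Set (c ⊔ ℓ₁)
    Concentrated l b s g = Hdim l b s g × (∀ i → i ≢ s → Hdim l b i 0)

  module _ (C : Complex) where

    open Complex C

    -- By `∂-mono` the differential only goes down in degree, so the basis elements not above l span
    -- a subcomplex and D descends to the quotient by it.
    D-Eq : ∀ i {l v w} → Eq (suc i) l v w → Eq i l (D i v) (D i w)
    D-Eq i {l} {v} {w} v~w p l⊑p = ∑-cong term
      where
      term : ∀ q → ∂ i p q *ᴷ v q ≈ ∂ i p q *ᴷ w q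
      term q with deg i p ⊑? deg (suc i) q
      ... | yes p⊑q = *-congˡ (v~w q (⊑-trans {a = l} l⊑p p⊑q))
      ... | no  p⋢q = trans (trans (*-congʳ (∂-mono i p q p⋢q)) (zeroˡ _))
                            (sym (trans (*-congʳ (∂-mono i p q p⋢q)) (zeroˡ _)))

    D-Supp : ∀ i {b v} → Supp (suc i) b v → Supp i b (D i v)
    D-Supp i {b} {v} v∈U p p⋢b = ∑-zero term
      where
      term : ∀ q → ∂ i p q *ᴷ v q ≈ 0#
      term q with deg i p ⊑? deg (suc i) q
      ... | yes p⊑q = trans (*-congˡ (v∈U q λ q⊑b → p⋢b (⊑-trans {b = deg (suc i) q} p⊑q q⊑b))) (zeroʳ _)
      ... | no  p⋢q = trans (*-congʳ (∂-mono i p q p⋢q)) (zeroˡ _)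

    D-⊞ : ∀ i v w p → D i (v ⊞ w) p ≈ D i v p +ᴷ D i w p
    D-⊞ i v w p = trans (∑-cong λ q → distribˡ _ _ _) (∑-+ _ _)

    D-⊟ : ∀ i v w p → D i (v ⊟ w) p ≈ D i v p -ᴷ D i w p
    D-⊟ i v w p = trans (∑-cong λ q → trans (distribˡ _ _ _) (+-congˡ (sym (-‿distribʳ-* _ _))))
                        (trans (∑-+ _ _) (+-congˡ (∑-neg _)))

    D-lin : ∀ i {m} a (z : Fin m → V (suc i)) p → D i (lin a z) p ≈ lin a (D i ∘ z) p
    D-lin i a z p = begin
      ∑ (λ q → ∂ i p q *ᴷ ∑ (λ j → a j *ᴷ z j q))     ≈⟨ ∑-cong (λ q → sym (∑-*ˡ _ _)) ⟩
      ∑ (λ q → ∑ (λ j → ∂ i p q *ᴷ (a j *ᴷ z j q)))   ≈⟨ ∑-comm _ ⟩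
      ∑ (λ j → ∑ (λ q → ∂ i p q *ᴷ (a j *ᴷ z j q)))   ≈⟨ ∑-cong
          (λ j → trans (∑-cong λ q → x∙yz≈y∙xz _ _ _) (∑-*ˡ _ _)) ⟩
      ∑ (λ j → a j *ᴷ ∑ (λ q → ∂ i p q *ᴷ z j q))     ∎
      where open import Algebra.Properties.CommutativeSemigroup *-commutativeSemigroup using (x∙yz≈y∙xz)

    D-𝟘 : ∀ i p → D i (𝟘 (suc i)) p ≈ 0#
    D-𝟘 i p = ∑-zero λ q → zeroʳ _

    Supp-⊑ : ∀ i {b b′ v} → b′ ⊑ b → Supp i b′ v → Supp i b v
    Supp-⊑ i b′⊑b v∈U p p⋢b = v∈U p λ p⊑b′ → p⋢b (⊑-trans {a = deg i p} p⊑b′ b′⊑b)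

    Supp-𝟘 : ∀ i {b} → Supp i b (𝟘 i)
    Supp-𝟘 i p _ = refl

    Supp-⊞ : ∀ i {b v w} → Supp i b v → Supp i b w → Supp i b (v ⊞ w)
    Supp-⊞ i v∈U w∈U p p⋢b = trans (+-cong (v∈U p p⋢b) (w∈U p p⋢b)) (+-identityˡ _)

    Supp-⊟ : ∀ i {b v w} → Supp i b v → Supp i b w → Supp i b (v ⊟ w)
    Supp-⊟ i v∈U w∈U p p⋢b = trans (+-cong (v∈U p p⋢b) (trans (-‿cong (w∈U p p⋢b)) -0#≈0#)) (+-identityˡ _)

    Supp-lin : ∀ i {b m} a {z : Fin m → V i} → (∀ j → Supp i b (z j)) → Supp i b (lin a z)
    Supp-lin i a z∈U p p⋢b = ∑-zero λ j → trans (*-congˡ (z∈U j p p⋢b)) (zeroʳ _)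

    restrict : ∀ i → Degree n → V i → V i
    restrict i b v p = if does (deg i p ⊑? b) then v p else 0#

    restrict-Supp : ∀ i b v → Supp i b (restrict i b v)
    restrict-Supp i b v p p⋢b with deg i p ⊑? b
    ... | yes p⊑b = contradiction p⊑b p⋢b
    ... | no  _   = refl

    lin-++ : ∀ {k₁ k₂ m} (a : Vector Carrier (k₁ + k₂)) (z₁ : Fin k₁ → Vector Carrier m)
        (z₂ : Fin k₂ → Vector Carrier m) p →
             lin a (z₁ ++ z₂) p ≈ lin (a ∘ (_↑ˡ k₂)) z₁ p +ᴷ lin (a ∘ (k₁ ↑ʳ_)) z₂ p
    lin-++ {k₁} {k₂} a z₁ z₂ p = trans (∑-split k₁ _)
      (+-cong (∑-cong λ j → *-congˡ (reflexive (≡.cong (λ v → v p) (lookup-++ˡ z₁ z₂ j))))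
              (∑-cong λ j → *-congˡ (reflexive (≡.cong (λ v → v p) (lookup-++ʳ z₁ z₂ j)))))

    -- The box [l,b] of degrees is the disjoint union of the sub-box [l,b′] and the quotient box [l′,b].
    record Step (l b l′ b′ : Degree n) : Set where
      field
        b′⊑b     : b′ ⊑ b
        l⊑l′     : l ⊑ l′
        disjoint : ∀ p → p ⊑ b′ → ¬ l′ ⊑ p
        cover    : ∀ p → p ⊑ b → l ⊑ p → p ⊑ b′ ⊎ l′ ⊑ p

      Eq-l′ : ∀ i {v w} → Eq i l v w → Eq i l′ v w
      Eq-l′ i v~w p l′⊑p = v~w p (⊑-trans {a = l} l⊑l′ l′⊑p)

      Supp-b′⇒Eq-l′ : ∀ i {v} → Supp i b′ v → Eq i l′ v (𝟘 i)
      Supp-b′⇒Eq-l′ i v∈U′ p l′⊑p = v∈U′ p λ p⊑b′ → disjoint (deg i p) p⊑b′ l′⊑p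

      -- Exactness in the middle of sub-box → box → quotient box: by `cover`, a basis element of the
      -- box outside the sub-box is seen by the quotient box.
      restrict-Eq : ∀ i v → Supp i b v → Eq i l′ v (𝟘 i) → Eq i l (restrict i b′ v) v
      restrict-Eq i v v∈U v~0 p l⊑p with deg i p ⊑? b′
      ... | yes _ = refl
      ... | no p⋢b′ with deg i p ⊑? b
      ...   | no p⋢b = sym (v∈U p p⋢b)
      ...   | yes p⊑b with cover (deg i p) p⊑b l⊑p
      ...     | inj₁ p⊑b′ = contradiction p⊑b′ p⋢b′
      ...     | inj₂ l′⊑p = sym (v~0 p l′⊑p)

    -- The map induced on homology by the inclusion of the sub-box into the box is zero at this
    -- index.
    ZeroMap : (l b′ b : Degree n) → ℕ → Set (c ⊔ ℓ₁)
    ZeroMap l b′ b i = ∀ v → Supp (suc i) b′ v → Cycle i l v →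
                       ∃ λ w → Supp (suc (suc i)) b w × Eq (suc i) l v (D (suc i) w)

    boundary : ∀ {l b i} → Hdim l b i 0 → ∀ v → Supp (suc i) b v → Cycle i l v →
               ∃ λ w → Supp (suc (suc i)) b w × Eq (suc i) l v (D (suc i) w)
    boundary H v v∈U cyc with a , w , w∈U , v~ ← Hdim.span H v v∈U cyc =
      w , w∈U , λ p l⊑p → trans (v~ p l⊑p) (trans (+-congʳ (∑-zero λ ())) (+-identityˡ _))

    source-zero : ∀ {l b′ b i} → b′ ⊑ b → Hdim l b′ i 0 → ZeroMap l b′ b i
    source-zero {i = i} b′⊑b H v v∈U cyc with w , w∈U , v~ ← boundary H v v∈U cyc =
      w , Supp-⊑ (suc (suc i)) b′⊑b w∈U , v~

    target-zero : ∀ {l b′ b i} → b′ ⊑ b → Hdim l b i 0 → ZeroMap l b′ b i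
    target-zero {i = i} b′⊑b H v v∈U = boundary H v (Supp-⊑ (suc i) b′⊑b v∈U)

    zero-Hdim : ∀ {l b i} →
                (∀ v → Supp (suc i) b v → Cycle i l v → ∃ λ w → Supp (suc (suc i)) b w × Eq (suc i) l v
                    (D (suc i) w)) →
                Hdim l b i 0
    zero-Hdim bd = record
      { z = λ () ; z-supp = λ () ; z-cycle = λ ()
      ; span = λ v v∈U cyc → let w , w∈U , v~ = bd v v∈U cyc in
                             (λ ()) , w , w∈U , λ p l⊑p → trans (v~ p l⊑p)
                                 (sym (trans (+-congʳ (∑-zero λ ())) (+-identityˡ _)))
      ; indep = λ _ _ _ _ () }

    private
      ≈⇒-≈0 : ∀ {x y} → x ≈ y → x -ᴷ y ≈ 0#
      ≈⇒-≈0 {x} {y} x≈y = trans (+-congʳ x≈y) (-‿inverseʳ y)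

      open import Algebra.Properties.CommutativeSemigroup +-commutativeSemigroup
        using (interchange; xy∙z≈xz∙y; x∙yz≈xz∙y)

    -- With both induced maps zero, the long exact sequence breaks into 0 → H(box) → H(quotient box)
    -- → H(sub-box) → 0, the index dropping by one at the last term. A basis in the middle is that
    -- of the box followed by preimages `ẑ` of the sub-box basis under the connecting map.
    exact-sequence : ∀ {l b l′ b′ i g₁ g₂} → Step l b l′ b′ →
                     Hdim l b (suc i) g₁ → Hdim l b′ i g₂ →
                     ZeroMap l b′ b (suc i) → ZeroMap l b′ b i →
                     Hdim l′ b (suc i) (g₁ + g₂)
    exact-sequence {l} {b} {l′} {b′} {i} {g₁} {g₂} step HB HA ζ₁ ζ₀ = record
      { z = B.z ++ ẑ
      ; z-supp = λ j → supp j
      ; z-cycle = λ j → cycle j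
      ; span = span
      ; indep = indep }
      where
      open Step step
      module A = Hdim HA
      module B = Hdim HB
      i₁ i₂ i₃ : ℕ
      i₁ = suc i
      i₂ = suc i₁
      i₃ = suc i₂

      lift : ∀ j → ∃ λ w → Supp i₂ b w × Eq i₁ l (A.z j) (D i₁ w)
      lift j = ζ₀ (A.z j) (A.z-supp j) (A.z-cycle j)
      ẑ : Fin g₂ → V i₂
      ẑ j = proj₁ (lift j)
      ẑ-supp : ∀ j → Supp i₂ b (ẑ j)
      ẑ-supp j = proj₁ (proj₂ (lift j))
      Dẑ : ∀ j → Eq i₁ l (A.z j) (D i₁ (ẑ j))
      Dẑ j = proj₂ (proj₂ (lift j))

      supp : ∀ j → Supp i₂ b ((B.z ++ ẑ) j)
      supp j with Fin.splitAt g₁ j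
      ... | inj₁ j₁ = B.z-supp j₁
      ... | inj₂ j₂ = ẑ-supp j₂

      cycle : ∀ j → Cycle i₁ l′ ((B.z ++ ẑ) j)
      cycle j with Fin.splitAt g₁ j
      ... | inj₁ j₁ = Eq-l′ i₁ (B.z-cycle j₁)
      ... | inj₂ j₂ = λ p l′⊑p → trans (sym (Eq-l′ i₁ (Dẑ j₂) p l′⊑p)) (Supp-b′⇒Eq-l′ i₁ (A.z-supp j₂) p l′⊑p)

      lin-ẑ : ∀ a → Eq i₁ l (D i₁ (lin a ẑ)) (lin a A.z)
      lin-ẑ a p l⊑p = trans (D-lin i₁ a ẑ p) (∑-cong λ j → *-congˡ (sym (Dẑ j p l⊑p)))

      span : ∀ v → Supp i₂ b v → Cycle i₁ l′ v →
             ∃ λ a → ∃ λ w → Supp i₃ b w × Eq i₂ l′ v (lin a (B.z ++ ẑ) ⊞ D i₂ w)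
      span v v∈U cyc = a₁ ++ a₂ , w , w∈U , λ p l′⊑p → begin
          v p                                          ≈⟨ x-y+y≈x _ _ ⟨
          (v ⊟ t) p +ᴷ t p                             ≈⟨ +-congʳ (Eq-l′ i₂ v-t~ p l′⊑p) ⟩
          (lin a₁ B.z p +ᴷ D i₂ w p) +ᴷ t p            ≈⟨ +-congˡ
              (trans (+-congˡ (Supp-b′⇒Eq-l′ i₂ w′∈U p l′⊑p)) (+-identityʳ _)) ⟩
          (lin a₁ B.z p +ᴷ D i₂ w p) +ᴷ lin a₂ ẑ p     ≈⟨ xy∙z≈xz∙y _ _ _ ⟩
          (lin a₁ B.z p +ᴷ lin a₂ ẑ p) +ᴷ D i₂ w p     ≈⟨ +-congʳ
              (+-cong (∑-cong λ j → *-congʳ (reflexive (lookup-++ˡ a₁ a₂ j)))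
                                                                           (∑-cong λ j → *-congʳ (reflexive
                                                                               (lookup-++ʳ a₁ a₂ j)))) ⟨
          (lin ((a₁ ++ a₂) ∘ (_↑ˡ g₂)) B.z p +ᴷ lin ((a₁ ++ a₂) ∘ (g₁ ↑ʳ_)) ẑ p) +ᴷ D i₂ w p  ≈⟨ +-congʳ
              (lin-++ (a₁ ++ a₂) B.z ẑ p) ⟨
          lin (a₁ ++ a₂) (B.z ++ ẑ) p +ᴷ D i₂ w p      ∎
        where
        -- The connecting map applied to v: `D i₁ v` dies in the quotient box, so up to `Eq l` it
        -- comes from the sub-box.
        u : V i₁
        u = restrict i₁ b′ (D i₁ v)
        u~Dv : Eq i₁ l u (D i₁ v)
        u~Dv = restrict-Eq i₁ (D i₁ v) (D-Supp i₁ v∈U) cyc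
        onA = A.span u (restrict-Supp i₁ b′ (D i₁ v)) λ p l⊑p → trans (D-Eq i u~Dv p l⊑p) (∂∂ i b v v∈U p)
        a₂ : Vector Carrier g₂
        a₂ = proj₁ onA
        w′ : V i₂
        w′ = proj₁ (proj₂ onA)
        w′∈U : Supp i₂ b′ w′
        w′∈U = proj₁ (proj₂ (proj₂ onA))
        t : V i₂
        t = lin a₂ ẑ ⊞ w′
        t∈U : Supp i₂ b t
        t∈U = Supp-⊞ i₂ (Supp-lin i₂ a₂ ẑ-supp) (Supp-⊑ i₂ b′⊑b w′∈U)
        v-t-cycle : Cycle i₁ l (v ⊟ t)
        v-t-cycle p l⊑p = trans (D-⊟ i₁ v t p) (≈⇒-≈0 (begin
          D i₁ v p                             ≈⟨ u~Dv p l⊑p ⟨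
          u p                                  ≈⟨ proj₂ (proj₂ (proj₂ onA)) p l⊑p ⟩
          lin a₂ A.z p +ᴷ D i₁ w′ p            ≈⟨ +-congʳ (lin-ẑ a₂ p l⊑p) ⟨
          D i₁ (lin a₂ ẑ) p +ᴷ D i₁ w′ p       ≈⟨ D-⊞ i₁ _ _ p ⟨
          D i₁ t p                             ∎))
        onB = B.span (v ⊟ t) (Supp-⊟ i₂ v∈U t∈U) v-t-cycle
        a₁ : Vector Carrier g₁
        a₁ = proj₁ onB
        w : V i₃
        w = proj₁ (proj₂ onB)
        w∈U : Supp i₃ b w
        w∈U = proj₁ (proj₂ (proj₂ onB))
        v-t~ : Eq i₂ l (v ⊟ t) (lin a₁ B.z ⊞ D i₂ w)
        v-t~ = proj₂ (proj₂ (proj₂ onB))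

      indep : ∀ a w → Supp i₃ b w → Eq i₂ l′ (lin a (B.z ++ ẑ)) (D i₂ w) → ∀ j → a j ≈ 0#
      indep a w w∈U rel = λ j → ≡.subst (λ k → a k ≈ 0#) (Finₚ.join-splitAt g₁ g₂ j) (by-side (Fin.splitAt g₁ j))
        where
        a₁ : Vector Carrier g₁
        a₁ = a ∘ (_↑ˡ g₂)
        a₂ : Vector Carrier g₂
        a₂ = a ∘ (g₁ ↑ʳ_)
        -- y vanishes in the quotient box, so it comes from y′ in the sub-box. The boundary of y′ is
        -- a relation among the `A.z j`, which kills a₂; then y′ is a cycle, bounds in the box by
        -- ζ₁, and the independence of `B.z` kills a₁.
        y : V i₂
        y = (lin a₁ B.z ⊞ lin a₂ ẑ) ⊟ D i₂ w
        y∈U : Supp i₂ b y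
        y∈U = Supp-⊟ i₂ (Supp-⊞ i₂ (Supp-lin i₂ a₁ B.z-supp) (Supp-lin i₂ a₂ ẑ-supp)) (D-Supp i₂ w∈U)
        y′ : V i₂
        y′ = restrict i₂ b′ y
        y′∈U : Supp i₂ b′ y′
        y′∈U = restrict-Supp i₂ b′ y
        y′~y : Eq i₂ l y′ y
        y′~y = restrict-Eq i₂ y y∈U λ p l′⊑p → ≈⇒-≈0 (trans (sym (lin-++ a B.z ẑ p)) (rel p l′⊑p))
        Dy′ : Eq i₁ l (lin a₂ A.z) (D i₁ y′)
        Dy′ p l⊑p = sym (begin
          D i₁ y′ p                                                   ≈⟨ D-Eq i₁ y′~y p l⊑p ⟩
          D i₁ y p                                                    ≈⟨ D-⊟ i₁ _ _ p ⟩
          D i₁ (lin a₁ B.z ⊞ lin a₂ ẑ) p -ᴷ D i₁ (D i₂ w) p           ≈⟨ +-cong (D-⊞ i₁ _ _ p)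
              (trans (-‿cong (∂∂ i₁ b w w∈U p)) -0#≈0#) ⟩
          (D i₁ (lin a₁ B.z) p +ᴷ D i₁ (lin a₂ ẑ) p) +ᴷ 0#            ≈⟨ +-identityʳ _ ⟩
          D i₁ (lin a₁ B.z) p +ᴷ D i₁ (lin a₂ ẑ) p                    ≈⟨ +-cong
              (trans (D-lin i₁ a₁ B.z p) (∑-zero λ j → trans (*-congˡ (B.z-cycle j p l⊑p)) (zeroʳ _)))
                  (lin-ẑ a₂ p l⊑p) ⟩
          0# +ᴷ lin a₂ A.z p                                          ≈⟨ +-identityˡ _ ⟩
          lin a₂ A.z p                                                ∎)
        a₂≈0 : ∀ j → a₂ j ≈ 0#
        a₂≈0 = A.indep a₂ y′ y′∈U Dy′
        y′-cycle : Cycle i₁ l y′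
        y′-cycle p l⊑p = trans (sym (Dy′ p l⊑p)) (∑-zero λ j → trans (*-congʳ (a₂≈0 j)) (zeroˡ _))
        bd = ζ₁ y′ y′∈U y′-cycle
        w″ : V i₃
        w″ = proj₁ bd
        a₁≈0 : ∀ j → a₁ j ≈ 0#
        a₁≈0 = B.indep a₁ (w ⊞ w″) (Supp-⊞ i₃ w∈U (proj₁ (proj₂ bd))) λ p l⊑p → begin
          lin a₁ B.z p                              ≈⟨ trans
              (+-congˡ (∑-zero λ j → trans (*-congʳ (a₂≈0 j)) (zeroˡ _))) (+-identityʳ _) ⟨
          lin a₁ B.z p +ᴷ lin a₂ ẑ p                ≈⟨ x-y+y≈x _ _ ⟨
          y p +ᴷ D i₂ w p                           ≈⟨ +-congʳ
              (trans (sym (y′~y p l⊑p)) (proj₂ (proj₂ bd) p l⊑p)) ⟩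
          D i₂ w″ p +ᴷ D i₂ w p                     ≈⟨ +-comm _ _ ⟩
          D i₂ w p +ᴷ D i₂ w″ p                     ≈⟨ D-⊞ i₂ _ _ p ⟨
          D i₂ (w ⊞ w″) p                           ∎
        by-side : ∀ s → a (Fin.join g₁ g₂ s) ≈ 0#
        by-side (inj₁ j) = a₁≈0 j
        by-side (inj₂ j) = a₂≈0 j

    rank-zero : ∀ {l b i} → rank (suc i) ≡ 0 → Hdim l b i 0
    rank-zero {i = i} r≡0 = zero-Hdim λ v _ _ → 𝟘 (suc (suc i)) , Supp-𝟘 (suc (suc i)) , λ p → contradiction
        (≡.subst Fin r≡0 p) λ ()

    -- The homology of the box and of the sub-box never meet in one index, so both induced maps
    -- vanish. Index 0 is out of reach of `exact-sequence`; there the zero module `V 1` decides.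
    Concentrated-step : ∀ {l b l′ b′ s g₁ g₂} → rank 1 ≡ 0 → Step l b l′ b′ →
                        Concentrated l b (suc s) g₁ → Concentrated l b′ s g₂ →
                        Concentrated l′ b (suc s) (g₁ + g₂)
    Concentrated-step {l} {b} {l′} {b′} {s} r step (HB , HB≢) (HA , HA≢) =
      exact-sequence step HB HA
        (source-zero b′⊑b (HA≢ (suc s) (ℕₚ.1+n≢n))) (target-zero b′⊑b (HB≢ s (ℕₚ.1+n≢n ∘ ≡.sym))) ,
      λ { zero    _    → rank-zero r
        ; (suc i) i≢s → exact-sequence step (HB≢ (suc i) i≢s) (HA≢ i (i≢s ∘ ≡.cong suc))
                           (target-zero b′⊑b (HB≢ (suc i) i≢s)) (source-zero b′⊑b (HA≢ i (i≢s ∘ ≡.cong suc))) }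
      where open Step step

    Acyclic⇒Concentrated : ∀ {l b s} → Acyclic l b → Concentrated l b s 0
    Acyclic⇒Concentrated ac = ac _ , λ i _ → ac i

    Concentrated⇒Acyclic : ∀ {l b} s → Concentrated l b s 0 → Acyclic l b
    Concentrated⇒Acyclic s (H , H≢) i with i ℕ.≟ s
    ... | yes ≡.refl = H
    ... | no  i≢s    = H≢ i i≢s

    -- The hypotheses say that the sub-box and the box have the same homology.
    cone-acyclic : ∀ {l b l′ b′} → rank 1 ≡ 0 → Step l b l′ b′ →
                   (∀ i v → Supp (suc i) b v → Cycle i l v →
                      ∃ λ w → ∃ λ u → Supp (suc (suc i)) b w × Supp (suc i) b′ u × Eq (suc i) l v
                          (D (suc i) w ⊞ u)) →
                   (∀ i u → Supp (suc i) b′ u → Cycle i l u → ∀ w → Supp (suc (suc i)) b w → Eq (suc i) l u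
                       (D (suc i) w) →
                      ∃ λ w′ → Supp (suc (suc i)) b′ w′ × Eq (suc i) l u (D (suc i) w′)) →
                   Acyclic l′ b
    cone-acyclic r step surj inj zero = rank-zero r
    cone-acyclic {l} {b} {l′} {b′} r step surj inj (suc i) = zero-Hdim bd
      where
      open Step step
      i₁ i₂ : ℕ
      i₁ = suc i
      i₂ = suc i₁
      bd : ∀ v → Supp i₂ b v → Cycle i₁ l′ v → ∃ λ w → Supp (suc i₂) b w × Eq i₂ l′ v (D i₂ w)
      -- The boundary of v comes from a sub-box cycle that bounds in the box, so by `inj` it bounds
      -- some w′ in the sub-box. Now v - w′ is a cycle of the box, homologous by `surj` to an
      -- element of the sub-box, and sub-box elements vanish modulo l′.
      bd v v∈U cyc
        with u~Dv ← restrict-Eq i₁ (D i₁ v) (D-Supp i₁ v∈U) cyc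
        with w′ , w′∈U , u~Dw′ ← inj i _ (restrict-Supp i₁ b′ (D i₁ v))
                                    (λ p l⊑p → trans (D-Eq i u~Dv p l⊑p) (∂∂ i b v v∈U p)) v v∈U u~Dv
        with w , u , w∈U , u∈U , v-w′~ ← surj i₁ (v ⊟ w′) (Supp-⊟ i₂ v∈U (Supp-⊑ i₂ b′⊑b w′∈U))
                                    (λ p l⊑p → trans (D-⊟ i₁ v w′ p)
                                        (≈⇒-≈0 (trans (sym (u~Dv p l⊑p)) (u~Dw′ p l⊑p))))
        = w , w∈U , λ p l′⊑p → begin
          v p                           ≈⟨ x-y+y≈x _ _ ⟨
          (v ⊟ w′) p +ᴷ w′ p            ≈⟨ +-cong (Eq-l′ i₂ v-w′~ p l′⊑p) (Supp-b′⇒Eq-l′ i₂ w′∈U p l′⊑p) ⟩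
          (D i₂ w p +ᴷ u p) +ᴷ 0#       ≈⟨ +-identityʳ _ ⟩
          D i₂ w p +ᴷ u p               ≈⟨ +-congˡ (Supp-b′⇒Eq-l′ i₂ u∈U p l′⊑p) ⟩
          D i₂ w p +ᴷ 0#                ≈⟨ +-identityʳ _ ⟩
          D i₂ w p                      ∎

    Hdim-resp : ∀ {l l′ b b′ i g} → l ⊑ l′ → l′ ⊑ l → b ⊑ b′ → b′ ⊑ b → Hdim l b i g → Hdim l′ b′ i g
    Hdim-resp {l} {l′} {b} {b′} {i} l⊑l′ l′⊑l b⊑b′ b′⊑b H = record
      { z = H.z
      ; z-supp = λ j → Supp-⊑ (suc i) b⊑b′ (H.z-supp j)
      ; z-cycle = λ j p l′⊑p → H.z-cycle j p (⊑-trans {a = l} l⊑l′ l′⊑p)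
      ; span = λ v v∈U cyc → let a , w , w∈U , v~ = H.span v (Supp-⊑ (suc i) b′⊑b v∈U) (λ p l⊑p → cyc p (⊑-trans {a = l′} l′⊑l l⊑p)) in
                             a , w , Supp-⊑ (suc (suc i)) b⊑b′ w∈U , λ p l′⊑p → v~ p (⊑-trans {a = l} l⊑l′ l′⊑p)
      ; indep = λ a w w∈U rel → H.indep a w (Supp-⊑ (suc (suc i)) b′⊑b w∈U) λ p l⊑p → rel p
          (⊑-trans {a = l′} l′⊑l l⊑p) }
      where module H = Hdim H

    Concentrated-resp : ∀ {l l′ b b′ s g} → l ⊑ l′ → l′ ⊑ l → b ⊑ b′ → b′ ⊑ b → Concentrated l b s g
        → Concentrated l′ b′ s g
    Concentrated-resp ll′ l′l bb′ b′b (H , H≢) =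
      Hdim-resp ll′ l′l bb′ b′b H , λ i i≢s → Hdim-resp ll′ l′l bb′ b′b (H≢ i i≢s)

    Minimal : Set ℓ₁
    Minimal = ∀ i p q → deg i p ⊑ deg (suc i) q → deg (suc i) q ⊑ deg i p → ∂ i p q ≈ 0#

    inDegree : ∀ i → Degree n → Fin (rank i) → Bool
    inDegree i b p = does ((deg i p ⊑? b) ×-dec (b ⊑? deg i p))

    -- In the box [b,b] an entry of the differential joins two generators of degree b, so minimality
    -- makes it zero and homology is the span of these generators.
    minimal-Hdim : Minimal → ∀ {b i g} → Hdim b b i g → count (inDegree (suc i) b) ≡ g
    minimal-Hdim minimal {b} {i} {g} H = basis-size S z z-supp span indep
      where
      module H = Hdim H
      i₁ : ℕ
      i₁ = suc i
      S : Fin (rank i₁) → Bool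
      S = inDegree i₁ b
      D~0 : ∀ i {v} → Supp (suc i) b v → Eq i b (D i v) (𝟘 i)
      D~0 i {v} v∈U p b⊑p = ∑-zero term
        where
        term : ∀ q → ∂ i p q *ᴷ v q ≈ 0#
        term q with deg i p ⊑? deg (suc i) q | deg (suc i) q ⊑? b
        ... | no p⋢q  | _        = trans (*-congʳ (∂-mono i p q p⋢q)) (zeroˡ _)
        ... | yes _   | no  q⋢b  = trans (*-congˡ (v∈U q q⋢b)) (zeroʳ _)
        ... | yes p⊑q | yes q⊑b  = trans (*-congʳ (minimal i p q p⊑q (⊑-trans {b = b} q⊑b b⊑p))) (zeroˡ _)
      -- Coordinates off degree b are either invisible to `Eq b` or zero by `Supp b`; cutting them
      -- off gives vectors supported on S, as `basis-size` expects.
      z : Fin g → V i₁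
      z j p = if S p then H.z j p else 0#
      z-supp : ∀ j p → S p ≡ false → z j p ≈ 0#
      z-supp j p Sp rewrite Sp = refl
      lin-z : ∀ a p → S p ≡ true → lin a z p ≈ lin a H.z p
      lin-z a p Sp = ∑-cong λ j → *-congˡ (reflexive (≡.cong (if_then H.z j p else 0#) Sp))
      lin-z-false : ∀ a p → S p ≡ false → lin a z p ≈ 0#
      lin-z-false a p Sp = ∑-zero λ j → trans (*-congˡ (z-supp j p Sp)) (zeroʳ _)
      S-false : ∀ p → ¬ deg i₁ p ⊑ b → S p ≡ false
      S-false p p⋢b with deg i₁ p ⊑? b
      ... | yes p⊑b = contradiction p⊑b p⋢b
      ... | no  _   = ≡.refl
      S-true : ∀ p → S p ≡ true → b ⊑ deg i₁ p
      S-true p Sp with deg i₁ p ⊑? b | b ⊑? deg i₁ p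
      ... | yes _ | yes b⊑p = b⊑p
      span : ∀ v → (∀ p → S p ≡ false → v p ≈ 0#) → ∃ λ a → ∀ p → v p ≈ lin a z p
      span v v-supp with v∈U ← (λ p p⋢b → v-supp p (S-false p p⋢b))
                    with a , w , w∈U , v~ ← H.span v v∈U (D~0 i v∈U) = a , λ p → at p (S p) ≡.refl
        where
        at : ∀ p s → S p ≡ s → v p ≈ lin a z p
        at p true Sp = begin
          v p                        ≈⟨ v~ p (S-true p Sp) ⟩
          lin a H.z p +ᴷ D i₁ w p    ≈⟨ +-congˡ (D~0 i₁ w∈U p (S-true p Sp)) ⟩
          lin a H.z p +ᴷ 0#          ≈⟨ +-identityʳ _ ⟩
          lin a H.z p                ≈⟨ lin-z a p Sp ⟨
          lin a z p                  ∎
        at p false Sp = trans (v-supp p Sp) (sym (lin-z-false a p Sp))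
      indep : ∀ a → (∀ p → lin a z p ≈ 0#) → ∀ j → a j ≈ 0#
      indep a lin≈0 = H.indep a (𝟘 (suc i₁)) (Supp-𝟘 (suc i₁)) λ p b⊑p → trans (at p b⊑p (S p) ≡.refl)
          (sym (D-𝟘 i₁ p))
        where
        S-false⁻ : ∀ p → b ⊑ deg i₁ p → S p ≡ false → ¬ deg i₁ p ⊑ b
        S-false⁻ p b⊑p Sp p⊑b with deg i₁ p ⊑? b | b ⊑? deg i₁ p
        ... | yes _   | no b⋢p = b⋢p b⊑p
        ... | no p⋢b  | _      = p⋢b p⊑b
        at : ∀ p → b ⊑ deg i₁ p → ∀ s → S p ≡ s → lin a H.z p ≈ 0#
        at p _   true  Sp = trans (sym (lin-z a p Sp)) (lin≈0 p)
        at p b⊑p false Sp = Supp-lin i₁ a H.z-supp p (S-false⁻ p b⊑p Sp)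

-- Squarefree lowering of degrees

infixl 6 _↓_

opaque
  _↓_ : ∀ {n} → Degree n → Fin n → Degree n
  (b ↓ x) y = if does (x Fin.≟ y) then pred (b y) else b y

≤suc-pred : ∀ m → m ≤ suc (pred m)
≤suc-pred zero    = z≤n
≤suc-pred (suc m) = ℕₚ.≤-refl

-- The dimension of the homology of a simplex on v vertices modulo its faces with fewer than r vertices.
topFaces : ℕ → ℕ → ℕ
topFaces zero    zero    = 1
topFaces zero    (suc r) = 0
topFaces (suc v) zero    = 0
topFaces (suc v) (suc r) = topFaces v (suc r) + topFaces v r

module _ {n : ℕ} where

  opaque
    unfolding _↓_

    ↓-self : ∀ (b : Degree n) x → (b ↓ x) x ≡ pred (b x)
    ↓-self b x with x Fin.≟ x
    ... | yes _   = ≡.refl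
    ... | no  x≢x = contradiction ≡.refl x≢x

    ↓-other : ∀ (b : Degree n) {x y} → x ≢ y → (b ↓ x) y ≡ b y
    ↓-other b {x} {y} x≢y with x Fin.≟ y
    ... | yes x≡y = contradiction x≡y x≢y
    ... | no  _   = ≡.refl

    ↓-⊑ : ∀ (b : Degree n) x → b ↓ x ⊑ b
    ↓-⊑ b x y with x Fin.≟ y
    ... | yes _ = ℕₚ.pred[n]≤n
    ... | no  _ = ℕₚ.≤-refl

    ⊑-↓ : ∀ {b p : Degree n} {x} → p ⊑ b → p x < b x → p ⊑ b ↓ x
    ⊑-↓ {x = x} p⊑b px<bx y with x Fin.≟ y
    ... | yes ≡.refl = ℕₚ.<⇒≤pred px<bx
    ... | no  _      = p⊑b y

  ↓-< : ∀ {b : Degree n} {x} → 1 ≤ b x → (b ↓ x) x < b x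
  ↓-< {b} {x} 1≤bx rewrite ↓-self b x = ℕₚ.≤-reflexive (ℕₚ.suc-pred (b x) {{ℕ.>-nonZero 1≤bx}})

  open import Data.List.Membership.DecPropositional (Fin._≟_ {n}) using (_∈?_)

  opaque
    lower : List (Fin n) → Degree n → Degree n
    lower X b x = if does (x ∈? X) then b x else 0

    lower-⊑ : ∀ X (b : Degree n) → lower X b ⊑ b
    lower-⊑ X b x with x ∈? X
    ... | yes _ = ℕₚ.≤-refl
    ... | no  _ = z≤n

    ⊑-lower⁺ : ∀ {X} {b p : Degree n} → (∀ x → x ∈ X → b x ≤ p x) → lower X b ⊑ p
    ⊑-lower⁺ {X} b≤p x with x ∈? X
    ... | yes x∈X = b≤p x x∈X
    ... | no  _   = z≤n

    ⊑-lower⁻ : ∀ {X} {b p : Degree n} → lower X b ⊑ p → ∀ x → x ∈ X → b x ≤ p x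
    ⊑-lower⁻ {X} l⊑p x x∈X with x ∈? X | l⊑p x
    ... | yes _   | b≤p = b≤p
    ... | no  x∉X | _   = contradiction x∈X x∉X

    ⊑-lower-full : ∀ {X} {b : Degree n} → (∀ x → 1 ≤ b x → x ∈ X) → b ⊑ lower X b
    ⊑-lower-full {X} {b} full x with x ∈? X
    ... | yes _ = ℕₚ.≤-refl
    ... | no x∉X with b x in bx
    ...   | zero  = z≤n
    ...   | suc _ = contradiction (full x (≡.subst (1 ≤_) (≡.sym bx) (s≤s z≤n))) x∉X

    lower-[] : ∀ {b l : Degree n} → lower [] b ⊑ l
    lower-[] x = z≤n

  lower-mono : ∀ {X Y} {b b′ : Degree n} → (∀ x → x ∈ X → x ∈ Y × b x ≤ b′ x) → lower X b ⊑ lower Y b′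
  lower-mono {X} {Y} {b} {b′} X⊆Y = ⊑-lower⁺ {X} λ x x∈X → let x∈Y , b≤b′ = X⊆Y x x∈X in
    ℕₚ.≤-trans b≤b′ (⊑-lower⁻ {Y} {b′} (λ _ → ℕₚ.≤-refl) x x∈Y)

  -- The degrees c − σ for squarefree σ with support in X.
  Near : List (Fin n) → Degree n → Degree n → Set
  Near X c d = ∀ x → d x ≤ c x × c x ≤ suc (d x) × (x ∉ X → d x ≡ c x)

  Near-refl : ∀ {X c} → Near X c c
  Near-refl x = ℕₚ.≤-refl , ℕₚ.n≤1+n _ , λ _ → ≡.refl

  Near-⊆ : ∀ {X Y c d} → (∀ {x} → x ∈ X → x ∈ Y) → Near X c d → Near Y c d
  Near-⊆ X⊆Y near x = let d≤c , c≤1+d , d≡c = near x in d≤c , c≤1+d , λ x∉Y → d≡c (x∉Y ∘ X⊆Y)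

  opaque
    unfolding _↓_

    Near-↓ : ∀ {X c d y} → Near X (c ↓ y) d → y ∉ X → Near (y ∷ X) c d
    Near-↓ {X} {c} {d} {y} near y∉X x with y Fin.≟ x | near x
    ... | yes ≡.refl | d≤ , _ , d≡ =
      ℕₚ.≤-trans d≤ ℕₚ.pred[n]≤n ,
      ℕₚ.≤-trans (≤suc-pred (c y)) (s≤s (ℕₚ.≤-reflexive (≡.sym (d≡ y∉X)))) , λ y∉ → contradiction (here ≡.refl) y∉
    ... | no y≢x | d≤ , c≤ , d≡ = d≤ , c≤ , λ x∉ → d≡ (x∉ ∘ there)

    Near-lower : ∀ {X c d x} → Near X c d → x ∉ X → Near (x ∷ X) c (d ↓ x)
    Near-lower {X} {c} {d} {x} near x∉X y with x Fin.≟ y | near y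
    ... | yes ≡.refl | d≤ , _ , d≡ =
      ℕₚ.≤-trans ℕₚ.pred[n]≤n d≤ ,
      ℕₚ.≤-trans (ℕₚ.≤-reflexive (≡.sym (d≡ x∉X))) (≤suc-pred (d x)) , λ y∉ → contradiction (here ≡.refl) y∉
    ... | no x≢y | d≤ , c≤ , d≡ = d≤ , c≤ , λ y∉ → d≡ (y∉ ∘ there)

  Positive : List (Fin n) → Degree n → Set
  Positive X b = ∀ {x} → x ∈ X → 1 ≤ b x

  Positive-↓ : ∀ {X b y} → y ∉ X → Positive X b → Positive X (b ↓ y)
  Positive-↓ {X} {b} y∉X pos x∈X = ≡.subst (1 ≤_) (≡.sym (↓-other b λ { ≡.refl → y∉X x∈X })) (pos x∈X)

  drops : List (Fin n) → Degree n → Degree n → ℕ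
  drops []      b d = 0
  drops (y ∷ Y) b d = ⟦ does (d y ℕ.<? b y) ⟧ + drops Y b d

  drops-cong : ∀ Y {b b′ d d′} → (∀ {y} → y ∈ Y → b y ≡ b′ y) → (∀ {y} → y ∈ Y → d y ≡ d′ y) →
               drops Y b d ≡ drops Y b′ d′
  drops-cong []      b≡ d≡ = ≡.refl
  drops-cong (y ∷ Y) {b′ = b′} b≡ d≡ = ≡.cong₂ (λ s t → s + t)
    (≡.cong₂ (λ s t → ⟦ does (s ℕ.<? t) ⟧) (d≡ (here ≡.refl)) (b≡ (here ≡.refl)))
        (drops-cong Y (b≡ ∘ there) (d≡ ∘ there))

  -- A non-empty level, split into a pivot (second component) and the other elements.
  Block : Set
  Block = List (Fin n) × Fin n

  flatten : List Block → List (Fin n) → List (Fin n)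
  flatten []              Y = Y
  flatten ((ys , x) ∷ Ls) Y = ys List.++ x ∷ flatten Ls Y

  Disjoint : List Block → List (Fin n) → Set
  Disjoint []              Y = Unique Y
  Disjoint ((ys , x) ∷ Ls) Y = Unique ys × x ∉ ys × x ∉ flatten Ls Y × (∀ {y} → y ∈ ys → y ∉ flatten Ls Y)
      × Disjoint Ls Y

  Undropped : Degree n → Degree n → Block → Set
  Undropped b d (ys , x) = d x ≡ b x × (∀ {y} → y ∈ ys → d y ≡ b y)

  -- The combinatorial form that membership of d in M will take: some lower level is untouched, or
  -- fewer than r elements of the top level Y have dropped.
  data Inside (Ls : List Block) (Y : List (Fin n)) (r : ℕ) (b d : Degree n) : Set where
    undropped : Any (Undropped b d) Ls → Inside Ls Y r b d
    few       : drops Y b d < r → Inside Ls Y r b d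

  Disjoint⇒Unique : ∀ Ls {Y} → Disjoint Ls Y → Unique (flatten Ls Y)
  Disjoint⇒Unique []              uY = uY
  Disjoint⇒Unique ((ys , x) ∷ Ls) (uys , x∉ys , x∉ , ys∩ , dj) =
    Uniqueₚ.++⁺ uys (All.tabulate (λ {z} z∈ x≡z → x∉ (≡.subst (_∈ _) (≡.sym x≡z) z∈)) ∷ Disjoint⇒Unique Ls dj)
      λ { (z∈ys , here ≡.refl) → x∉ys z∈ys ; (z∈ys , there z∈) → ys∩ z∈ys z∈ }

  Inside-cong : ∀ Ls {Y r b b′ d d′} → (∀ {y} → y ∈ flatten Ls Y → b y ≡ b′ y) →
      (∀ {y} → y ∈ flatten Ls Y → d y ≡ d′ y) →
                Inside Ls Y r b d → Inside Ls Y r b′ d′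
  Inside-cong [] {Y} {r} b≡ d≡ (few lt) = few (≡.subst (_< r) (drops-cong Y b≡ d≡) lt)
  Inside-cong ((ys , x) ∷ Ls) b≡ d≡ (undropped (here (dx≡ , dys≡))) = undropped (here
    (≡.trans (≡.sym (d≡ x∈)) (≡.trans dx≡ (b≡ x∈)) ,
     λ y∈ → ≡.trans (≡.sym (d≡ (∈ₚ.∈-++⁺ˡ y∈))) (≡.trans (dys≡ y∈) (b≡ (∈ₚ.∈-++⁺ˡ y∈)))))
    where
    x∈ : x ∈ flatten ((ys , x) ∷ Ls) _
    x∈ = ∈ₚ.∈-++⁺ʳ ys (here ≡.refl)
  Inside-cong ((ys , x) ∷ Ls) b≡ d≡ (undropped (there any))
    with Inside-cong Ls (b≡ ∘ ∈ₚ.∈-++⁺ʳ ys ∘ there) (d≡ ∘ ∈ₚ.∈-++⁺ʳ ys ∘ there) (undropped any)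
  ... | undropped any′ = undropped (there any′)
  ... | few lt   = few lt
  Inside-cong ((ys , x) ∷ Ls) b≡ d≡ (few lt)
    with Inside-cong Ls (b≡ ∘ ∈ₚ.∈-++⁺ʳ ys ∘ there) (d≡ ∘ ∈ₚ.∈-++⁺ʳ ys ∘ there) (few lt)
  ... | undropped any′ = undropped (there any′)
  ... | few lt′  = few lt′

-- Koszul-type homology of a resolved monomial quotient.

module QuotientResolution {c ℓ₁ ℓ₂ : Level} (K : HeytingField c ℓ₁ ℓ₂)
                          (_#?_ : Decidable (HeytingField._#_ K)) (n : ℕ)
                          (M : Degree n → Set) (M? : ∀ b → Dec (M b))
                          (M-up : ∀ {a b} → a ⊑ b → M a → M b) where

  open GradedComplex K _#?_ n public

  -- The complex resolves R/I, where I is the monomial ideal spanned by the degrees in M.  Two zero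
  -- modules precede the free module over R/I, so that the module in homological degree i is V (2 + i);
  -- e is the augmentation of the generators, read off in every degree b ∉ M.
  record Resolves (C : Complex) : Set (c ⊔ ℓ₁) where
    open Complex C
    field
      rank₁≡0 : rank 1 ≡ 0
      exact   : ∀ i b v → Supp (3 + i) b v → (∀ p → D (2 + i) v p ≈ 0#) →
                ∃ λ w → Supp (4 + i) b w × (∀ p → v p ≈ D (3 + i) w p)
      onto    : ∀ b v → M b → Supp 2 b v → ∃ λ w → Supp 3 b w × (∀ p → v p ≈ D 2 w p)
      e       : V 2

    aug : V 2 → Carrier
    aug v = ∑ λ p → e p *ᴷ v p

    field
      aug-∂    : ∀ b w → ¬ M b → Supp 3 b w → aug (D 2 w) ≈ 0#
      aug-ker  : ∀ b v → ¬ M b → Supp 2 b v → aug v ≈ 0# → ∃ λ w → Supp 3 b w × (∀ p → v p ≈ D 2 w p)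
      aug-unit : ∀ b → ¬ M b → ∃ λ z → Supp 2 b z × aug z ≈ 1#

  module _ (C : Complex) (res : Resolves C) where

    open Complex C
    open Resolves res
    open import Relation.Binary.Reasoning.Setoid setoid

    aug-∸ : ∀ v a z → aug (v ⊟ λ p → a *ᴷ z p) ≈ aug v -ᴷ a *ᴷ aug z
    aug-∸ v a z = begin
      ∑ (λ p → e p *ᴷ (v p -ᴷ a *ᴷ z p))                       ≈⟨ ∑-cong
          (λ p → trans (distribˡ _ _ _) (+-congˡ (trans (sym (-‿distribʳ-* _ _)) (-‿cong (x∙yz≈y∙xz _ _ _))))) ⟩
      ∑ (λ p → e p *ᴷ v p -ᴷ a *ᴷ (e p *ᴷ z p))                ≈⟨ ∑-+ _ _ ⟩
      aug v +ᴷ ∑ (λ p → -ᴷ (a *ᴷ (e p *ᴷ z p)))                ≈⟨ +-congˡ (trans (∑-neg _) (-‿cong (∑-*ˡ _ _))) ⟩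
      aug v -ᴷ a *ᴷ aug z                                       ∎
      where open import Algebra.Properties.CommutativeSemigroup *-commutativeSemigroup using (x∙yz≈y∙xz)

    aug-cong : ∀ {v w} → (∀ p → v p ≈ w p) → aug v ≈ aug w
    aug-cong v≈w = ∑-cong λ p → *-congˡ (v≈w p)

    private
      0ᵈ : Degree n
      0ᵈ _ = 0
      0⊑ : ∀ {p : Degree n} → 0ᵈ ⊑ p
      0⊑ x = z≤n

      supp-scale : ∀ {i b z} a → Supp i b z → Supp i b (λ p → a *ᴷ z p)
      supp-scale a z∈U p p⋢b = trans (*-congˡ (z∈U p p⋢b)) (zeroʳ a)

      empty₁ : ∀ {ℓ} {P : Fin (rank 1) → Set ℓ} → ∀ p → P p
      empty₁ p = contradiction (≡.subst Fin rank₁≡0 p) λ ()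

      higher : ∀ {b} i → Hdim 0ᵈ b (2 + i) 0
      higher {b} i = zero-Hdim C λ v v∈U cyc →
        let w , w∈U , v≈ = exact i b v v∈U (λ p → cyc p 0⊑) in w , w∈U , λ p _ → v≈ p

      span-unit : ∀ {b} → ¬ M b → ∀ z → Supp 2 b z → aug z ≈ 1# → ∀ v → Supp 2 b v →
                  ∃ λ w → Supp 3 b w × (∀ p → v p ≈ aug v *ᴷ z p +ᴷ D 2 w p)
      span-unit {b} ¬Mb z z∈U ez≈1 v v∈U
        with w , w∈U , v-≈ ← aug-ker b (v ⊟ λ p → aug v *ᴷ z p) ¬Mb (Supp-⊟ C 2 v∈U (supp-scale {2} (aug v) z∈U))
                     (trans (aug-∸ v (aug v) z) (trans (+-congˡ (-‿cong (trans (*-congˡ ez≈1) (*-identityʳ _))))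
                         (-‿inverseʳ _)))
        = w , w∈U , λ p → trans (sym (x-y+y≈x _ _)) (trans (+-congʳ (v-≈ p)) (+-comm _ _))

    strand-acyclic : ∀ {b} → M b → Acyclic 0ᵈ b
    strand-acyclic Mb zero          = rank-zero C rank₁≡0
    strand-acyclic {b} Mb (suc zero) = zero-Hdim C λ v v∈U _ →
      let w , w∈U , v≈ = onto b v Mb v∈U in w , w∈U , λ p _ → v≈ p
    strand-acyclic Mb (suc (suc i)) = higher i

    -- Outside M the degree b part of R/I is one-dimensional, detected by the augmentation. Index 1
    -- is homological degree 0: two zero modules are prepended, and `Hdim` counts from the outgoing
    -- differential.
    strand-concentrated : ∀ {b} → ¬ M b → Concentrated 0ᵈ b 1 1
    strand-concentrated {b} ¬Mb = H₁ , λ { zero _ → rank-zero C rank₁≡0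
                                       ; (suc zero) 1≢1 → contradiction ≡.refl 1≢1
                                       ; (suc (suc i)) _ → higher i }
      where
      u : V 2
      u = proj₁ (aug-unit b ¬Mb)
      u∈U : Supp 2 b u
      u∈U = proj₁ (proj₂ (aug-unit b ¬Mb))
      eu≈1 : aug u ≈ 1#
      eu≈1 = proj₂ (proj₂ (aug-unit b ¬Mb))
      lin-u : ∀ (a : Vector Carrier 1) p → lin a (λ _ → u) p ≈ a zero *ᴷ u p
      lin-u a p = trans (∑-suc {0} _) (trans (+-congˡ (∑-zero λ ())) (+-identityʳ _))
      H₁ : Hdim 0ᵈ b 1 1
      H₁ = record
        { z = λ _ → u
        ; z-supp = λ _ → u∈U
        ; z-cycle = λ _ → empty₁
        ; span = λ v v∈U _ → let w , w∈U , v≈ = span-unit ¬Mb u u∈U eu≈1 v v∈U in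
            (λ _ → aug v) , w , w∈U , λ p _ → trans (v≈ p) (+-congʳ (sym (lin-u (λ _ → aug v) p)))
        ; indep = λ a w w∈U rel → λ { zero → begin
            a zero                          ≈⟨ *-identityʳ _ ⟨
            a zero *ᴷ 1#                    ≈⟨ *-congˡ eu≈1 ⟨
            a zero *ᴷ aug u                 ≈⟨ ∑-*ˡ _ _ ⟨
            ∑ (λ p → a zero *ᴷ (e p *ᴷ u p)) ≈⟨ ∑-cong (λ p → x∙yz≈y∙xz _ _ _) ⟩
            aug (λ p → a zero *ᴷ u p)       ≈⟨ aug-cong (λ p → trans (sym (lin-u a p)) (rel p 0⊑)) ⟩
            aug (D 2 w)                     ≈⟨ aug-∂ b w ¬Mb w∈U ⟩
            0#                              ∎ } }
        where open import Algebra.Properties.CommutativeSemigroup *-commutativeSemigroup using (x∙yz≈y∙xz)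

    -- Passing from b′ to b is an isomorphism on R/I when both degrees lie in M or both lie outside,
    -- so the cone has no homology. Outside M, the unit class already supported below b′ also
    -- generates degree b.
    cone-base : ∀ {b b′ l′} → Step C 0ᵈ b l′ b′ → (M b → M b′) → Acyclic l′ b
    cone-base {b} {b′} step Mb⇒Mb′ with M? b
    ... | yes Mb = Concentrated⇒Acyclic C 1 (Concentrated-step C rank₁≡0 step
                     (Acyclic⇒Concentrated C (strand-acyclic Mb))
                         (Acyclic⇒Concentrated C {s = 0} (strand-acyclic (Mb⇒Mb′ Mb))))
    ... | no ¬Mb = cone-acyclic C rank₁≡0 step
      (λ { zero v _ _ → 𝟘 2 , 𝟘 1 , Supp-𝟘 C 2 , Supp-𝟘 C 1 , empty₁
         ; (suc zero) v v∈U _ → let z , z∈U′ , ez≈1 = aug-unit b′ ¬Mb′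
                                    w , w∈U , v≈ = span-unit ¬Mb z (Supp-⊑ C 2 b′⊑b z∈U′) ez≈1 v v∈U in
             w , (λ p → aug v *ᴷ z p) , w∈U , supp-scale {2} (aug v) z∈U′ , λ p _ → trans (v≈ p) (+-comm _ _)
         ; (suc (suc i)) v v∈U cyc → let w , w∈U , v≈ = exact i b v v∈U (λ p → cyc p 0⊑) in
             w , 𝟘 (3 + i) , w∈U , Supp-𝟘 C (3 + i) , λ p _ → trans (v≈ p) (sym (+-identityʳ _)) })
      (λ { zero u _ _ _ _ _ → 𝟘 2 , Supp-𝟘 C 2 , empty₁
         ; (suc zero) u u∈U′ _ w w∈U u~ → let w′ , w′∈U , u≈ = aug-ker b′ u ¬Mb′ u∈U′ (trans (aug-cong λ p → u~ p 0⊑) (aug-∂ b w ¬Mb w∈U)) in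
             w′ , w′∈U , λ p _ → u≈ p
         ; (suc (suc i)) u u∈U′ cyc _ _ _ → let w , w∈U , u≈ = exact i b′ u u∈U′ (λ p → cyc p 0⊑) in w , w∈U , λ p _ → u≈ p })
      where
      open Step step
      ¬Mb′ : ¬ M b′
      ¬Mb′ Mb′ = ¬Mb (M-up b′⊑b Mb′)

    -- The index s is one more than the homological degree in the resolution of R/I.
    H : List (Fin n) → Degree n → ℕ → ℕ → Set (c ⊔ ℓ₁)
    H X b = Concentrated (lower X b) b

    H-resp : ∀ {X Y b s g} → (∀ {x} → x ∈ X → x ∈ Y) → (∀ {x} → x ∈ Y → x ∈ X) → H X b s g → H Y b s g
    H-resp {X} {Y} {b} X⊆Y Y⊆X = Concentrated-resp C (lower-mono {b = b} λ x x∈X → X⊆Y x∈X , ℕₚ.≤-refl)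
                                                     (lower-mono {b = b} λ x x∈Y → Y⊆X x∈Y , ℕₚ.≤-refl)
                                                     (⊑-refl {a = b}) (⊑-refl {a = b})

    box-step : ∀ {X b x} → x ∉ X → 1 ≤ b x → Step C (lower X b) b (lower (x ∷ X) b) (b ↓ x)
    box-step {X} {b} {x} x∉X 1≤bx = record
      { b′⊑b = ↓-⊑ b x
      ; l⊑l′ = lower-mono {b = b} λ y y∈X → there y∈X , ℕₚ.≤-refl
      ; disjoint = λ p p⊑b′ l′⊑p → ℕₚ.<⇒≱ (ℕₚ.≤-<-trans (p⊑b′ x) (↓-< {b = b} 1≤bx))
          (⊑-lower⁻ {X = x ∷ X} {b} l′⊑p x (here ≡.refl))
      ; cover = cover }
      where
      cover : ∀ p → p ⊑ b → lower X b ⊑ p → p ⊑ b ↓ x ⊎ lower (x ∷ X) b ⊑ p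
      cover p p⊑b l⊑p with b x ℕ.≤? p x
      ... | yes bx≤px = inj₂ (⊑-lower⁺ {X = x ∷ X}
          λ { y (here ≡.refl) → bx≤px ; y (there y∈X) → ⊑-lower⁻ {X = X} {b} l⊑p y y∈X })
      ... | no  bx≰px = inj₁ (⊑-↓ p⊑b (ℕₚ.≰⇒> bx≰px))

    -- The sub-box is the strand of degree b - e_x. Since b and `b ↓ x` agree on X, its lower corner
    -- is the one that H prescribes for `b ↓ x`.
    H-step : ∀ {X b x s g₁ g₂} → x ∉ X → 1 ≤ b x → H X b (suc s) g₁ → H X (b ↓ x) s g₂ → H (x ∷ X) b (suc s)
        (g₁ + g₂)
    H-step {X} {b} {x} x∉X 1≤bx HB HA = Concentrated-step C rank₁≡0 (box-step x∉X 1≤bx) HB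
      (Concentrated-resp C (lower-mono {X = X} {b = b ↓ x} λ y y∈X → y∈X , ↓-⊑ b x y)
                           (lower-mono {X = X} {b′ = b ↓ x} λ y y∈X → y∈X , ℕₚ.≤-reflexive
                               (≡.sym (↓-other b λ { ≡.refl → x∉X y∈X })))
                           (⊑-refl {a = b ↓ x}) (⊑-refl {a = b ↓ x}) HA)

    -- All strands met on the way have degree in M, where R/I is zero.
    H-inside : ∀ {X b s} → Unique X → Positive X b → (∀ d → Near X b d → M d) → H X b s 0
    H-inside {[]} {b} [] pos inM = Concentrated-resp C 0⊑ (lower-[] {b = b}) (⊑-refl {a = b}) (⊑-refl {a = b})
                                     (Acyclic⇒Concentrated C (strand-acyclic (inM b Near-refl)))
    -- Any two consecutive indices would do here: the homology vanishes everywhere, and 1 and 0 only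
    -- fit the shape of `H-step`.
    H-inside {y ∷ X} {b} (y∉ ∷ uX) pos inM = Acyclic⇒Concentrated C (Concentrated⇒Acyclic C 1
      (H-step y∉X (pos (here ≡.refl))
         (H-inside {s = 1} uX (pos ∘ there) λ d near → inM d (Near-⊆ there near))
         (H-inside {s = 0} uX (Positive-↓ y∉X (pos ∘ there)) λ d near → inM d (Near-↓ near y∉X))))
      where
      y∉X : y ∉ X
      y∉X = λ y∈X → All.lookup y∉ y∈X ≡.refl

    -- x is adjoined before all of X: at the base, lowering x does not change membership in M, so
    -- `cone-base` applies, and adjoining further variables to an acyclic strand keeps it acyclic.
    H-toggle : ∀ {X b x s} → Unique X → x ∉ X → Positive (x ∷ X) b →
               (∀ d → Near X b d → M d → M (d ↓ x)) → H (x ∷ X) b s 0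
    H-toggle {[]} {b} {x} [] x∉ pos toggle = Acyclic⇒Concentrated C (cone-base
      (record { b′⊑b = b′⊑b ; l⊑l′ = 0⊑ ; disjoint = disjoint ; cover = λ p p⊑b _ → cover p p⊑b
          (lower-[] {b = b} {p}) })
      (toggle b Near-refl))
      where open Step (box-step {[]} {b} {x} x∉ (pos (here ≡.refl)))
    H-toggle {y ∷ X} {b} {x} (y∉ ∷ uX) x∉ pos toggle = H-resp
      (λ { (here y≡) → there (here y≡) ; (there (here x≡)) → here x≡ ; (there (there ∈X)) → there (there ∈X) })
      (λ { (here x≡) → there (here x≡) ; (there (here y≡)) → here y≡ ; (there (there ∈X)) → there (there ∈X) })
      (Acyclic⇒Concentrated C (Concentrated⇒Acyclic C 1 (H-step y∉xX (pos (there (here ≡.refl)))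
        (H-toggle {s = 1} uX (x∉ ∘ there) pos-xX λ d near → toggle d (Near-⊆ there near))
        (H-toggle {s = 0} uX (x∉ ∘ there) (Positive-↓ y∉xX pos-xX) λ d near → toggle d (Near-↓ near y∉X)))))
      where
      y∉X : y ∉ X
      y∉X y∈X = All.lookup y∉ y∈X ≡.refl
      y∉xX : y ∉ x ∷ X
      y∉xX (here ≡.refl) = x∉ (here ≡.refl)
      y∉xX (there y∈X)   = y∉X y∈X
      pos-xX : Positive (x ∷ X) b
      pos-xX (here ≡.refl) = pos (here ≡.refl)
      pos-xX (there ∈X)    = pos (there (there ∈X))

    -- A level ys ∪ {x} that keeps d outside M exactly when some coordinate of it drops contributes one
    -- homological degree: the pivot x carries the drop, and once some y drops x can be toggled freely.
    H-level : ∀ ys {x X b s g} → Unique ys → Unique X → x ∉ ys → x ∉ X → (∀ {y} → y ∈ ys → y ∉ X) →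
              Positive (ys List.++ x ∷ X) b →
              (∀ d → Near X b d → M d) →
              (∀ y → y ∈ ys → ∀ d → Near (ys List.++ X) b d → d y < b y → M d → M (d ↓ x)) →
              H X (b ↓ x) s g → H (ys List.++ x ∷ X) b (suc s) g
    H-level [] _ uX _ x∉X _ pos inM _ HX = H-step x∉X (pos (here ≡.refl)) (H-inside uX (pos ∘ there) inM) HX
    H-level (y ∷ ys) {x} {X} {b} {s} {g} (y∉ ∷ uys) uX x∉yys x∉X ys∩X pos inM toggle HX =
      ≡.subst (H _ b (suc s)) (ℕₚ.+-identityʳ g)
        (H-step y∉rest (pos (here ≡.refl))
          (H-level ys uys uX (x∉yys ∘ there) x∉X (ys∩X ∘ there) (pos ∘ there) inM
             (λ z z∈ys d near → toggle z (there z∈ys) d (Near-⊆ there near)) HX)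
          (H-resp xV⊆ ⊆xV (H-toggle uV x∉V (λ {z} z∈ → Positive-↓ y∉rest (pos ∘ there) (xV⊆ z∈))
             λ d near → toggle y (here ≡.refl) d (Near-↓ near (λ y∈V → y∉rest (xV⊆ (there y∈V))))
               (ℕₚ.≤-<-trans (proj₁ (near y)) (↓-< {b = b} (pos (here ≡.refl)))))))
      where
      Y : List (Fin n)
      Y = ys List.++ X
      xV⊆ : ∀ {z} → z ∈ x ∷ Y → z ∈ ys List.++ x ∷ X
      xV⊆ (here z≡x) = ∈ₚ.∈-++⁺ʳ ys (here z≡x)
      xV⊆ (there z∈) with ∈ₚ.∈-++⁻ ys z∈
      ... | inj₁ z∈ys = ∈ₚ.∈-++⁺ˡ z∈ys
      ... | inj₂ z∈X  = ∈ₚ.∈-++⁺ʳ ys (there z∈X)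
      ⊆xV : ∀ {z} → z ∈ ys List.++ x ∷ X → z ∈ x ∷ Y
      ⊆xV z∈ with ∈ₚ.∈-++⁻ ys z∈
      ... | inj₁ z∈ys        = there (∈ₚ.∈-++⁺ˡ z∈ys)
      ... | inj₂ (here z≡x)  = here z≡x
      ... | inj₂ (there z∈X) = there (∈ₚ.∈-++⁺ʳ ys z∈X)
      y∉rest : y ∉ ys List.++ x ∷ X
      y∉rest y∈ with ∈ₚ.∈-++⁻ ys y∈
      ... | inj₁ y∈ys         = All.lookup y∉ y∈ys ≡.refl
      ... | inj₂ (here ≡.refl) = x∉yys (here ≡.refl)
      ... | inj₂ (there y∈X)   = ys∩X (here ≡.refl) y∈X
      uV : Unique Y
      uV = Uniqueₚ.++⁺ uys uX λ { (z∈ys , z∈X) → ys∩X (there z∈ys) z∈X }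
      x∉V : x ∉ Y
      x∉V x∈ with ∈ₚ.∈-++⁻ ys x∈
      ... | inj₁ x∈ys = x∉yys (there x∈ys)
      ... | inj₂ x∈X  = x∉X x∈X

    -- A degree avoids M exactly if at least r elements drop. If y is kept, the demand on the rest
    -- is unchanged; if y is lowered, it falls by one: this is the recursion of `topFaces`. For r =
    -- 0 and non-empty Y no degree near b lies in M, so y toggles vacuously.
    H-last : ∀ Y r {b} → Unique Y → Positive Y b →
             (∀ d → Near Y b d → (M d → drops Y b d < r) × (drops Y b d < r → M d)) →
             H Y b (suc r) (topFaces (length Y) r)
    H-last [] zero {b} _ _ char = Concentrated-resp C 0⊑ (lower-[] {b = b}) (⊑-refl {a = b}) (⊑-refl {a = b})
      (strand-concentrated λ Mb → contradiction (proj₁ (char b Near-refl) Mb) λ ())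
    H-last [] (suc r) {b} _ pos char = H-inside [] (λ ()) λ d near → proj₂ (char d near) (s≤s z≤n)
    H-last (y ∷ Y) zero (y∉ ∷ uY) pos char =
      H-toggle uY (λ y∈Y → All.lookup y∉ y∈Y ≡.refl) pos λ d near Md → contradiction
          (proj₁ (char d (Near-⊆ there near)) Md) λ ()
    H-last (y ∷ Y) (suc r) {b} (y∉ ∷ uY) pos char =
      H-step y∉Y (pos (here ≡.refl))
        (H-last Y (suc r) uY (pos ∘ there) λ d near → let f , g = char d (Near-⊆ there near) in
           ≡.subst (_< suc r) (kept d near) ∘ f , g ∘ ≡.subst (_< suc r) (≡.sym (kept d near)))
        (H-last Y r uY (Positive-↓ y∉Y (pos ∘ there)) λ d near → let f , g = char d (Near-↓ near y∉Y) in
           ℕₚ.≤-pred ∘ ≡.subst (_< suc r) (dropped d near) ∘ f , g ∘ ≡.subst (_< suc r)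
               (≡.sym (dropped d near)) ∘ s≤s)
      where
      y∉Y : y ∉ Y
      y∉Y y∈Y = All.lookup y∉ y∈Y ≡.refl
      kept : ∀ d → Near Y b d → drops (y ∷ Y) b d ≡ drops Y b d
      kept d near = ≡.cong (λ t → ⟦ t ⟧ + drops Y b d)
          (dec-false (d y ℕ.<? b y) (ℕₚ.≤⇒≯ (ℕₚ.≤-reflexive (≡.sym (proj₂ (proj₂ (near y)) y∉Y)))))
      dropped : ∀ d → Near Y (b ↓ y) d → drops (y ∷ Y) b d ≡ suc (drops Y (b ↓ y) d)
      dropped d near = ≡.cong₂ (λ t m → ⟦ t ⟧ + m)
        (dec-true (d y ℕ.<? b y) (ℕₚ.≤-<-trans (proj₁ (near y)) (↓-< {b = b} (pos (here ≡.refl)))))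
        (drops-cong Y (λ z∈Y → ≡.sym (↓-other b λ { ≡.refl → y∉Y z∈Y })) (λ _ → ≡.refl))

    -- Lowering the pivot settles its block, and membership in M becomes the same condition for the
    -- remaining blocks with the same r. Each block adds one to the index through `H-level`.
    H-levels : ∀ Ls {Y r b} → Disjoint Ls Y → Positive (flatten Ls Y) b →
               (∀ d → Near (flatten Ls Y) b d → (M d → Inside Ls Y r b d) × (Inside Ls Y r b d → M d)) →
               H (flatten Ls Y) b (length Ls + suc r) (topFaces (length Y) r)
    H-levels [] {Y} {r} uY pos char = H-last Y r uY pos λ d near → let f , g = char d near in
      (λ Md → last (f Md)) , g ∘ few
      where
      last : ∀ {b d} → Inside [] Y r b d → drops Y b d < r
      last (few lt) = lt
    H-levels ((ys , x) ∷ Ls) {Y} {r} {b} (uys , x∉ys , x∉X , ys∩X , dj) pos char =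
      H-level ys uys (Disjoint⇒Unique Ls dj) x∉ys x∉X ys∩X pos
        (λ d near → proj₂ (char d (Near-⊆ X⊆ near))
            (undropped (here (proj₂ (proj₂ (near x)) x∉X , λ y∈ys → proj₂ (proj₂ (near _)) (ys∩X y∈ys)))))
        toggle
        (H-levels Ls dj (Positive-↓ x∉X (pos ∘ X⊆)) λ d near →
          let near′ = Near-⊆ xX⊆ (Near-↓ near x∉X) in
          (λ Md → Inside-cong Ls b≡b↓x (λ _ → ≡.refl)
              (rest d x (inj₁ ≡.refl) (ℕₚ.≤-<-trans (proj₁ (near x)) (↓-< {b = b} (pos x∈)))
                  (proj₁ (char d near′) Md))) ,
          λ ins → proj₂ (char d near′) (weaken d (Inside-cong Ls (λ y∈ → ≡.sym (b≡b↓x y∈)) (λ _ → ≡.refl) ins)))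
      where
      X : List (Fin n)
      X = flatten Ls Y
      X⊆ : ∀ {z} → z ∈ X → z ∈ ys List.++ x ∷ X
      X⊆ z∈ = ∈ₚ.∈-++⁺ʳ ys (there z∈)
      xX⊆ : ∀ {z} → z ∈ x ∷ X → z ∈ ys List.++ x ∷ X
      xX⊆ = ∈ₚ.∈-++⁺ʳ ys
      x∈ : x ∈ ys List.++ x ∷ X
      x∈ = ∈ₚ.∈-++⁺ʳ ys (here ≡.refl)
      b≡b↓x : ∀ {y} → y ∈ X → b y ≡ (b ↓ x) y
      b≡b↓x y∈ = ≡.sym (↓-other b λ { ≡.refl → x∉X y∈ })
      rest : ∀ d y → x ≡ y ⊎ y ∈ ys → d y < b y → Inside ((ys , x) ∷ Ls) Y r b d → Inside Ls Y r b d
      rest d y (inj₁ ≡.refl) d< (undropped (here (dx≡ , _)))  = contradiction dx≡ (ℕₚ.<⇒≢ d<)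
      rest d y (inj₂ y∈ys)   d< (undropped (here (_ , dys≡))) = contradiction (dys≡ y∈ys) (ℕₚ.<⇒≢ d<)
      rest d y _             d< (undropped (there any))       = undropped any
      rest d y _             d< (few lt)                      = few lt
      weaken : ∀ d → Inside Ls Y r b d → Inside ((ys , x) ∷ Ls) Y r b d
      weaken d (undropped any) = undropped (there any)
      weaken d (few lt)        = few lt
      -- Once y has dropped, its block can no longer be untouched, so membership is decided by the
      -- later blocks and Y, which do not contain x.
      toggle : ∀ y → y ∈ ys → ∀ d → Near (ys List.++ X) b d → d y < b y → M d → M (d ↓ x)
      toggle y y∈ys d near d< Md =
        proj₂ (char (d ↓ x) (Near-⊆ perm (Near-lower near x∉V)))
          (weaken (d ↓ x) (Inside-cong Ls (λ _ → ≡.refl) (λ z∈ → ≡.sym (↓-other d λ { ≡.refl → x∉X z∈ }))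
            (rest d y (inj₂ y∈ys) d< (proj₁ (char d (Near-⊆ (perm ∘ there) near)) Md))))
        where
        perm : ∀ {z} → z ∈ x ∷ ys List.++ X → z ∈ ys List.++ x ∷ X
        perm (here z≡x) = ∈ₚ.∈-++⁺ʳ ys (here z≡x)
        perm (there z∈) with ∈ₚ.∈-++⁻ ys z∈
        ... | inj₁ z∈ys = ∈ₚ.∈-++⁺ˡ z∈ys
        ... | inj₂ z∈X  = ∈ₚ.∈-++⁺ʳ ys (there z∈X)
        x∉V : x ∉ ys List.++ X
        x∉V x∈′ with ∈ₚ.∈-++⁻ ys x∈′
        ... | inj₁ x∈ys = x∉ys x∈ys
        ... | inj₂ x∈X  = x∉X x∈X

-- From polynomial matrices to scalar matrices

module _ {n : ℕ} where

  infixl 6 _⊖_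

  _⊖_ : Multidegree n → Multidegree n → Multidegree n
  _⊖_ = Vec.zipWith _∸_

  vec-ext : ∀ {a b : Multidegree n} → (∀ x → lookup a x ≡ lookup b x) → a ≡ b
  vec-ext {a} {b} a≗b = ≡.trans (≡.sym (Vecₚ.tabulate∘lookup a))
      (≡.trans (Vecₚ.tabulate-cong a≗b) (Vecₚ.tabulate∘lookup b))

  lookup-⊕ : ∀ (a b : Multidegree n) x → lookup (a ⊕ b) x ≡ lookup a x + lookup b x
  lookup-⊕ a b x = Vecₚ.lookup-zipWith _+_ x a b

  lookup-⊖ : ∀ (a b : Multidegree n) x → lookup (a ⊖ b) x ≡ lookup a x ∸ lookup b x
  lookup-⊖ a b x = Vecₚ.lookup-zipWith _∸_ x a b

  ⊖-⊕ : ∀ {a b : Multidegree n} → lookup a ⊑ lookup b → (b ⊖ a) ⊕ a ≡ b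
  ⊖-⊕ {a} {b} a⊑b = vec-ext λ x → ≡.trans (lookup-⊕ (b ⊖ a) a x)
    (≡.trans (≡.cong (_+ lookup a x) (lookup-⊖ b a x)) (ℕₚ.m∸n+n≡m (a⊑b x)))

  ⊕-⊖ : ∀ (a b : Multidegree n) → (a ⊕ b) ⊖ b ≡ a
  ⊕-⊖ a b = vec-ext λ x → ≡.trans (lookup-⊖ (a ⊕ b) b x)
    (≡.trans (≡.cong (_∸ lookup b x) (lookup-⊕ a b x)) (ℕₚ.m+n∸n≡m (lookup a x) (lookup b x)))

  ⊕-comm : ∀ (a b : Multidegree n) → a ⊕ b ≡ b ⊕ a
  ⊕-comm = Vecₚ.zipWith-comm ℕₚ.+-comm

  ⊕-assoc : ∀ (a b c : Multidegree n) → (a ⊕ b) ⊕ c ≡ a ⊕ (b ⊕ c)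
  ⊕-assoc = Vecₚ.zipWith-assoc ℕₚ.+-assoc

  ⊕-cancelʳ : ∀ {a b c : Multidegree n} → a ⊕ c ≡ b ⊕ c → a ≡ b
  ⊕-cancelʳ {a} {b} {c} eq = ≡.trans (≡.sym (⊕-⊖ a c)) (≡.trans (≡.cong (_⊖ c) eq) (⊕-⊖ b c))

  ⊕-cancelˡ : ∀ {a b c : Multidegree n} → c ⊕ a ≡ c ⊕ b → a ≡ b
  ⊕-cancelˡ {a} {b} {c} eq = ⊕-cancelʳ {a} {b} {c} (≡.trans (⊕-comm a c) (≡.trans eq (⊕-comm c b)))

  ⊑-⊕ʳ : ∀ (a b : Multidegree n) → lookup b ⊑ lookup (a ⊕ b)
  ⊑-⊕ʳ a b x = ≡.subst (lookup b x ≤_) (≡.sym (lookup-⊕ a b x)) (ℕₚ.m≤n+m _ _)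

  lookup-𝟎 : ∀ x → lookup (𝟎 {n}) x ≡ 0
  lookup-𝟎 x = Vecₚ.lookup-replicate x 0

  ⊖-𝟎 : ∀ (a : Multidegree n) → a ⊖ 𝟎 ≡ a
  ⊖-𝟎 a = vec-ext λ x → ≡.trans (lookup-⊖ a 𝟎 x) (≡.cong (lookup a x ∸_) (lookup-𝟎 x))

  ⊕-𝟎 : ∀ (a : Multidegree n) → a ⊕ 𝟎 ≡ a
  ⊕-𝟎 a = vec-ext λ x → ≡.trans (lookup-⊕ a 𝟎 x) (≡.trans (≡.cong (lookup a x +_) (lookup-𝟎 x)) (ℕₚ.+-identityʳ _))

  ⊖-zero : ∀ {a b : Multidegree n} → lookup a ⊑ lookup b → a ⊖ b ≡ 𝟎
  ⊖-zero {a} {b} a⊑b = vec-ext λ x → ≡.trans (lookup-⊖ a b x) (≡.trans (ℕₚ.m≤n⇒m∸n≡0 (a⊑b x)) (≡.sym (lookup-𝟎 x)))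

  lookup⊑tabulate : ∀ (a : Multidegree n) {b : Degree n} → lookup a ⊑ b → lookup a ⊑ lookup (tabulate b)
  lookup⊑tabulate a {b} a⊑b x = ≡.subst (lookup a x ≤_) (≡.sym (Vecₚ.lookup∘tabulate b x)) (a⊑b x)

  lookup⊑tabulate⁻ : ∀ (a : Multidegree n) {b : Degree n} → lookup a ⊑ lookup (tabulate b) → lookup a ⊑ b
  lookup⊑tabulate⁻ a {b} a⊑b x = ≡.subst (lookup a x ≤_) (Vecₚ.lookup∘tabulate b x) (a⊑b x)

module Strand {c ℓ₁ ℓ₂ : Level} (K : HeytingField c ℓ₁ ℓ₂)
              (_#?_ : Decidable (HeytingField._#_ K)) (n : ℕ) where

  open LinearAlgebra K _#?_
  open Graded K n
  open import Relation.Binary.Reasoning.Setoid setoid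

  coeff-hit : ∀ r {b a} p → b ≡ a → coeff ((r , b) ∷ p) a ≈ r +ᴷ coeff p a
  coeff-hit r {b} {a} p b≡a with b ≟ᵈ a
  ... | yes _  = refl
  ... | no b≢a = contradiction b≡a b≢a

  coeff-miss : ∀ r {b a} p → b ≢ a → coeff ((r , b) ∷ p) a ≈ coeff p a
  coeff-miss r {b} {a} p b≢a with b ≟ᵈ a
  ... | yes b≡a = contradiction b≡a b≢a
  ... | no _    = refl

  coeff-++ : ∀ p q a → coeff (p List.++ q) a ≈ coeff p a +ᴷ coeff q a
  coeff-++ []            q a = sym (+-identityˡ _)
  coeff-++ ((r , b) ∷ p) q a with b ≟ᵈ a
  ... | yes _ = trans (+-congˡ (coeff-++ p q a)) (sym (+-assoc _ _ _))
  ... | no  _ = coeff-++ p q a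

  coeff-neg : ∀ p a → coeff (R.- p) a ≈ -ᴷ coeff p a
  coeff-neg []            a = sym -0#≈0#
  coeff-neg ((r , b) ∷ p) a with b ≟ᵈ a
  ... | yes _ = trans (+-congˡ (coeff-neg p a)) (-‿+-comm _ _)
  ... | no  _ = coeff-neg p a

  coeff-term : ∀ r b q a {a′} → b ⊕ a′ ≡ a → coeff (List.map (mulTerm (r , b)) q) a ≈ r *ᴷ coeff q a′
  coeff-term r b []            a      eq = sym (zeroʳ r)
  coeff-term r b ((s , e) ∷ q) a {a′} eq with e ≟ᵈ a′
  ... | yes ≡.refl = trans (coeff-hit _ _ eq) (trans (+-congˡ (coeff-term r b q a eq)) (sym (distribˡ _ _ _)))
  ... | no  e≢a′   = trans (coeff-miss _ _ λ eq′ → e≢a′ (⊕-cancelˡ (≡.trans eq′ (≡.sym eq))))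
      (coeff-term r b q a eq)

  coeff-term-zero : ∀ r b q a → (∀ a′ → b ⊕ a′ ≢ a) → coeff (List.map (mulTerm (r , b)) q) a ≈ 0#
  coeff-term-zero r b []            a no-a′ = refl
  coeff-term-zero r b ((s , e) ∷ q) a no-a′ = trans (coeff-miss _ _ (no-a′ e)) (coeff-term-zero r b q a no-a′)

  quotient? : ∀ (b a : Multidegree n) → b ⊕ (a ⊖ b) ≡ a ⊎ (∀ a′ → b ⊕ a′ ≢ a)
  quotient? b a with b ⊕ (a ⊖ b) ≟ᵈ a
  ... | yes eq = inj₁ eq
  ... | no  ¬eq = inj₂ λ a′ eq → ¬eq
      (≡.trans (≡.cong (b ⊕_) (≡.trans (≡.cong (_⊖ b) (≡.trans (≡.sym eq) (⊕-comm b a′))) (⊕-⊖ a′ b))) eq)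

  -- Addition of exponents cancels, so only terms of p with exponent e can meet the single degree f
  -- of q; a repeated exponent in p adds up to its total coefficient.
  coeff-*-homogeneous : ∀ p q {f} → HomogeneousPoly q f → ∀ {a e} → e ⊕ f ≡ a →
                        coeff (p R.* q) a ≈ coeff p e *ᴷ coeff q f
  coeff-*-homogeneous []            q         hom        eq = sym (zeroˡ _)
  coeff-*-homogeneous ((r , b) ∷ p) q {f} hom {a} {e} eq =
    trans (coeff-++ (List.map (mulTerm (r , b)) q) (p R.* q) a) (by-quotient (quotient? b a))
    where
    ih : coeff (p R.* q) a ≈ coeff p e *ᴷ coeff q f
    ih = coeff-*-homogeneous p q hom eq
    miss : coeff (List.map (mulTerm (r , b)) q) a ≈ 0# → b ≢ e →
           coeff (List.map (mulTerm (r , b)) q) a +ᴷ coeff (p R.* q) a ≈ coeff ((r , b) ∷ p) e *ᴷ coeff q f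
    miss t≈0 b≢e = trans (+-cong t≈0 ih) (trans (+-identityˡ _) (*-congʳ (sym (coeff-miss r p b≢e))))
    by-quotient : b ⊕ (a ⊖ b) ≡ a ⊎ (∀ a′ → b ⊕ a′ ≢ a) →
                  coeff (List.map (mulTerm (r , b)) q) a +ᴷ coeff (p R.* q) a ≈ coeff ((r , b) ∷ p) e *ᴷ coeff q f
    by-quotient (inj₂ no-a′) = miss (coeff-term-zero r b q a no-a′) λ { ≡.refl → no-a′ f eq }
    by-quotient (inj₁ b⊕a′) with b ≟ᵈ e
    ... | yes ≡.refl = trans (+-cong (coeff-term r b q a eq) ih) (sym (distribʳ _ _ _))
    ... | no b≢e = trans (+-cong (trans (coeff-term r b q a b⊕a′) (trans (*-congˡ (hom (a ⊖ b) λ a′≡f →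
                      b≢e (⊕-cancelʳ (≡.trans (≡.cong (b ⊕_) (≡.sym a′≡f)) (≡.trans b⊕a′ (≡.sym eq))))))
                          (zeroʳ r))) ih) (+-identityˡ _)

  coeff-*-miss : ∀ p q {f} → HomogeneousPoly q f → ∀ {a} → (∀ e → e ⊕ f ≢ a) → coeff (p R.* q) a ≈ 0#
  coeff-*-miss []            q     hom     no-e = refl
  coeff-*-miss ((r , b) ∷ p) q {f} hom {a} no-e =
    trans (coeff-++ (List.map (mulTerm (r , b)) q) (p R.* q) a)
      (trans (+-cong (term (quotient? b a)) (coeff-*-miss p q hom no-e)) (+-identityˡ _))
    where
    term : b ⊕ (a ⊖ b) ≡ a ⊎ (∀ a′ → b ⊕ a′ ≢ a) → coeff (List.map (mulTerm (r , b)) q) a ≈ 0#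
    term (inj₂ no-a′) = coeff-term-zero r b q a no-a′
    term (inj₁ b⊕a′)  = trans (coeff-term r b q a b⊕a′)
      (trans (*-congˡ (hom (a ⊖ b) λ a′≡f → no-e b (≡.trans (≡.cong (b ⊕_) (≡.sym a′≡f)) b⊕a′))) (zeroʳ r))

  module _ {r : ℕ} (as : Fin r → Multidegree n) where

    opaque
      -- The degree b part of W as a scalar vector. The test guards against the truncation in `⊖`,
      -- which would otherwise read a wrong coefficient at basis elements not below b.
      component : Degree n → Vector Poly r → Vector Carrier r
      component b W q = if does (lookup (as q) ⊑? b) then coeff (W q) (tabulate b ⊖ as q) else 0#

      component-Supp : ∀ b W q → ¬ lookup (as q) ⊑ b → component b W q ≈ 0#
      component-Supp b W q q⋢b with lookup (as q) ⊑? b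
      ... | yes q⊑b = contradiction q⊑b q⋢b
      ... | no  _   = refl

      component-at : ∀ b W q → lookup (as q) ⊑ b → component b W q ≈ coeff (W q) (tabulate b ⊖ as q)
      component-at b W q q⊑b with lookup (as q) ⊑? b
      ... | yes _   = refl
      ... | no  q⋢b = contradiction q⊑b q⋢b

      homogenize : Degree n → Vector Carrier r → Vector Poly r
      homogenize b v q = if does (lookup (as q) ⊑? b) then (v q , tabulate b ⊖ as q) ∷ [] else []

      component-homogenize : ∀ b b′ v → tabulate b ≡ tabulate b′ → (∀ q → ¬ lookup (as q) ⊑ b′ → v q ≈ 0#) →
                             ∀ q → component b (homogenize b′ v) q ≈ v q
      component-homogenize b b′ v b≡b′ v∈U q with lookup (as q) ⊑? b | lookup (as q) ⊑? b′
      ... | yes _   | yes _    = trans (coeff-hit (v q) {tabulate b′ ⊖ as q} [] (≡.cong (_⊖ as q) (≡.sym b≡b′)))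
          (+-identityʳ _)
      ... | no  _   | no  q⋢b′ = sym (v∈U q q⋢b′)
      ... | yes q⊑b | no  q⋢b′ = contradiction
          (lookup⊑tabulate⁻ (as q) (≡.subst (λ t → lookup (as q) ⊑ lookup t) b≡b′
              (lookup⊑tabulate (as q) q⊑b))) q⋢b′
      ... | no  q⋢b | yes q⊑b′ = contradiction
          (lookup⊑tabulate⁻ (as q) (≡.subst (λ t → lookup (as q) ⊑ lookup t) (≡.sym b≡b′)
              (lookup⊑tabulate (as q) q⊑b′))) q⋢b

      component-homogenize-≢ : ∀ b b′ v → tabulate b ≢ tabulate b′ → ∀ q → component b (homogenize b′ v) q ≈ 0#
      component-homogenize-≢ b b′ v b≢b′ q with lookup (as q) ⊑? b | lookup (as q) ⊑? b′
      ... | no _    | _       = refl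
      ... | yes _   | no _    = refl
      ... | yes q⊑b | yes q⊑b′ = coeff-miss (v q) [] λ eq → b≢b′ (≡.sym
        (≡.trans (≡.sym (⊖-⊕ (lookup⊑tabulate (as q) q⊑b′)))
            (≡.trans (≡.cong (_⊕ as q) eq) (⊖-⊕ (lookup⊑tabulate (as q) q⊑b)))))

      component-cong : ∀ b {W W′ : Vector Poly r} → (∀ q → W q R.≈ W′ q) → ∀ q → component b W q ≈ component b W′ q
      component-cong b W≈W′ q with lookup (as q) ⊑? b
      ... | yes _ = W≈W′ q _
      ... | no  _ = refl

      component-𝟘 : ∀ b q → component b (λ _ → []) q ≈ 0#
      component-𝟘 b q with lookup (as q) ⊑? b
      ... | yes _ = refl
      ... | no  _ = refl

    -- The only possible exponent of `g q` is `as q ⊖ c`, so the map acts on degree b parts by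
    -- scalars. If c is not below `as q` then `g q` is zero; if `as q` is not below b, no exponent
    -- of the product fits.
    component-sum : ∀ (g : Fin r → Poly) c → (∀ q e → e ⊕ c ≢ as q → coeff (g q) e ≈ 0#) → ∀ W b → lookup c ⊑ b →
                    ∑ (λ q → coeff (W q R.* g q) (tabulate b ⊖ c)) ≈ ∑
                        (λ q → coeff (g q) (as q ⊖ c) *ᴷ component b W q)
    component-sum g c g-hom W b c⊑b = ∑-cong term
      where
      b̂-c : (tabulate b ⊖ c) ⊕ c ≡ tabulate b
      b̂-c = ⊖-⊕ (lookup⊑tabulate c c⊑b)
      term : ∀ q → coeff (W q R.* g q) (tabulate b ⊖ c) ≈ coeff (g q) (as q ⊖ c) *ᴷ component b W q
      term q with lookup c ⊑? lookup (as q)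
      ... | no c⋢a = trans (trans (vanish (as q)) (sym (zeroˡ _))) (*-congʳ (sym (g≈0 _)))
        where
        g≈0 : ∀ e → coeff (g q) e ≈ 0#
        g≈0 e = g-hom q e λ eq → c⋢a (≡.subst (λ a → lookup c ⊑ lookup a) eq (⊑-⊕ʳ e c))
        vanish : ∀ f → coeff (W q R.* g q) (tabulate b ⊖ c) ≈ 0#
        vanish f with quotient? f (tabulate b ⊖ c)
        ... | inj₁ eq = trans (coeff-*-homogeneous (W q) (g q) {f} (λ a _ → g≈0 a) (≡.trans (⊕-comm _ f) eq))
            (trans (*-congˡ (g≈0 f)) (zeroʳ _))
        ... | inj₂ no-e = coeff-*-miss (W q) (g q) {f} (λ a _ → g≈0 a) λ e eq → no-e e (≡.trans (⊕-comm f e) eq)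
      ... | yes c⊑a = by-degree (lookup (as q) ⊑? b)
        where
        f : Multidegree n
        f = as q ⊖ c
        f⊕c : f ⊕ c ≡ as q
        f⊕c = ⊖-⊕ c⊑a
        hom : HomogeneousPoly (g q) f
        hom e e≢f = g-hom q e λ eq → e≢f (⊕-cancelʳ (≡.trans eq (≡.sym f⊕c)))
        by-degree : Dec (lookup (as q) ⊑ b) → coeff (W q R.* g q) (tabulate b ⊖ c) ≈ coeff
            (g q) f *ᴷ component b W q
        by-degree (yes a⊑b) = trans
          (coeff-*-homogeneous (W q) (g q) hom (⊕-cancelʳ (≡.trans (⊕-assoc _ f c) (≡.trans (≡.cong (_ ⊕_) f⊕c)
            (≡.trans (⊖-⊕ (lookup⊑tabulate (as q) a⊑b)) (≡.sym b̂-c))))))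
          (trans (*-comm _ _) (*-congˡ (sym (component-at b W q a⊑b))))
        by-degree (no a⋢b) = trans
          (coeff-*-miss (W q) (g q) hom λ e eq → a⋢b
              (lookup⊑tabulate⁻ (as q) (≡.subst (λ t → lookup (as q) ⊑ lookup t)
            (≡.trans (≡.cong (e ⊕_) (≡.sym f⊕c))
                (≡.trans (≡.sym (⊕-assoc e f c)) (≡.trans (≡.cong (_⊕ c) eq) b̂-c))) (⊑-⊕ʳ e (as q)))))
          (sym (trans (*-congˡ (component-Supp b W q a⋢b)) (zeroʳ _)))

    component-sum₀ : ∀ (g : Fin r → Poly) → (∀ q → HomogeneousPoly (g q) (as q)) → ∀ W b →
                     ∑ (λ q → coeff (W q R.* g q) (tabulate b)) ≈ ∑ (λ q → coeff (g q) (as q) *ᴷ component b W q)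
    component-sum₀ g g-hom W b = begin
      ∑ (λ q → coeff (W q R.* g q) (tabulate b))             ≈⟨ ∑-cong
          (λ q → reflexive (≡.cong (coeff (W q R.* g q)) (⊖-𝟎 (tabulate b)))) ⟨
      ∑ (λ q → coeff (W q R.* g q) (tabulate b ⊖ 𝟎))         ≈⟨ component-sum g 𝟎
          (λ q e e≢ → g-hom q e λ eq → e≢ (≡.trans (⊕-𝟎 e) eq)) W b
              (λ x → ≡.subst (_≤ b x) (≡.sym (lookup-𝟎 x)) z≤n) ⟩
      ∑ (λ q → coeff (g q) (as q ⊖ 𝟎) *ᴷ component b W q)    ≈⟨ ∑-cong
          (λ q → *-congʳ (reflexive (≡.cong (coeff (g q)) (⊖-𝟎 (as q))))) ⟩
      ∑ (λ q → coeff (g q) (as q) *ᴷ component b W q)        ∎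

  coeff-free : ∀ (as : List (Multidegree n)) {r} (g : Vector (Vector Poly (length as)) r) W p e →
               coeff (RawGradedModule.linear (freeModule as) g W p) e ≈ ∑ (λ q → coeff (W q R.* g q p) e)
  coeff-free as {zero}  g W p e = sym (∑-zero λ ())
  coeff-free as {suc r} g W p e = trans (coeff-++ (W zero R.* g zero p) _ e)
    (trans (+-congˡ (coeff-free as (g ∘ suc) (W ∘ suc) p e)) (sym (∑-suc _)))

  module _ {X : Set} (gen : X → Poly) where

    coeff-ideal : ∀ {r} (g : Vector (Σ Poly (Ideal gen)) r) W e →
                  coeff (proj₁ (RawGradedModule.linear (idealModule gen) g W)) e ≈ ∑
                      (λ q → coeff (W q R.* proj₁ (g q)) e)
    coeff-ideal {zero}  g W e = sym (∑-zero λ ())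
    coeff-ideal {suc r} g W e = trans (coeff-++ (W zero R.* proj₁ (g zero)) _ e)
      (trans (+-congˡ (coeff-ideal (g ∘ suc) (W ∘ suc) e)) (sym (∑-suc _)))

    coeff-quotient : ∀ {r} (g : Vector Poly r) W e →
                     coeff (RawGradedModule.linear (quotientModule gen) g W) e ≈ ∑ (λ q → coeff (W q R.* g q) e)
    coeff-quotient {zero}  g W e = sym (∑-zero λ ())
    coeff-quotient {suc r} g W e = trans (coeff-++ (W zero R.* g zero) _ e)
      (trans (+-congˡ (coeff-quotient (g ∘ suc) (W ∘ suc) e)) (sym (∑-suc _)))

  -- A homogenized vector lives in one degree only, so a single scalar equation there controls all
  -- coefficients. Degrees are compared after `tabulate` because they are functions.
  ∑-component-homogenize : ∀ {r} (as : Fin r → Multidegree n) (E v : Vector Carrier r) b b′ →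
                           (∀ q → ¬ lookup (as q) ⊑ b → v q ≈ 0#) →
                           (tabulate b′ ≡ tabulate b → ∑ (λ q → E q *ᴷ v q) ≈ 0#) →
                           ∑ (λ q → E q *ᴷ component as b′ (homogenize as b v) q) ≈ 0#
  ∑-component-homogenize as E v b b′ v∈U Ev≈0 with tabulate b′ ≟ᵈ tabulate b
  ... | yes eq = trans (∑-cong λ q → *-congˡ (component-homogenize as b′ b v eq v∈U q)) (Ev≈0 eq)
  ... | no neq = ∑-zero λ q → trans (*-congˡ (component-homogenize-≢ as b′ b v neq q)) (zeroʳ _)

  module FreeMap (cs as : List (Multidegree n)) (g : Vector (Vector Poly (length cs)) (length as))
                 (g-hom : ∀ q p e → e ⊕ List.lookup cs p ≢ List.lookup as q → coeff (g q p) e ≈ 0#) where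

    linear : Vector Poly (length as) → Vector Poly (length cs)
    linear = RawGradedModule.linear (freeModule cs) g

    degˢ : Fin (length as) → Degree n
    degˢ q = lookup (List.lookup as q)

    degᵗ : Fin (length cs) → Degree n
    degᵗ p = lookup (List.lookup cs p)

    entry : Fin (length cs) → Fin (length as) → Carrier
    entry p q = coeff (g q p) (List.lookup as q ⊖ List.lookup cs p)

    entry-mono : ∀ p q → ¬ degᵗ p ⊑ degˢ q → entry p q ≈ 0#
    entry-mono p q p⋢q = g-hom q p _ λ eq → p⋢q
        (≡.subst (λ t → degᵗ p ⊑ lookup t) eq (⊑-⊕ʳ (List.lookup as q ⊖ List.lookup cs p) (List.lookup cs p)))

    component-linear : ∀ W b p → component (List.lookup cs) b (linear W) p ≈
                                 ∑ (λ q → entry p q *ᴷ component (List.lookup as) b W q)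
    component-linear W b p = by-degree (degᵗ p ⊑? b)
      where
      by-degree : Dec (degᵗ p ⊑ b) → component (List.lookup cs) b (linear W) p ≈
                                     ∑ (λ q → entry p q *ᴷ component (List.lookup as) b W q)
      by-degree (yes p⊑b) = begin
        component (List.lookup cs) b (linear W) p                         ≈⟨ component-at (List.lookup cs) b
            (linear W) p p⊑b ⟩
        coeff (linear W p) (tabulate b ⊖ List.lookup cs p)                ≈⟨ coeff-free cs g W p _ ⟩
        ∑ (λ q → coeff (W q R.* g q p) (tabulate b ⊖ List.lookup cs p))   ≈⟨ component-sum (List.lookup as)
            (λ q → g q p) (List.lookup cs p) (λ q → g-hom q p) W b p⊑b ⟩
        ∑ (λ q → entry p q *ᴷ component (List.lookup as) b W q)           ∎
      by-degree (no p⋢b) = trans (component-Supp (List.lookup cs) b (linear W) p p⋢b) (sym (∑-zero term))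
        where
        term : ∀ q → entry p q *ᴷ component (List.lookup as) b W q ≈ 0#
        term q with degᵗ p ⊑? degˢ q
        ... | no  p⋢q = trans (*-congʳ (entry-mono p q p⋢q)) (zeroˡ _)
        ... | yes p⊑q = trans (*-congˡ
            (component-Supp (List.lookup as) b W q λ q⊑b → p⋢b (⊑-trans {a = degᵗ p} p⊑q q⊑b))) (zeroʳ _)

    -- Together with `linear-homogenize-zero` this carries exactness to strands: that lemma turns a
    -- scalar kernel vector into a polynomial one, and this one turns the polynomial preimage back
    -- into a scalar preimage.
    lift : ∀ {b v W} → (∀ p → ¬ degᵗ p ⊑ b → v p ≈ 0#) → (∀ p → linear W p R.≈ homogenize (List.lookup cs) b v p) →
           ∀ p → v p ≈ ∑ (λ q → entry p q *ᴷ component (List.lookup as) b W q)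
    lift {b} {v} {W} v∈U W↦v p = begin
      v p                                                                      ≈⟨ component-homogenize
          (List.lookup cs) b b v ≡.refl v∈U p ⟨
      component (List.lookup cs) b (homogenize (List.lookup cs) b v) p         ≈⟨ component-cong
          (List.lookup cs) b {linear W} W↦v p ⟨
      component (List.lookup cs) b (linear W) p                                ≈⟨ component-linear W b p ⟩
      ∑ (λ q → entry p q *ᴷ component (List.lookup as) b W q)                  ∎

    linear-homogenize : ∀ b v → (∀ q → ¬ degˢ q ⊑ b → v q ≈ 0#) → ∀ p →
                        component (List.lookup cs) b (linear (homogenize (List.lookup as) b v)) p ≈ ∑
                            (λ q → entry p q *ᴷ v q)
    linear-homogenize b v v∈U p = trans (component-linear _ b p)
      (∑-cong λ q → *-congˡ (component-homogenize (List.lookup as) b b v ≡.refl v∈U q))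

    linear-homogenize-zero : ∀ b v → (∀ q → ¬ degˢ q ⊑ b → v q ≈ 0#) → (∀ p → ∑ (λ q → entry p q *ᴷ v q) ≈ 0#) →
                             ∀ p → linear (homogenize (List.lookup as) b v) p R.≈ []
    linear-homogenize-zero b v v∈U Dv≈0 p e = begin
      coeff (linear W p) e                                             ≈⟨ reflexive
          (≡.cong (coeff (linear W p)) e≡) ⟩
      coeff (linear W p) (tabulate b′ ⊖ List.lookup cs p)              ≈⟨ component-at (List.lookup cs) b′
          (linear W) p (⊑-⊕ʳ e (List.lookup cs p)) ⟨
      component (List.lookup cs) b′ (linear W) p                       ≈⟨ component-linear W b′ p ⟩
      ∑ (λ q → entry p q *ᴷ component (List.lookup as) b′ W q)         ≈⟨ ∑-component-homogenize (List.lookup as)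
          (entry p) v b b′ v∈U (λ _ → Dv≈0 p) ⟩
      0#                                                               ∎
      where
      W : Vector Poly (length as)
      W = homogenize (List.lookup as) b v
      b′ : Degree n
      b′ = lookup (e ⊕ List.lookup cs p)
      e≡ : e ≡ tabulate b′ ⊖ List.lookup cs p
      e≡ = ≡.trans (≡.sym (⊕-⊖ e (List.lookup cs p)))
          (≡.cong (_⊖ List.lookup cs p) (≡.sym (Vecₚ.tabulate∘lookup (e ⊕ List.lookup cs p))))

  composite-zero : ∀ (as₀ as₁ as₂ : List (Multidegree n)) g₀ g₁ hom₀ hom₁ →
    let module L₀ = FreeMap as₀ as₁ g₀ hom₀
        module L₁ = FreeMap as₁ as₂ g₁ hom₁
    in (∀ W p → L₀.linear (L₁.linear W) p R.≈ []) →
       ∀ b w → (∀ q → ¬ L₁.degˢ q ⊑ b → w q ≈ 0#) →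
       ∀ p → ∑ (λ q → L₀.entry p q *ᴷ ∑ (λ r → L₁.entry q r *ᴷ w r)) ≈ 0#
  composite-zero as₀ as₁ as₂ g₀ g₁ hom₀ hom₁ L₀L₁≈0 b w w∈U p = begin
    ∑ (λ q → L₀.entry p q *ᴷ ∑ (λ r → L₁.entry q r *ᴷ w r))                        ≈⟨ ∑-cong
        (λ q → *-congˡ (L₁.linear-homogenize b w w∈U q)) ⟨
    ∑ (λ q → L₀.entry p q *ᴷ component (List.lookup as₁) b (L₁.linear W) q)        ≈⟨ L₀.component-linear _ b p ⟨
    component (List.lookup as₀) b (L₀.linear (L₁.linear W)) p                      ≈⟨ component-cong
        (List.lookup as₀) b (L₀L₁≈0 W) p ⟩
    component (List.lookup as₀) b (λ _ → []) p                                     ≈⟨ component-𝟘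
        (List.lookup as₀) b p ⟩
    0#                                                                             ∎
    where
    module L₀ = FreeMap as₀ as₁ g₀ hom₀
    module L₁ = FreeMap as₁ as₂ g₁ hom₁
    W : Vector Poly (length as₂)
    W = homogenize (List.lookup as₂) b w

-- Resolutions of a monomial ideal and of its quotient as scalar complexes.

module MonomialIdeal {c ℓ₁ ℓ₂ : Level} (K : HeytingField c ℓ₁ ℓ₂)
                     (_#?_ : Decidable (HeytingField._#_ K)) (n : ℕ)
                     (M : Degree n → Set) (M? : ∀ b → Dec (M b))
                     (M-up : ∀ {a b} → a ⊑ b → M a → M b) (¬M-𝟎 : ¬ M (lookup 𝟎))
                     {X : Set} (exponent : X → Multidegree n)
                     (exponent-M : ∀ x → M (lookup (exponent x)))
                     (M-exponent : ∀ {b} → M b → ∃ λ x → lookup (exponent x) ⊑ b) where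

  open QuotientResolution K _#?_ n M M? M-up public
  open Graded K n
  open Strand K _#?_ n
  open import Relation.Binary.Reasoning.Setoid setoid

  gens : X → Poly
  gens x = x^ (exponent x)

  I : Poly → Set (c ⊔ ℓ₁)
  I = Ideal gens

  -- If e is outside M then so is e - b, since M is closed upwards. Hence the coefficients outside M
  -- are well defined modulo the ideal.
  coeff-*-outside : ∀ W {q q′} → (∀ e → ¬ M (lookup e) → coeff q e ≈ coeff q′ e) →
                    ∀ e → ¬ M (lookup e) → coeff (W R.* q) e ≈ coeff (W R.* q′) e
  coeff-*-outside []            q≈q′ e e∉M = refl
  coeff-*-outside ((r , b) ∷ W) {q} {q′} q≈q′ e e∉M =
    trans (coeff-++ (List.map (mulTerm (r , b)) q) (W R.* q) e)
      (trans (+-cong (term (quotient? b e)) (coeff-*-outside W q≈q′ e e∉M))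
        (sym (coeff-++ (List.map (mulTerm (r , b)) q′) (W R.* q′) e)))
    where
    term : b ⊕ (e ⊖ b) ≡ e ⊎ (∀ a′ → b ⊕ a′ ≢ e) →
           coeff (List.map (mulTerm (r , b)) q) e ≈ coeff (List.map (mulTerm (r , b)) q′) e
    term (inj₂ no-a) = trans (coeff-term-zero r b q e no-a) (sym (coeff-term-zero r b q′ e no-a))
    term (inj₁ eq)   = trans (coeff-term r b q e eq) (trans (*-congˡ (q≈q′ (e ⊖ b) λ Me-b → e∉M (M-up
      (≡.subst (λ t → lookup (e ⊖ b) ⊑ lookup t) eq (⊑-⊕ʳ b (e ⊖ b))) Me-b))) (sym (coeff-term r b q′ e eq)))

  ideal⇒outside : ∀ {p} → I p → ∀ e → ¬ M (lookup e) → coeff p e ≈ 0#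
  ideal⇒outside (gen x)          e e∉M = coeff-miss 1# {exponent x} {e} [] λ { ≡.refl → e∉M (exponent-M x) }
  ideal⇒outside zero             e e∉M = refl
  ideal⇒outside (add {p} {q} a b) e e∉M = trans (coeff-++ p q e)
      (trans (+-cong (ideal⇒outside a e e∉M) (ideal⇒outside b e e∉M)) (+-identityˡ _))
  ideal⇒outside (mul p {q} a)    e e∉M = trans (coeff-*-outside p {q} {[]} (ideal⇒outside a) e e∉M) (*-[] p)
    where
    *-[] : ∀ p → coeff (p R.* []) e ≈ 0#
    *-[] []      = refl
    *-[] (_ ∷ p) = *-[] p
  ideal⇒outside (resp p≈q a)     e e∉M = trans (sym (p≈q e)) (ideal⇒outside a e e∉M)

  term∈I : ∀ r b → M (lookup b) → I ((r , b) ∷ [])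
  term∈I r b Mb with x , x⊑b ← M-exponent Mb = resp eq (mul ((r , b ⊖ exponent x) ∷ []) (gen x))
    where
    eq : (((r *ᴷ 1# , (b ⊖ exponent x) ⊕ exponent x)) ∷ []) R.≈ ((r , b) ∷ [])
    eq a with b ≟ᵈ a
    ... | yes b≡a = trans (coeff-hit _ [] (≡.trans (⊖-⊕ x⊑b) b≡a)) (+-congʳ (*-identityʳ r))
    ... | no  b≢a = coeff-miss _ [] (b≢a ∘ ≡.trans (≡.sym (⊖-⊕ x⊑b)))

  -- p may list terms outside M that cancel each other, so it cannot be assembled from its own
  -- terms: `part` discards those terms and `resp` identifies the result with p.
  outside⇒ideal : ∀ p → (∀ e → ¬ M (lookup e) → coeff p e ≈ 0#) → I p
  outside⇒ideal p out = let q , q∈I , q-in , q-out = part p in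
    resp (λ e → by-M {q} e q-in q-out (M? (lookup e))) q∈I
    where
    part : ∀ p → ∃ λ q → I q × (∀ e → M (lookup e) → coeff q e ≈ coeff p e) ×
        (∀ e → ¬ M (lookup e) → coeff q e ≈ 0#)
    part [] = [] , zero , (λ _ _ → refl) , λ _ _ → refl
    part ((r , b) ∷ p) with M? (lookup b) | part p
    ... | yes Mb | q , q∈I , q-in , q-out = (r , b) ∷ q , add (term∈I r b Mb) q∈I , same , λ e e∉M →
      trans (coeff-miss r {b} {e} q λ { ≡.refl → e∉M Mb }) (q-out e e∉M)
      where
      same : ∀ e → M (lookup e) → coeff ((r , b) ∷ q) e ≈ coeff ((r , b) ∷ p) e
      same e Me with b ≟ᵈ e
      ... | yes _ = +-congˡ (q-in e Me)
      ... | no  _ = q-in e Me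
    ... | no ¬Mb | q , q∈I , q-in , q-out =
      q , q∈I , (λ e Me → trans (q-in e Me) (sym (coeff-miss r {b} {e} p λ { ≡.refl → ¬Mb Me }))) , q-out
    by-M : ∀ {q} e → (∀ e → M (lookup e) → coeff q e ≈ coeff p e) → (∀ e → ¬ M (lookup e) → coeff q e ≈ 0#) →
           Dec (M (lookup e)) → coeff q e ≈ coeff p e
    by-M e q-in q-out (yes Me)  = q-in e Me
    by-M e q-in q-out (no  e∉M) = trans (q-out e e∉M) (sym (out e e∉M))

  ≈ideal⇒outside : ∀ p q → I (p R.+ (R.- q)) → ∀ e → ¬ M (lookup e) → coeff p e ≈ coeff q e
  ≈ideal⇒outside p q p-q∈I e e∉M = x∙y⁻¹≈ε⇒x≈y _ _ (trans (+-congˡ (sym (coeff-neg q e)))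
    (trans (sym (coeff-++ p _ e)) (ideal⇒outside p-q∈I e e∉M)))

  outside⇒≈ideal : ∀ p q → (∀ e → ¬ M (lookup e) → coeff p e ≈ coeff q e) → I (p R.+ (R.- q))
  outside⇒≈ideal p q out = outside⇒ideal _ λ e e∉M → trans (coeff-++ p _ e)
    (trans (+-cong (out e e∉M) (coeff-neg q e)) (-‿inverseʳ _))

  M-tabulate⁺ : ∀ {b} → M b → M (lookup (tabulate b))
  M-tabulate⁺ {b} = M-up λ x → ℕₚ.≤-reflexive (≡.sym (Vecₚ.lookup∘tabulate b x))

  M-tabulate⁻ : ∀ {b} → M (lookup (tabulate b)) → M b
  M-tabulate⁻ {b} = M-up λ x → ℕₚ.≤-reflexive (Vecₚ.lookup∘tabulate b x)

  D≈0 : ∀ {m} {f v : Vector Carrier m} → (∀ q → v q ≈ 0#) → ∑ (λ q → f q *ᴷ v q) ≈ 0#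
  D≈0 v≈0 = ∑-zero λ q → trans (*-congˡ (v≈0 q)) (zeroʳ _)

  module FromQuotient (𝓖 : MinimalFreeResolution (quotientModule gens)) where

    open MinimalFreeResolution 𝓖 hiding (F; module F)
    private
      module 𝓜 = RawGradedModule (quotientModule gens)
      module L (i : ℕ) = FreeMap (degrees i) (degrees (suc i)) (d i) (d-homogeneous i)

    rankᶜ : ℕ → ℕ
    rankᶜ zero          = 0
    rankᶜ (suc zero)    = 0
    rankᶜ (suc (suc i)) = rank i

    degᶜ : ∀ i → Fin (rankᶜ i) → Degree n
    degᶜ (suc (suc i)) p = lookup (List.lookup (degrees i) p)

    ∂ᶜ : ∀ i → Fin (rankᶜ i) → Fin (rankᶜ (suc i)) → Carrier
    ∂ᶜ (suc (suc i)) = L.entry i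

    complex : Complex
    complex = record
      { rank = rankᶜ ; deg = degᶜ ; ∂ = ∂ᶜ
      ; ∂-mono = λ { (suc (suc i)) → L.entry-mono i }
      ; ∂∂ = λ { (suc (suc i)) →
                              composite-zero (degrees i) (degrees (suc i)) (degrees (suc (suc i))) (d i)
                                  (d (suc i))
                            (d-homogeneous i) (d-homogeneous (suc i)) (d∘d≈0 i) } }

    -- `ε q` is homogeneous only modulo the ideal; this representative is homogeneous on the nose
    -- and agrees with it outside M.
    h : Fin (rank 0) → Poly
    h q = proj₁ (ε-homogeneous q)

    E : Vector Carrier (rank 0)
    E q = coeff (h q) (List.lookup (degrees 0) q)

    coeff-ε : ∀ W b → ¬ M b → coeff (𝓜.linear ε W) (tabulate b) ≈ ∑
        (λ q → E q *ᴷ component (List.lookup (degrees 0)) b W q)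
    coeff-ε W b ¬Mb = begin
      coeff (𝓜.linear ε W) (tabulate b)                       ≈⟨ coeff-quotient gens ε W _ ⟩
      ∑ (λ q → coeff (W q R.* ε q) (tabulate b))              ≈⟨ ∑-cong
          (λ q → coeff-*-outside (W q) (≈ideal⇒outside (ε q) (h q) (proj₂ (proj₂ (ε-homogeneous q)))) _
              (¬Mb ∘ M-tabulate⁻)) ⟩
      ∑ (λ q → coeff (W q R.* h q) (tabulate b))              ≈⟨ component-sum₀ (List.lookup (degrees 0)) h
          (λ q → proj₁ (proj₂ (ε-homogeneous q))) W b ⟩
      ∑ (λ q → E q *ᴷ component (List.lookup (degrees 0)) b W q) ∎

    coeff-ε-homogenize : ∀ b v → (∀ q → ¬ degᶜ 2 q ⊑ b → v q ≈ 0#) → (¬ M b → ∑ (λ q → E q *ᴷ v q) ≈ 0#) →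
                         𝓜.linear ε (homogenize (List.lookup (degrees 0)) b v) 𝓜.≈ᴹ 𝓜.0ᴹ
    coeff-ε-homogenize b v v∈U Ev≈0 = outside⇒≈ideal (𝓜.linear ε W) [] λ e e∉M → begin
      coeff (𝓜.linear ε W) e                       ≈⟨ reflexive
          (≡.cong (coeff (𝓜.linear ε W)) (Vecₚ.tabulate∘lookup e)) ⟨
      coeff (𝓜.linear ε W) (tabulate (lookup e))   ≈⟨ coeff-ε W (lookup e) e∉M ⟩
      ∑ (λ q → E q *ᴷ component (List.lookup (degrees 0)) (lookup e) W q) ≈⟨ ∑-component-homogenize
          (List.lookup (degrees 0)) E v b (lookup e) v∈U
                                                             (λ eq → Ev≈0 λ Mb → e∉M (M-tabulate⁻
                                                                 (≡.subst (M ∘ lookup) (≡.sym eq)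
                                                                     (M-tabulate⁺ Mb)))) ⟩
      0#                                           ∎
      where
      W : Vector Poly (rank 0)
      W = homogenize (List.lookup (degrees 0)) b v

    -- In a degree of M everything is zero modulo the ideal, so the equation is imposed only outside
    -- M. This serves `onto` and `aug-ker` alike.
    kernel : ∀ b v → (∀ q → ¬ degᶜ 2 q ⊑ b → v q ≈ 0#) → (¬ M b → ∑ (λ q → E q *ᴷ v q) ≈ 0#) →
             ∃ λ w → (∀ q → ¬ degᶜ 3 q ⊑ b → w q ≈ 0#) × (∀ p → v p ≈ ∑ (λ q → L.entry 0 p q *ᴷ w q))
    kernel b v v∈U Ev≈0 with W , W↦v ← ker-ε⊆im (homogenize (List.lookup (degrees 0)) b v) (coeff-ε-homogenize b v v∈U Ev≈0) =
      component (List.lookup (degrees 1)) b W , component-Supp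
          (List.lookup (degrees 1)) b W , L.lift 0 {b} {v} {W} v∈U W↦v

    resolves : Resolves complex
    resolves = record
      { rank₁≡0 = ≡.refl
      ; exact = λ i b v v∈U Dv≈0 →
          let W , W↦v = ker-d⊆im i (homogenize (List.lookup (degrees (suc i))) b v) (L.linear-homogenize-zero i b v v∈U Dv≈0) in
          component (List.lookup (degrees (2 + i))) b W , component-Supp
              (List.lookup (degrees (2 + i))) b W , L.lift (suc i) {b} {v} {W} v∈U W↦v
      ; onto = λ b v Mb v∈U → kernel b v v∈U λ ¬Mb → contradiction Mb ¬Mb
      ; e = E
      ; aug-∂ = λ b w ¬Mb w∈U → begin
          ∑ (λ p → E p *ᴷ ∑ (λ q → L.entry 0 p q *ᴷ w q))   ≈⟨ ∑-cong
              (λ p → *-congˡ (L.linear-homogenize 0 b w w∈U p)) ⟨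
          ∑ (λ p → E p *ᴷ component (List.lookup (degrees 0)) b
              (L.linear 0 (homogenize (List.lookup (degrees 1)) b w)) p) ≈⟨ coeff-ε _ b ¬Mb ⟨
          coeff (𝓜.linear ε (L.linear 0 (homogenize (List.lookup (degrees 1)) b w))) (tabulate b)
            ≈⟨ ≈ideal⇒outside _ [] (ε∘d≈0 (homogenize (List.lookup (degrees 1)) b w)) (tabulate b)
                (¬Mb ∘ M-tabulate⁻) ⟩
          0#                                                ∎
      ; aug-ker = λ b v ¬Mb v∈U Ev≈0 → kernel b v v∈U λ _ → Ev≈0
      ; aug-unit = λ b ¬Mb → let W , W↦1 = ε-surjective (x^ (tabulate b)) in
          component (List.lookup (degrees 0)) b W , component-Supp (List.lookup (degrees 0)) b W ,
          trans (sym (coeff-ε W b ¬Mb)) (trans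
              (≈ideal⇒outside _ (x^ (tabulate b)) W↦1 (tabulate b) (¬Mb ∘ M-tabulate⁻))
            (trans (coeff-hit 1# {tabulate b} [] ≡.refl) (+-identityʳ _))) }

    complex-minimal : Minimal complex
    complex-minimal (suc (suc i)) p q _ q⊑p =
      trans (reflexive (≡.cong (coeff (d i q p)) (⊖-zero q⊑p))) (minimal i q p)

  module FromIdeal (𝓕 : MinimalFreeResolution (idealModule gens)) where

    open MinimalFreeResolution 𝓕 hiding (F; module F)
    private
      module 𝓜 = RawGradedModule (idealModule gens)
      module L (i : ℕ) = FreeMap (degrees i) (degrees (suc i)) (d i) (d-homogeneous i)

    -- The resolution of the ideal is continued by the inclusion of the ideal into R.
    rankᶜ : ℕ → ℕ
    rankᶜ zero                = 0
    rankᶜ (suc zero)          = 0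
    rankᶜ (suc (suc zero))    = 1
    rankᶜ (suc (suc (suc i))) = rank i

    degᶜ : ∀ i → Fin (rankᶜ i) → Degree n
    degᶜ (suc (suc zero))    _ = lookup 𝟎
    degᶜ (suc (suc (suc i))) p = lookup (List.lookup (degrees i) p)

    E : Vector Carrier (rank 0)
    E q = coeff (proj₁ (ε q)) (List.lookup (degrees 0) q)

    ∂ᶜ : ∀ i → Fin (rankᶜ i) → Fin (rankᶜ (suc i)) → Carrier
    ∂ᶜ (suc (suc zero))    _ q = E q
    ∂ᶜ (suc (suc (suc i)))     = L.entry i

    coeff-ε : ∀ W b → coeff (proj₁ (𝓜.linear ε W)) (tabulate b) ≈ ∑
        (λ q → E q *ᴷ component (List.lookup (degrees 0)) b W q)
    coeff-ε W b = trans (coeff-ideal gens ε W _)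
        (component-sum₀ (List.lookup (degrees 0)) (proj₁ ∘ ε) ε-homogeneous W b)

    ε-entry : ∀ b w → (∀ q → ¬ degᶜ 3 q ⊑ b → w q ≈ 0#) →
              ∑ (λ q → E q *ᴷ w q) ≈ coeff (proj₁ (𝓜.linear ε (homogenize (List.lookup (degrees 0)) b w)))
                  (tabulate b)
    ε-entry b w w∈U = sym (trans (coeff-ε _ b)
        (∑-cong λ q → *-congˡ (component-homogenize (List.lookup (degrees 0)) b b w ≡.refl w∈U q)))

    ε∂ : ∀ b w → (∀ q → ¬ degᶜ 4 q ⊑ b → w q ≈ 0#) → ∑ (λ p → E p *ᴷ ∑ (λ q → L.entry 0 p q *ᴷ w q)) ≈ 0#
    ε∂ b w w∈U = begin
      ∑ (λ p → E p *ᴷ ∑ (λ q → L.entry 0 p q *ᴷ w q))   ≈⟨ ∑-cong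
          (λ p → *-congˡ (L.linear-homogenize 0 b w w∈U p)) ⟨
      ∑ (λ p → E p *ᴷ component (List.lookup (degrees 0)) b
          (L.linear 0 (homogenize (List.lookup (degrees 1)) b w)) p) ≈⟨ coeff-ε _ b ⟨
      coeff (proj₁ (𝓜.linear ε (L.linear 0 (homogenize (List.lookup (degrees 1)) b w)))) (tabulate b)
        ≈⟨ ε∘d≈0 (homogenize (List.lookup (degrees 1)) b w) (tabulate b) ⟩
      0#                                                ∎

    complex : Complex
    complex = record
      { rank = rankᶜ ; deg = degᶜ ; ∂ = ∂ᶜ
      ; ∂-mono = λ { (suc (suc zero)) _ q 𝟎⋢ → contradiction
          (λ x → ≡.subst (_≤ degᶜ 3 q x) (≡.sym (lookup-𝟎 x)) z≤n) 𝟎⋢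
                   ; (suc (suc (suc i))) → L.entry-mono i }
      ; ∂∂ = λ { (suc (suc zero)) b w w∈U _ → ε∂ b w w∈U
               ; (suc (suc (suc i))) →
                              composite-zero (degrees i) (degrees (suc i)) (degrees (suc (suc i))) (d i)
                                  (d (suc i))
                            (d-homogeneous i) (d-homogeneous (suc i)) (d∘d≈0 i) } }

    kernel : ∀ b v → (∀ q → ¬ degᶜ 3 q ⊑ b → v q ≈ 0#) → ∑ (λ q → E q *ᴷ v q) ≈ 0# →
             proj₁ (𝓜.linear ε (homogenize (List.lookup (degrees 0)) b v)) R.≈ []
    kernel b v v∈U Ev≈0 e = begin
      coeff (proj₁ (𝓜.linear ε W)) e                       ≈⟨ reflexive
          (≡.cong (coeff (proj₁ (𝓜.linear ε W))) (Vecₚ.tabulate∘lookup e)) ⟨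
      coeff (proj₁ (𝓜.linear ε W)) (tabulate (lookup e))   ≈⟨ coeff-ε W (lookup e) ⟩
      ∑ (λ q → E q *ᴷ component (List.lookup (degrees 0)) (lookup e) W q) ≈⟨ ∑-component-homogenize
          (List.lookup (degrees 0)) E v b (lookup e) v∈U (λ _ → Ev≈0) ⟩
      0#                                           ∎
      where
      W : Vector Poly (rank 0)
      W = homogenize (List.lookup (degrees 0)) b v

    private
      ∑₁ : (v : Vector Carrier 1) → ∑ (λ p → 1# *ᴷ v p) ≈ v zero
      ∑₁ v = trans (∑-suc {0} _) (trans (+-cong (*-identityˡ _) (∑-zero λ ())) (+-identityʳ _))

    resolves : Resolves complex
    resolves = record
      { rank₁≡0 = ≡.refl
      ; exact = λ
          { zero b v v∈U Dv≈0 → let W , W↦v = ker-ε⊆im (homogenize (List.lookup (degrees 0)) b v) (kernel b v v∈U (Dv≈0 zero)) in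
              component (List.lookup (degrees 1)) b W , component-Supp
                  (List.lookup (degrees 1)) b W , L.lift 0 {b} {v} {W} v∈U W↦v
          ; (suc i) b v v∈U Dv≈0 → let W , W↦v = ker-d⊆im i (homogenize (List.lookup (degrees (suc i))) b v) (L.linear-homogenize-zero i b v v∈U Dv≈0) in
              component (List.lookup (degrees (2 + i))) b W , component-Supp
                  (List.lookup (degrees (2 + i))) b W , L.lift (suc i) {b} {v} {W} v∈U W↦v }
      -- For b in M the monomial x^b with coefficient `v zero` lies in the ideal, and a preimage
      -- under ε supplies w.
      ; onto = λ b v Mb _ → let W , W↦v = ε-surjective ((v zero , tabulate b) ∷ [] , term∈I (v zero) (tabulate b) (M-tabulate⁺ Mb)) in
          component (List.lookup (degrees 0)) b W , component-Supp (List.lookup (degrees 0)) b W , λ { zero →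
            trans (sym (trans (W↦v (tabulate b))
                (trans (coeff-hit (v zero) {tabulate b} [] ≡.refl) (+-identityʳ _)))) (coeff-ε W b) }
      ; e = λ _ → 1#
      ; aug-∂ = λ b w ¬Mb w∈U → trans (∑₁ _) (trans (ε-entry b w w∈U)
          (ideal⇒outside (proj₂ (𝓜.linear ε (homogenize (List.lookup (degrees 0)) b w))) (tabulate b)
              (¬Mb ∘ M-tabulate⁻)))
      ; aug-ker = λ b v ¬Mb v∈U v≈0 → (λ _ → 0#) , (λ _ _ → refl) , λ { zero →
          trans (trans (sym (∑₁ v)) v≈0) (sym (D≈0 λ _ → refl)) }
      ; aug-unit = λ b ¬Mb → (λ _ → 1#) ,
          (λ p 𝟎⋢b → contradiction (λ x → ≡.subst (_≤ b x) (≡.sym (lookup-𝟎 x)) z≤n) 𝟎⋢b) , ∑₁ _ }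

    complex-minimal : Minimal complex
    -- A generator of degree 𝟎 has `ε q` in the ideal, whose coefficient there vanishes because 𝟎 is
    -- not in M.
    complex-minimal (suc (suc zero)) _ q _ q⊑𝟎 = ideal⇒outside (proj₂ (ε q)) _ λ Mq → ¬M-𝟎 (M-up q⊑𝟎 Mq)
    complex-minimal (suc (suc (suc i))) p q _ q⊑p =
      trans (reflexive (≡.cong (coeff (d i q p)) (⊖-zero q⊑p))) (minimal i q p)

-- Thresholds and levels

true⇒ : ∀ {ℓ} {A : Set ℓ} (a? : Dec A) → does a? ≡ true → A
true⇒ (yes a) _ = a

does-⇔ : ∀ {ℓ ℓ′} {A : Set ℓ} {B : Set ℓ′} (a? : Dec A) (b? : Dec B) → (A → B) → (B → A) → does a? ≡ does b?
does-⇔ (yes a) (yes b) f g = ≡.refl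
does-⇔ (yes a) (no ¬b) f g = contradiction (f a) ¬b
does-⇔ (no ¬a) (yes b) f g = contradiction (g b) ¬a
does-⇔ (no ¬a) (no ¬b) f g = ≡.refl

count-mono : ∀ {n} {P Q : Fin n → Bool} → (∀ i → P i ≡ true → Q i ≡ true) → count P ≤ count Q
count-mono {zero}  P⊆Q = z≤n
count-mono {suc n} {P} {Q} P⊆Q = ℕₚ.+-mono-≤ (at (P zero) (Q zero) (P⊆Q zero)) (count-mono (P⊆Q ∘ suc))
  where
  at : ∀ p q → (p ≡ true → q ≡ true) → ⟦ p ⟧ ≤ ⟦ q ⟧
  at false q     _   = z≤n
  at true  true  _   = ℕₚ.≤-refl
  at true  false p⇒q = contradiction (p⇒q ≡.refl) λ ()

count-+ : ∀ {n} {P Q R : Fin n → Bool} → (∀ i → ⟦ P i ⟧ + ⟦ Q i ⟧ ≡ ⟦ R i ⟧) → count P + count Q ≡ count R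
count-+ {zero}  eq = ≡.refl
count-+ {suc n} {P} {Q} eq = ≡.trans (ℕ-interchange ⟦ P zero ⟧ _ _ _) (≡.cong₂ _+_ (eq zero) (count-+ (eq ∘ suc)))
  where open import Algebra.Properties.CommutativeSemigroup ℕₚ.+-commutativeSemigroup renaming (interchange to ℕ-interchange)

count-false : ∀ {n} {P : Fin n → Bool} → (∀ i → P i ≡ false) → count P ≡ 0
count-false {zero}  P≡f = ≡.refl
count-false {suc n} P≡f = ≡.cong₂ _+_ (≡.cong ⟦_⟧ (P≡f zero)) (count-false (P≡f ∘ suc))

count≡0⇒false : ∀ {n} (P : Fin n → Bool) → count P ≡ 0 → ∀ i → P i ≡ false
count≡0⇒false P c≡0 i with P i in eq
... | false = ≡.refl
... | true  = contradiction (≡.trans (≡.sym (count-∖ P i eq)) c≡0) λ ()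

∃⇒0<count : ∀ {n} (P : Fin n → Bool) i → P i ≡ true → 0 < count P
∃⇒0<count P i Pi rewrite count-∖ P i Pi = s≤s z≤n

count-filter : ∀ {ℓ ℓ′} {A : Set ℓ} {P : A → Set ℓ′} (P? : ∀ x → Dec (P x)) {n} (f : Fin n → A) →
               length (List.filter P? (List.tabulate f)) ≡ count (λ i → does (P? (f i)))
count-filter P? {zero}  f = ≡.refl
count-filter P? {suc n} f with P? (f zero)
... | yes _ = ≡.cong suc (count-filter P? (f ∘ suc))
... | no  _ = count-filter P? (f ∘ suc)

count-≤ : ∀ {n} (P : Fin n → Bool) → count P ≤ n
count-≤ {zero}  P = z≤n
count-≤ {suc n} P with P zero
... | true  = s≤s (count-≤ (P ∘ suc))
... | false = ℕₚ.m≤n⇒m≤1+n (count-≤ (P ∘ suc))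

-- For t = `τ b` this is the number of non-empty levels among 1, ..., k.
jumps : (ℕ → ℕ) → ℕ → ℕ
jumps t zero    = 0
jumps t (suc a) = ⟦ not (does (t (suc a) ℕ.≟ t a)) ⟧ + jumps t a

jumps-cong : ∀ {t u : ℕ → ℕ} k → (∀ a → a ≤ k → t a ≡ u a) → jumps t k ≡ jumps u k
jumps-cong zero    t≗u = ≡.refl
jumps-cong (suc k) t≗u = ≡.cong₂ _+_
  (≡.cong₂ (λ x y → ⟦ not (does (x ℕ.≟ y)) ⟧) (t≗u (suc k) ℕₚ.≤-refl) (t≗u k (ℕₚ.n≤1+n k)))
  (jumps-cong k λ a a≤k → t≗u a (ℕₚ.m≤n⇒m≤1+n a≤k))

-- For the ideal of the k-skeleton, x^b lies in the ideal iff for some 1 ≤ a ≤ k + 1 at least a of the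
-- exponents b_x are ≥ n + 1 − a.
module Thresholds (n : ℕ) where

  -- The condition b_x ≥ n + 1 - a, written without truncated subtraction.
  above : Degree n → ℕ → Fin n → Bool
  above b a x = does (suc n ℕ.≤? b x + a)

  τ : Degree n → ℕ → ℕ
  τ b a = count (above b a)

  τ-cong : ∀ {b b′} → (∀ x → b x ≡ b′ x) → ∀ a → τ b a ≡ τ b′ a
  τ-cong b≗b′ a = count-cong λ x → ≡.cong (λ m → does (suc n ℕ.≤? m + a)) (b≗b′ x)

  above⁺ : ∀ b a x → suc n ≤ b x + a → above b a x ≡ true
  above⁺ b a x = dec-true (suc n ℕ.≤? b x + a)

  above⁻ : ∀ b a x → above b a x ≡ true → suc n ≤ b x + a
  above⁻ b a x = true⇒ (suc n ℕ.≤? b x + a)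

  τ-mono : ∀ b b′ a a′ → (∀ x → suc n ≤ b x + a → suc n ≤ b′ x + a′) → τ b a ≤ τ b′ a′
  τ-mono b b′ a a′ imp = count-mono λ x → above⁺ b′ a′ x ∘ imp x ∘ above⁻ b a x

  level? : ∀ (b : Degree n) a x → Dec (b x + a ≡ suc n)
  level? b a x = b x + a ℕ.≟ suc n

  level : Degree n → ℕ → List (Fin n)
  level b a = List.filter (level? b a) (List.allFin n)

  ∈-level⁺ : ∀ b a {x} → b x + a ≡ suc n → x ∈ level b a
  ∈-level⁺ b a = ∈ₚ.∈-filter⁺ (level? b a) (∈ₚ.∈-allFin _)

  ∈-level⁻ : ∀ b a {x} → x ∈ level b a → b x + a ≡ suc n
  ∈-level⁻ b a x∈ = proj₂ (∈ₚ.∈-filter⁻ (level? b a) {xs = List.allFin n} x∈)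

  level-unique : ∀ b a → Unique (level b a)
  level-unique b a = Uniqueₚ.filter⁺ (level? b a) (Uniqueₚ.allFin⁺ n)

  τ-suc : ∀ b a → τ b a + length (level b (suc a)) ≡ τ b (suc a)
  τ-suc b a = ≡.trans (≡.cong (τ b a +_) (count-filter (level? b (suc a)) id)) (count-+ at)
    where
    at : ∀ x → ⟦ above b a x ⟧ + ⟦ does (level? b (suc a) x) ⟧ ≡ ⟦ above b (suc a) x ⟧
    at x with ℕₚ.<-cmp (b x + suc a) (suc n)
    ... | tri< lt neq _ rewrite dec-false (suc n ℕ.≤? b x + a) (ℕₚ.<⇒≱ (ℕₚ.≤-<-trans (ℕₚ.+-monoʳ-≤ (b x) (ℕₚ.n≤1+n a)) lt))
                              | dec-false (level? b (suc a) x) neq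
                              | dec-false (suc n ℕ.≤? b x + suc a) (ℕₚ.<⇒≱ lt) = ≡.refl
    ... | tri≈ _ eq _ rewrite dec-false (suc n ℕ.≤? b x + a) (ℕₚ.<⇒≱ (ℕₚ.≤-reflexive (≡.trans (≡.sym (ℕₚ.+-suc (b x) a)) eq)))
                            | dec-true (level? b (suc a) x) eq
                            | dec-true (suc n ℕ.≤? b x + suc a) (ℕₚ.≤-reflexive (≡.sym eq)) = ≡.refl
    ... | tri> _ neq gt rewrite dec-true (suc n ℕ.≤? b x + a) (ℕₚ.≤-pred (≡.subst (suc (suc n) ≤_) (ℕₚ.+-suc (b x) a) gt))
                              | dec-false (level? b (suc a) x) neq
                              | dec-true (suc n ℕ.≤? b x + suc a) (ℕₚ.<⇒≤ gt) = ≡.refl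

  module Skeletal (k : ℕ) where

    M : Degree n → Set
    M b = ∃ λ a → a < suc k × suc a ≤ τ b (suc a)

    M? : ∀ b → Dec (M b)
    M? b = ℕₚ.anyUpTo? (λ a → suc a ℕ.≤? τ b (suc a)) (suc k)

    M-up : ∀ {a b} → a ⊑ b → M a → M b
    M-up {b} {b′} b⊑b′ (a , a<k , le) = a , a<k , ℕₚ.≤-trans le
        (τ-mono b b′ (suc a) (suc a) λ x le′ → ℕₚ.≤-trans le′ (ℕₚ.+-monoˡ-≤ (suc a) (b⊑b′ x)))

    -- The degrees with a non-zero Betti number.
    record Good (b : Degree n) : Set where
      field
        τ₀      : τ b 0 ≡ 0
        support : ∀ x → b x ≡ 0 ⊎ suc n ≤ b x + suc k
        lower-levels : ∀ a → a < k → τ b (suc a) ≡ τ b a ⊎ τ b (suc a) ≡ suc a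
        top-level    : τ b (suc k) ≡ τ b k ⊎ suc k ≤ τ b (suc k)

    -- Three causes of vanishing. `all-inside`: each exponent drops by at most one, so every d near
    -- b has τ d (a + 1) ≥ τ b a ≥ a + 1 and lies in M. `isolated`: x is too small to count at any
    -- relevant threshold, so it can be toggled. `sparse`: an x on level a + 1 influences only the
    -- threshold a + 1, which is too small to put d into M, so x can be toggled.
    data Bad (b : Degree n) : Set where
      all-inside : ∀ a → a < suc k → suc a ≤ τ b a → Bad b
      isolated   : ∀ x → 1 ≤ b x → b x + suc k ≤ n → Bad b
      sparse     : ∀ a → a ≤ k → τ b (suc a) ≢ τ b a → τ b (suc a) < suc a → Bad b

    good-or-bad : ∀ b → Good b ⊎ Bad b
    good-or-bad b with τ b 0 ℕ.≟ 0
    ... | no τ₀≢0 = inj₂ (all-inside 0 (s≤s z≤n) (ℕₚ.n≢0⇒n>0 τ₀≢0))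
    ... | yes τ₀ with Finₚ.any? (λ x → 1 ℕ.≤? b x ×-dec b x + suc k ℕ.≤? n)
    ...   | yes (x , 1≤bx , le) = inj₂ (isolated x 1≤bx le)
    ...   | no none with ℕₚ.anyUpTo? (λ a → ¬? (τ b (suc a) ℕ.≟ τ b a) ×-dec ¬? (τ b (suc a) ℕ.≟ suc a)) k
    ...     | yes (a , a<k , ≢τ , ≢a) with ℕₚ.<-cmp (τ b (suc a)) (suc a)
    ...       | tri< lt _ _ = inj₂ (sparse a (ℕₚ.<⇒≤ a<k) ≢τ lt)
    ...       | tri≈ _ eq _ = contradiction eq ≢a
    ...       | tri> _ _ gt = inj₂ (all-inside (suc a) (s≤s a<k) gt)
    good-or-bad b | yes τ₀ | no none | no fine = top (τ b (suc k) ℕ.≟ τ b k) (suc k ℕ.≤? τ b (suc k))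
      where
      support : ∀ x → b x ≡ 0 ⊎ suc n ≤ b x + suc k
      support x with b x ℕ.≟ 0 | suc n ℕ.≤? b x + suc k
      ... | yes bx≡0 | _      = inj₁ bx≡0
      ... | no  _    | yes le = inj₂ le
      ... | no  bx≢0 | no  ≰  = contradiction (x , ℕₚ.n≢0⇒n>0 bx≢0 , ℕₚ.≤-pred (ℕₚ.≰⇒> ≰)) none
      lower-levels : ∀ a → a < k → τ b (suc a) ≡ τ b a ⊎ τ b (suc a) ≡ suc a
      lower-levels a a<k with τ b (suc a) ℕ.≟ τ b a | τ b (suc a) ℕ.≟ suc a
      ... | yes eq | _      = inj₁ eq
      ... | no  _  | yes eq = inj₂ eq
      ... | no ≢τ  | no ≢a  = contradiction (a , a<k , ≢τ , ≢a) fine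
      good : τ b (suc k) ≡ τ b k ⊎ suc k ≤ τ b (suc k) → Good b
      good top-level = record { τ₀ = τ₀ ; support = support ; lower-levels = lower-levels ; top-level = top-level }
      top : Dec (τ b (suc k) ≡ τ b k) → Dec (suc k ≤ τ b (suc k)) → Good b ⊎ Bad b
      top (yes eq) _        = inj₁ (good (inj₁ eq))
      top (no _)   (yes le) = inj₁ (good (inj₂ le))
      top (no ≢τ)  (no ≰)   = inj₂ (sparse k ℕₚ.≤-refl ≢τ (ℕₚ.≰⇒> ≰))

  cons : List (Fin n) → List Block → List Block
  cons []       Ls = Ls
  cons (x ∷ ys) Ls = (ys , x) ∷ Ls

  -- Empty levels leave no block, which is why the length is the number of jumps; the first element
  -- of a level is its pivot.
  blocks : Degree n → ℕ → List Block
  blocks b zero    = []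
  blocks b (suc a) = cons (level b (suc a)) (blocks b a)

  ∈-cons⁻ : ∀ X {Ls Y z} → z ∈ flatten (cons X Ls) Y → z ∈ X ⊎ z ∈ flatten Ls Y
  ∈-cons⁻ []       z∈ = inj₂ z∈
  ∈-cons⁻ (x ∷ ys) z∈ with ∈ₚ.∈-++⁻ ys z∈
  ... | inj₁ z∈ys       = inj₁ (there z∈ys)
  ... | inj₂ (here z≡x) = inj₁ (here z≡x)
  ... | inj₂ (there z∈) = inj₂ z∈

  ∈-cons⁺ˡ : ∀ X {Ls Y z} → z ∈ X → z ∈ flatten (cons X Ls) Y
  ∈-cons⁺ˡ (x ∷ ys) (here z≡x)   = ∈ₚ.∈-++⁺ʳ ys (here z≡x)
  ∈-cons⁺ˡ (x ∷ ys) (there z∈ys) = ∈ₚ.∈-++⁺ˡ z∈ys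

  ∈-cons⁺ʳ : ∀ X {Ls Y z} → z ∈ flatten Ls Y → z ∈ flatten (cons X Ls) Y
  ∈-cons⁺ʳ []       z∈ = z∈
  ∈-cons⁺ʳ (x ∷ ys) z∈ = ∈ₚ.∈-++⁺ʳ ys (there z∈)

  Disjoint-cons : ∀ X {Ls Y} → Unique X → (∀ {z} → z ∈ X → z ∉ flatten Ls Y) → Disjoint Ls Y → Disjoint
      (cons X Ls) Y
  Disjoint-cons []       _          _  dj = dj
  Disjoint-cons (x ∷ ys) (x∉ ∷ uys) X∩ dj = uys , (λ x∈ → All.lookup x∉ x∈ ≡.refl) , X∩
      (here ≡.refl) , X∩ ∘ there , dj

  ∈-blocks⁻ : ∀ {b} a {Y z} → z ∈ flatten (blocks b a) Y → (∃ λ a′ → a′ < a × b z + suc a′ ≡ suc n) ⊎ z ∈ Y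
  ∈-blocks⁻ zero z∈ = inj₂ z∈
  ∈-blocks⁻ {b} (suc a) z∈ with ∈-cons⁻ (level b (suc a)) z∈
  ... | inj₁ z∈E = inj₁ (a , ℕₚ.n<1+n a , ∈-level⁻ b (suc a) z∈E)
  ... | inj₂ z∈′ with ∈-blocks⁻ a z∈′
  ...   | inj₁ (a′ , a′<a , eq) = inj₁ (a′ , ℕₚ.m<n⇒m<1+n a′<a , eq)
  ...   | inj₂ z∈Y = inj₂ z∈Y

  ∈-blocks⁺ : ∀ {b} a {Y z a′} → a′ < a → b z + suc a′ ≡ suc n → z ∈ flatten (blocks b a) Y
  ∈-blocks⁺ {b} (suc a) {a′ = a′} a′<1+a eq with a′ ℕ.≟ a
  ... | yes ≡.refl = ∈-cons⁺ˡ (level b (suc a)) (∈-level⁺ b (suc a) eq)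
  ... | no a′≢a    = ∈-cons⁺ʳ (level b (suc a)) (∈-blocks⁺ a (ℕₚ.≤∧≢⇒< (ℕₚ.≤-pred a′<1+a) a′≢a) eq)

  ∈-blocks⁺ʳ : ∀ {b} a {Y z} → z ∈ Y → z ∈ flatten (blocks b a) Y
  ∈-blocks⁺ʳ zero        z∈Y = z∈Y
  ∈-blocks⁺ʳ {b} (suc a) z∈Y = ∈-cons⁺ʳ (level b (suc a)) (∈-blocks⁺ʳ a z∈Y)

  same-level : ∀ {m a a′} → m + suc a ≡ suc n → m + suc a′ ≡ suc n → a ≡ a′
  same-level {m} eq eq′ = ℕₚ.suc-injective (ℕₚ.+-cancelˡ-≡ m _ _ (≡.trans eq (≡.sym eq′)))

  Disjoint-blocks : ∀ {b} a {Y} → Unique Y → (∀ {z} → z ∈ Y → ∀ a′ → a′ < a → b z + suc a′ ≢ suc n) → Disjoint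
      (blocks b a) Y
  Disjoint-blocks zero        uY Y∩ = uY
  Disjoint-blocks {b} (suc a) uY Y∩ = Disjoint-cons (level b (suc a)) (level-unique b (suc a)) E∩
    (Disjoint-blocks a uY λ z∈ a′ a′<a → Y∩ z∈ a′ (ℕₚ.m<n⇒m<1+n a′<a))
    where
    E∩ : ∀ {z} → z ∈ level b (suc a) → z ∉ flatten (blocks b a) _
    E∩ {z} z∈E z∈ with ∈-blocks⁻ a z∈
    ... | inj₁ (a′ , a′<a , eq) = ℕₚ.<⇒≢ a′<a (same-level {b z} eq (∈-level⁻ b (suc a) z∈E))
    ... | inj₂ z∈Y              = Y∩ z∈Y a (ℕₚ.n<1+n a) (∈-level⁻ b (suc a) z∈E)

  undropped⁻ : ∀ {b d} a → Any (Undropped b d) (blocks b a) →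
               ∃ λ a′ → a′ < a × 0 < length (level b (suc a′)) × (∀ {y} → y ∈ level b (suc a′) → d y ≡ b y)
  undropped⁻ {b} {d} (suc a) any with level b (suc a) in eq | any
  ... | x ∷ ys | here (dx≡ , dys≡) = a , ℕₚ.n<1+n a , ≡.subst (λ E → 0 < length E) (≡.sym eq) (s≤s z≤n) ,
        λ y∈ → at (≡.subst (_ ∈_) eq y∈)
    where
    at : ∀ {y} → y ∈ x ∷ ys → d y ≡ b y
    at (here ≡.refl) = dx≡
    at (there y∈)    = dys≡ y∈
  ... | x ∷ ys | there any′ = let a′ , a′<a , rest = undropped⁻ a any′ in a′ , ℕₚ.m<n⇒m<1+n a′<a , rest
  ... | []     | any′       = let a′ , a′<a , rest = undropped⁻ a any′ in a′ , ℕₚ.m<n⇒m<1+n a′<a , rest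

  undropped⁺ : ∀ b d a {a′} → a′ < a → 0 < length (level b (suc a′)) → (∀ {y} → y ∈ level b (suc a′) → d y ≡ b y) →
               Any (Undropped b d) (blocks b a)
  undropped⁺ b d (suc a) {a′} a′<1+a nonempty und with a′ ℕ.≟ a
  ... | yes ≡.refl = here-cons (level b (suc a)) nonempty und
    where
    here-cons : ∀ X → 0 < length X → (∀ {y} → y ∈ X → d y ≡ b y) → Any (Undropped b d) (cons X (blocks b a))
    here-cons (x ∷ ys) _ und = here (und (here ≡.refl) , und ∘ there)
  ... | no a′≢a = there-cons (level b (suc a)) (undropped⁺ b d a (ℕₚ.≤∧≢⇒< (ℕₚ.≤-pred a′<1+a) a′≢a) nonempty und)
    where
    there-cons : ∀ X → Any (Undropped b d) (blocks b a) → Any (Undropped b d) (cons X (blocks b a))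
    there-cons []       any = any
    there-cons (x ∷ ys) any = there any

  length-blocks : ∀ b a → length (blocks b a) ≡ jumps (τ b) a
  length-blocks b zero    = ≡.refl
  length-blocks b (suc a) = ≡.trans (length-cons (level b (suc a)) (τ-suc b a))
      (≡.cong (⟦ not (does (τ b (suc a) ℕ.≟ τ b a)) ⟧ +_) (length-blocks b a))
    where
    length-cons : ∀ X → τ b a + length X ≡ τ b (suc a) →
                  length (cons X (blocks b a)) ≡ ⟦ not (does (τ b (suc a) ℕ.≟ τ b a)) ⟧ + length (blocks b a)
    length-cons [] eq rewrite dec-true (τ b (suc a) ℕ.≟ τ b a) (≡.trans (≡.sym eq) (ℕₚ.+-identityʳ _)) = ≡.refl
    length-cons (x ∷ ys) eq rewrite dec-false (τ b (suc a) ℕ.≟ τ b a) (λ eq′ → ℕₚ.m≢1+m+n (τ b a) {length ys} (≡.trans (≡.sym eq′) (≡.trans (≡.sym eq) (ℕₚ.+-suc _ _)))) = ≡.refl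

  drops-filter : ∀ {P : Fin n → Set} (P? : ∀ x → Dec (P x)) {b d m} (f : Fin m → Fin n) →
                 drops (List.filter P? (List.tabulate f)) b d ≡ count
                     (λ i → does (P? (f i)) ∧ does (d (f i) ℕ.<? b (f i)))
  drops-filter P? {m = zero}  f = ≡.refl
  drops-filter P? {m = suc m} f with P? (f zero)
  ... | yes _ = ≡.cong (_ +_) (drops-filter P? (f ∘ suc))
  ... | no  _ = drops-filter P? (f ∘ suc)

  -- No exponent drops by more than one, so threshold a loses exactly the lowered elements of level
  -- a.
  τ-drops : ∀ {X b d} → Near X b d → ∀ a → τ d a + drops (level b a) b d ≡ τ b a
  τ-drops {X} {b} {d} near a = ≡.trans (≡.cong (τ d a +_) (drops-filter (level? b a) id)) (count-+ at)
    where
    at : ∀ x → ⟦ above d a x ⟧ + ⟦ does (level? b a x) ∧ does (d x ℕ.<? b x) ⟧ ≡ ⟦ above b a x ⟧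
    at x with d x ℕ.≟ b x
    ... | yes dx≡bx rewrite dec-false (d x ℕ.<? b x) (λ lt → ℕₚ.<⇒≢ lt dx≡bx) | dx≡bx
      with does (level? b a x)
    ...   | true  = ℕₚ.+-identityʳ _
    ...   | false = ℕₚ.+-identityʳ _
    at x | no dx≢bx rewrite dec-true (d x ℕ.<? b x) (ℕₚ.≤∧≢⇒< (proj₁ (near x)) dx≢bx)
                          | ℕₚ.≤-antisym (proj₁ (proj₂ (near x))) (ℕₚ.≤∧≢⇒< (proj₁ (near x)) dx≢bx)
      with ℕₚ.<-cmp (d x + a) n
    ...   | tri< lt neq _ rewrite dec-false (suc n ℕ.≤? d x + a) (ℕₚ.<⇒≱ (ℕₚ.m<n⇒m<1+n lt))
                                | dec-false (suc (d x) + a ℕ.≟ suc n) (neq ∘ ℕₚ.suc-injective)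
                                | dec-false (suc n ℕ.≤? suc (d x) + a) (ℕₚ.<⇒≱ (s≤s lt)) = ≡.refl
    ...   | tri≈ _ eq _ rewrite dec-false (suc n ℕ.≤? d x + a) (ℕₚ.<⇒≱ (s≤s (ℕₚ.≤-reflexive eq)))
                              | dec-true (suc (d x) + a ℕ.≟ suc n) (≡.cong suc eq)
                              | dec-true (suc n ℕ.≤? suc (d x) + a) (s≤s (ℕₚ.≤-reflexive (≡.sym eq))) = ≡.refl
    ...   | tri> _ neq gt rewrite dec-true (suc n ℕ.≤? d x + a) gt
                                | dec-false (suc (d x) + a ℕ.≟ suc n) (neq ∘ ℕₚ.suc-injective)
                                | dec-true (suc n ℕ.≤? suc (d x) + a) (ℕₚ.m≤n⇒m≤1+n gt) = ≡.refl

  drops≡0⁻ : ∀ Y (b d : Degree n) → drops Y b d ≡ 0 → d ⊑ b → ∀ {y} → y ∈ Y → d y ≡ b y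
  drops≡0⁻ (z ∷ Y) b d eq d⊑b (here ≡.refl) with d z ℕ.<? b z
  ... | no d≮b  = ℕₚ.≤-antisym (d⊑b z) (ℕₚ.≮⇒≥ d≮b)
  ... | yes d<b rewrite dec-true (d z ℕ.<? b z) d<b = contradiction eq λ ()
  drops≡0⁻ (z ∷ Y) b d eq d⊑b (there y∈Y) = drops≡0⁻ Y b d (ℕₚ.m+n≡0⇒n≡0 ⟦ does (d z ℕ.<? b z) ⟧ eq) d⊑b y∈Y

  drops≡0⁺ : ∀ Y (b d : Degree n) → (∀ {y} → y ∈ Y → d y ≡ b y) → drops Y b d ≡ 0
  drops≡0⁺ []      b d _  = ≡.refl
  drops≡0⁺ (z ∷ Y) b d d≡ = ≡.cong₂ _+_
      (≡.cong ⟦_⟧ (dec-false (d z ℕ.<? b z) λ d<b → ℕₚ.<⇒≢ d<b (d≡ (here ≡.refl)))) (drops≡0⁺ Y b d (d≡ ∘ there))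

  module Levels (k : ℕ) where

    open Skeletal k

    excess : Degree n → ℕ
    excess b = τ b (suc k) ∸ k

    -- Lowering b by a squarefree degree leaves the ideal exactly when every level a ≤ k is hit and the
    -- top level is hit at least τ b (k + 1) − k times.
    good-inside : ∀ {b} → Good b → ∀ {X d} → Near X b d →
                  (M d → Inside (blocks b k) (level b (suc k)) (excess b) b d) ×
                  (Inside (blocks b k) (level b (suc k)) (excess b) b d → M d)
    good-inside {b} good {X} {d} near = to , from
      where
      open Good good
      τ≤ : ∀ a → a ≤ k → τ b a ≤ a
      τ≤ zero    _   = ℕₚ.≤-reflexive τ₀
      τ≤ (suc a) a<k with lower-levels a a<k
      ... | inj₁ eq = ℕₚ.≤-trans (ℕₚ.≤-reflexive eq) (ℕₚ.≤-trans (τ≤ a (ℕₚ.<⇒≤ a<k)) (ℕₚ.n≤1+n a))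
      ... | inj₂ eq = ℕₚ.≤-reflexive eq
      d⊑b : d ⊑ b
      d⊑b x = proj₁ (near x)
      τd≤ : ∀ a → τ d a ≤ τ b a
      τd≤ a = ≡.subst (τ d a ≤_) (τ-drops near a) (ℕₚ.m≤m+n _ _)
      to : M d → Inside (blocks b k) (level b (suc k)) (excess b) b d
      to (a , a<1+k , 1+a≤) with a ℕ.≟ k
      ... | yes ≡.refl = few (ℕₚ.m+n≤o⇒m≤o∸n (suc (drops E b d))
              (ℕₚ.≤-trans (ℕₚ.≤-reflexive (≡.trans (≡.sym (ℕₚ.+-suc (drops E b d) k))
                  (ℕₚ.+-comm (drops E b d) (suc k))))
              (ℕₚ.≤-trans (ℕₚ.+-monoˡ-≤ (drops E b d) 1+a≤) (ℕₚ.≤-reflexive (τ-drops near (suc k))))))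
        where
        E : List (Fin n)
        E = level b (suc k)
      ... | no a≢k with a<k ← ℕₚ.≤∧≢⇒< (ℕₚ.≤-pred a<1+k) a≢k with lower-levels a a<k
      ...   | inj₁ eq = contradiction
          (ℕₚ.≤-trans 1+a≤ (ℕₚ.≤-trans (τd≤ (suc a))
              (ℕₚ.≤-trans (ℕₚ.≤-reflexive eq) (τ≤ a (ℕₚ.<⇒≤ a<k))))) ℕₚ.1+n≰n
      -- Level a + 1 is non-empty because τ b a ≤ a, and it is untouched because τ d (a + 1) still
      -- reaches a + 1 = τ b (a + 1).
      ...   | inj₂ eq = undropped (undropped⁺ b d k a<k
                (ℕₚ.+-cancelˡ-< (τ b a) 0 _ (≡.subst₂ _<_ (≡.sym (ℕₚ.+-identityʳ _))
                    (≡.trans (≡.sym eq) (≡.sym (τ-suc b a))) (s≤s (τ≤ a (ℕₚ.<⇒≤ a<k)))))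
                (drops≡0⁻ (level b (suc a)) b d (ℕₚ.n≤0⇒n≡0 (ℕₚ.+-cancelˡ-≤ (suc a) _ _
                  (ℕₚ.≤-trans (ℕₚ.+-monoˡ-≤ _ 1+a≤)
                      (ℕₚ.≤-reflexive (≡.trans (τ-drops near (suc a))
                          (≡.trans eq (≡.sym (ℕₚ.+-identityʳ _)))))))) d⊑b))
      from : Inside (blocks b k) (level b (suc k)) (excess b) b d → M d
      from (few lt) = k , ℕₚ.n<1+n k , ℕₚ.+-cancelʳ-≤ (drops E b d) _ _
        (ℕₚ.≤-trans (ℕₚ.≤-reflexive (≡.trans (ℕₚ.+-comm (suc k) (drops E b d)) (ℕₚ.+-suc (drops E b d) k)))
        (ℕₚ.≤-trans (ℕₚ.m≤o∸n⇒m+n≤o (suc (drops E b d))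
            (ℕₚ.<⇒≤ (ℕₚ.m∸n≢0⇒n<m (λ eq → ℕₚ.n≮0 (≡.subst (drops E b d <_) eq lt)))) lt)
                (ℕₚ.≤-reflexive (≡.sym (τ-drops near (suc k))))))
        where
        E : List (Fin n)
        E = level b (suc k)
      from (undropped any) with a , a<k , nonempty , und ← undropped⁻ k any with lower-levels a a<k
      ... | inj₁ eq = contradiction (ℕₚ.+-cancelˡ-≡ (τ b a) _ 0
          (≡.trans (τ-suc b a) (≡.trans eq (≡.sym (ℕₚ.+-identityʳ _))))) (ℕₚ.m<n⇒n≢0 nonempty)
      ... | inj₂ eq = a , ℕₚ.m<n⇒m<1+n a<k , ℕₚ.≤-reflexive
          (≡.trans (≡.sym eq) (≡.trans (≡.sym (τ-drops near (suc a)))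
              (≡.trans (≡.cong (τ d (suc a) +_) (drops≡0⁺ (level b (suc a)) b d und)) (ℕₚ.+-identityʳ _))))

-- Betti numbers of the skeleton ideal in good and bad degrees.

∣∣≡count : ∀ {n} (A : Subset n) → ∣ A ∣ ≡ count (lookup A)
∣∣≡count Vec.[]            = ≡.refl
∣∣≡count (true  Vec.∷ A) = ≡.cong suc (∣∣≡count A)
∣∣≡count (false Vec.∷ A) = ∣∣≡count A

choose : ∀ {n} (P : Fin n → Bool) m → m ≤ count P → ∃ λ (A : Subset n) → ∣ A ∣ ≡ m ×
    (∀ x → lookup A x ≡ true → P x ≡ true)
choose {zero}  P zero    _  = Vec.[] , ≡.refl , λ ()
choose {suc n} P m m≤ with P zero in eq | m
... | true | suc m′ with A , ∣A∣ , A⊆ ← choose (P ∘ suc) m′ (ℕₚ.≤-pred m≤) =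
  inside Vec.∷ A , ≡.cong suc ∣A∣ , λ { zero _ → eq ; (suc x) → A⊆ x }
... | true | zero with A , ∣A∣ , A⊆ ← choose (P ∘ suc) 0 z≤n =
  outside Vec.∷ A , ∣A∣ , λ { (suc x) → A⊆ x }
... | false | m′ with A , ∣A∣ , A⊆ ← choose (P ∘ suc) m′ m≤ =
  outside Vec.∷ A , ∣A∣ , λ { (suc x) → A⊆ x }

-- The i-th Betti number of R/I in a good degree with thresholds t: non-empty lower levels
-- contribute one homological degree each, and the top level has t (k + 1) - t k elements of which t
-- (k + 1) - k must drop.
predicted : ℕ → (ℕ → ℕ) → ℕ → ℕ
predicted k t i = if does (i ℕ.≟ jumps t k + (t (suc k) ∸ k)) then topFaces (t (suc k) ∸ t k)
    (t (suc k) ∸ k) else 0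

module SkeletonBetti {c ℓ₁ ℓ₂ : Level} (K : HeytingField c ℓ₁ ℓ₂)
                     (_#?_ : Decidable (HeytingField._#_ K)) (n k : ℕ) (k<n : k < n) where

  open Thresholds n
  open Skeletal k
  open Levels k
  open Skeleton K n k using (SkeletonIndex; skeletonExponent)

  exponent : SkeletonIndex → Multidegree n
  exponent (A , _) = skeletonExponent A

  lookup-exponent : ∀ A x → lookup (skeletonExponent A) x ≡ (if lookup A x then n ∸ ∣ A ∣ + 1 else 0)
  lookup-exponent A x = Vecₚ.lookup-map x _ A

  exponent-M : ∀ x → M (lookup (exponent x))
  exponent-M (A , nonempty , ∣A∣≤1+k) = by-size ∣ A ∣ ≡.refl
    where
    by-size : ∀ m → ∣ A ∣ ≡ m → M (lookup (skeletonExponent A))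
    by-size zero    eq = contradiction (≡.trans (≡.sym (∣∣≡count A)) eq)
        (ℕₚ.m<n⇒n≢0 (∃⇒0<count (lookup A) (proj₁ nonempty) (Vecₚ.[]=⇒lookup (proj₂ nonempty))))
    by-size (suc a) eq = a , ≡.subst (_≤ suc k) eq ∣A∣≤1+k , ℕₚ.≤-trans
        (ℕₚ.≤-reflexive (≡.trans (≡.sym eq) (∣∣≡count A)))
      (count-mono λ x x∈A → above⁺ (lookup (skeletonExponent A)) (suc a) x
          (ℕₚ.≤-reflexive (≡.sym (exponent-x x x∈A))))
      where
      exponent-x : ∀ x → lookup A x ≡ true → lookup (skeletonExponent A) x + suc a ≡ suc n
      exponent-x x x∈A = ≡.trans
        (≡.cong (_+ suc a) (≡.trans (lookup-exponent A x) (≡.cong₂ (λ s m → if s then n ∸ m + 1 else 0) x∈A eq)))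
        (≡.trans (≡.cong (_+ suc a) (ℕₚ.+-comm (n ∸ suc a) 1))
            (≡.cong suc (ℕₚ.m∸n+n≡m (≡.subst (_≤ n) eq (Subsetₚ.∣p∣≤n A)))))

  -- Any a + 1 of the coordinates counted by `τ b (suc a)` form a set A whose generator divides x^b.
  M-exponent : ∀ {b} → M b → ∃ λ x → lookup (exponent x) ⊑ b
  M-exponent {b} (a , a<1+k , le) with A , ∣A∣ , A⊆ ← choose (above b (suc a)) (suc a) le =
    (A , nonempty , ℕₚ.≤-trans (ℕₚ.≤-reflexive ∣A∣) a<1+k) , below
    where
    nonempty : Nonempty A
    nonempty = let x , x∈A = 0<count⇒∃ (lookup A) (≡.subst (0 <_) (≡.trans (≡.sym ∣A∣) (∣∣≡count A)) (s≤s z≤n)) in x , Vecₚ.lookup⇒[]= x A x∈A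
    below : lookup (skeletonExponent A) ⊑ b
    below x with lookup A x in x∈A | lookup-exponent A x
    ... | false | eq = ≡.subst (_≤ b x) (≡.sym eq) z≤n
    ... | true  | eq = ≡.subst (_≤ b x) (≡.sym eq)
        (ℕₚ.≤-trans (ℕₚ.≤-reflexive (≡.trans (≡.cong (λ m → n ∸ m + 1) ∣A∣)
            (≡.trans (ℕₚ.+-comm (n ∸ suc a) 1) (≡.sym (ℕₚ.+-∸-assoc 1 1+a≤n)))))
            (ℕₚ.≤-trans (ℕₚ.∸-monoˡ-≤ (suc a) (above⁻ b (suc a) x (A⊆ x x∈A)))
                (ℕₚ.≤-reflexive (ℕₚ.m+n∸n≡m (b x) (suc a)))))
      where
      1+a≤n : suc a ≤ n
      1+a≤n = ℕₚ.≤-trans a<1+k k<n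

  ¬M-𝟎 : ¬ M (lookup 𝟎)
  ¬M-𝟎 (a , a<1+k , le) with x , above-x ← 0<count⇒∃ (above (lookup 𝟎) (suc a)) (ℕₚ.≤-trans (s≤s z≤n) le) =
    ℕₚ.1+n≰n (ℕₚ.≤-trans (≡.subst (λ m → suc n ≤ m + suc a) (lookup-𝟎 x) (above⁻ (lookup 𝟎) (suc a) x above-x))
        (ℕₚ.≤-trans a<1+k k<n))

  open MonomialIdeal K _#?_ n M M? M-up ¬M-𝟎 exponent exponent-M M-exponent public
  open Graded K n

  module _ (C : Complex) (res : Resolves C) where

    open Complex C

    -- A coordinate with b x = 0 has the same lower corner whether or not it is in X, so containing
    -- the support of b already gives the box [b,b].
    full-support : ∀ {X b s g} → (∀ x → 1 ≤ b x → x ∈ X) → H C res X b s g → Concentrated b b s g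
    full-support {X} {b} full = Concentrated-resp C (lower-⊑ X b) (⊑-lower-full full) (⊑-refl {a = b})
        (⊑-refl {a = b})

    good-concentrated : ∀ {b} → Good b →
                        Concentrated b b (suc (jumps (τ b) k + excess b))
                            (topFaces (τ b (suc k) ∸ τ b k) (excess b))
    good-concentrated {b} good = ≡.subst₂ (Concentrated b b)
      (≡.trans (≡.cong (_+ suc (excess b)) (length-blocks b k)) (ℕₚ.+-suc _ _))
      (≡.cong (λ m → topFaces m (excess b))
          (≡.trans (≡.sym (ℕₚ.m+n∸m≡n (τ b k) _)) (≡.cong (_∸ τ b k) (τ-suc b k))))
      (full-support covers (H-levels C res (blocks b k) (Disjoint-blocks k (level-unique b (suc k))
        (λ {z} z∈ a′ a′<k eq → ℕₚ.<⇒≢ a′<k (same-level {b z} eq (∈-level⁻ b (suc k) z∈))))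
        positive (λ d near → good-inside good near)))
      where
      open Good good
      positive-level : ∀ {m a} → a ≤ k → m + suc a ≡ suc n → 1 ≤ m
      positive-level {zero}  a≤k eq = contradiction (ℕₚ.suc-injective eq) (ℕₚ.<⇒≢ (ℕₚ.≤-<-trans a≤k k<n))
      positive-level {suc m} a≤k eq = s≤s z≤n
      positive : Positive (flatten (blocks b k) (level b (suc k))) b
      positive z∈ with ∈-blocks⁻ k z∈
      ... | inj₁ (a , a<k , eq) = positive-level (ℕₚ.<⇒≤ a<k) eq
      ... | inj₂ z∈E            = positive-level ℕₚ.≤-refl (∈-level⁻ b (suc k) z∈E)
      -- `τ₀` bounds b x by n and `support` bounds n - b x by k, so x lies on level n - b x + 1.
      covers : ∀ x → 1 ≤ b x → x ∈ flatten (blocks b k) (level b (suc k))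
      covers x 1≤bx with support x
      ... | inj₁ bx≡0 = contradiction bx≡0 (ℕₚ.m<n⇒n≢0 1≤bx)
      ... | inj₂ le   = by-level (n ∸ b x ℕ.≟ k)
        where
        bx≤n : b x ≤ n
        bx≤n = ℕₚ.≤-pred (ℕₚ.≰⇒> λ n<bx → contradiction
            (∃⇒0<count (above b 0) x (above⁺ b 0 x (ℕₚ.≤-trans n<bx (ℕₚ.≤-reflexive (≡.sym (ℕₚ.+-identityʳ _))))))
                                            (ℕₚ.<⇒≱ (s≤s (ℕₚ.≤-reflexive τ₀))))
        eq : b x + suc (n ∸ b x) ≡ suc n
        eq = ≡.trans (ℕₚ.+-suc (b x) _) (≡.cong suc (ℕₚ.m+[n∸m]≡n bx≤n))
        a≤k : n ∸ b x ≤ k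
        a≤k = ℕₚ.m≤n+o⇒m∸n≤o n (b x) (ℕₚ.≤-pred (ℕₚ.≤-trans le (ℕₚ.≤-reflexive (ℕₚ.+-suc (b x) k))))
        by-level : Dec (n ∸ b x ≡ k) → x ∈ flatten (blocks b k) (level b (suc k))
        by-level (yes a≡k) = ∈-blocks⁺ʳ k (∈-level⁺ b (suc k) (≡.subst (λ a → b x + suc a ≡ suc n) a≡k eq))
        by-level (no  a≢k) = ∈-blocks⁺ k (ℕₚ.≤∧≢⇒< a≤k a≢k) eq

    toggle-acyclic : ∀ {b} x → 1 ≤ b x → (∀ d → d ⊑ b → d x ≡ b x → M d → M (d ↓ x)) → Acyclic b b
    toggle-acyclic {b} x 1≤bx toggle = Concentrated⇒Acyclic C 0 (full-support covers
      (H-toggle C res (Uniqueₚ.filter⁺ P? (Uniqueₚ.allFin⁺ n)) x∉X positive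
        λ d near → toggle d (λ y → proj₁ (near y)) (proj₂ (proj₂ (near x)) x∉X)))
      where
      P? : ∀ y → Dec (1 ≤ b y × ¬ x ≡ y)
      P? y = 1 ℕ.≤? b y ×-dec ¬? (x Fin.≟ y)
      X : List (Fin n)
      X = List.filter P? (List.allFin n)
      x∉X : x ∉ X
      x∉X x∈X = proj₂ (proj₂ (∈ₚ.∈-filter⁻ P? {xs = List.allFin n} x∈X)) ≡.refl
      positive : Positive (x ∷ X) b
      positive (here ≡.refl) = 1≤bx
      positive (there y∈X)   = proj₁ (proj₂ (∈ₚ.∈-filter⁻ P? {xs = List.allFin n} y∈X))
      covers : ∀ y → 1 ≤ b y → y ∈ x ∷ X
      covers y 1≤by with x Fin.≟ y
      ... | yes x≡y = here (≡.sym x≡y)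
      ... | no  x≢y = there (∈ₚ.∈-filter⁺ P? (∈ₚ.∈-allFin y) (1≤by , x≢y))

    toggle-τ : ∀ {d x a} → (suc n ≤ d x + a → suc n ≤ pred (d x) + a) → τ d a ≤ τ (d ↓ x) a
    toggle-τ {d} {x} {a} at-x = τ-mono d (d ↓ x) a a at
      where
      at : ∀ y → suc n ≤ d y + a → suc n ≤ (d ↓ x) y + a
      at y le with x Fin.≟ y
      ... | yes ≡.refl = ≡.subst (λ m → suc n ≤ m + a) (≡.sym (↓-self d x)) (at-x le)
      ... | no x≢y     = ≡.subst (λ m → suc n ≤ m + a) (≡.sym (↓-other d x≢y)) le

    bad-acyclic : ∀ {b} → Bad b → Acyclic b b
    bad-acyclic {b} (all-inside a a<1+k le) = Concentrated⇒Acyclic C 0 (full-support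
      (λ x 1≤bx → ∈ₚ.∈-filter⁺ P? (∈ₚ.∈-allFin x) 1≤bx)
      (H-inside C res (Uniqueₚ.filter⁺ P? (Uniqueₚ.allFin⁺ n))
          (λ x∈ → proj₂ (∈ₚ.∈-filter⁻ P? {xs = List.allFin n} x∈))
        λ d near → a , a<1+k , ℕₚ.≤-trans le (τ-mono b d a (suc a) λ x le′ →
          ℕₚ.≤-trans le′ (ℕₚ.≤-trans (ℕₚ.+-monoˡ-≤ a (proj₁ (proj₂ (near x))))
              (ℕₚ.≤-reflexive (≡.sym (ℕₚ.+-suc (d x) a)))))))
      where
      P? : ∀ x → Dec (1 ≤ b x)
      P? x = 1 ℕ.≤? b x
    bad-acyclic {b} (isolated x 1≤bx le) = toggle-acyclic x 1≤bx λ d d⊑b _ (a , a<1+k , le′) →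
      a , a<1+k , ℕₚ.≤-trans le′ (toggle-τ {d} λ le″ → contradiction
          (ℕₚ.≤-trans le″ (ℕₚ.≤-trans (ℕₚ.+-mono-≤ (d⊑b x) a<1+k) le)) ℕₚ.1+n≰n)
    bad-acyclic {b} (sparse a a≤k ≢τ lt) with level b (suc a) in eq
    ... | [] = contradiction (≡.trans (≡.sym (τ-suc b a))
        (≡.trans (≡.cong (λ E → τ b a + length E) eq) (ℕₚ.+-identityʳ _))) ≢τ
    ... | x ∷ _ = toggle-acyclic x 1≤bx toggle
      where
      bx : b x + suc a ≡ suc n
      bx = ∈-level⁻ b (suc a) (≡.subst (x ∈_) (≡.sym eq) (here ≡.refl))
      1≤bx : 1 ≤ b x
      1≤bx = ℕₚ.n≢0⇒n>0 λ bx≡0 → ℕₚ.<⇒≢ (ℕₚ.≤-<-trans a≤k k<n)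
          (ℕₚ.suc-injective (≡.trans (≡.cong (_+ suc a) (≡.sym bx≡0)) bx))
      toggle : ∀ d → d ⊑ b → d x ≡ b x → M d → M (d ↓ x)
      toggle d d⊑b dx≡bx (a′ , a′<1+k , le) with a′ ℕ.≟ a
      ... | yes ≡.refl = contradiction
          (ℕₚ.≤-trans le (τ-mono d b (suc a) (suc a) λ y le′ → ℕₚ.≤-trans le′ (ℕₚ.+-monoˡ-≤ (suc a) (d⊑b y))))
              (ℕₚ.<⇒≱ lt)
      ... | no a′≢a = a′ , a′<1+k , ℕₚ.≤-trans le (toggle-τ {d} at-x)
        where
        at-x : suc n ≤ d x + suc a′ → suc n ≤ pred (d x) + suc a′
        at-x le′ rewrite dx≡bx = ℕₚ.≤-trans (ℕₚ.≤-reflexive (≡.sym bx)) (ℕₚ.≤-trans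
          (ℕₚ.≤-reflexive (≡.trans (≡.cong (_+ suc a) (≡.sym (ℕₚ.suc-pred (b x) {{ℕ.>-nonZero 1≤bx}})))
              (≡.sym (ℕₚ.+-suc (pred (b x)) (suc a)))))
          (ℕₚ.+-monoʳ-≤ (pred (b x)) (s≤s
              (ℕₚ.≤∧≢⇒< (ℕₚ.≤-pred (ℕₚ.+-cancelˡ-≤ (b x) _ _ (ℕₚ.≤-trans (ℕₚ.≤-reflexive bx) le′)))
                  (a′≢a ∘ ≡.sym)))))

    module _ (minimal : Minimal C) where

      good-count : ∀ {b} → Good b → ∀ i → count (inDegree C (2 + i) b) ≡ predicted k (τ b) i
      good-count {b} good i with i ℕ.≟ jumps (τ b) k + excess b
      ... | yes eq rewrite dec-true (i ℕ.≟ jumps (τ b) k + excess b) eq =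
        minimal-Hdim C minimal (≡.subst (λ s → Hdim b b (suc s) _) (≡.sym eq) (proj₁ (good-concentrated good)))
      ... | no neq rewrite dec-false (i ℕ.≟ jumps (τ b) k + excess b) neq =
        minimal-Hdim C minimal (proj₂ (good-concentrated good) (suc i) (neq ∘ ℕₚ.suc-injective))

      bad-count : ∀ {b} → Bad b → ∀ i → count (inDegree C (2 + i) b) ≡ 0
      bad-count bad i = minimal-Hdim C minimal (bad-acyclic bad (suc i))

  count-degrees : ∀ (L : List (Multidegree n)) b →
                  length (List.filter (_≟ᵈ b) L) ≡
                  count (λ p → does ((lookup (List.lookup L p) ⊑? lookup b) ×-dec
                      (lookup b ⊑? lookup (List.lookup L p))))
  count-degrees L b = ≡.trans (≡.cong (length ∘ List.filter (_≟ᵈ b)) (≡.sym (Listₚ.tabulate-lookup L)))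
    (≡.trans (count-filter (_≟ᵈ b) (List.lookup L))
        (count-cong λ p → does-⇔ (List.lookup L p ≟ᵈ b)
            ((lookup (List.lookup L p) ⊑? lookup b) ×-dec (lookup b ⊑? lookup (List.lookup L p)))
      (λ { ≡.refl → ⊑-refl {a = lookup b} , ⊑-refl {a = lookup b} }) λ (≤ , ≥) → vec-ext λ x → ℕₚ.≤-antisym (≤ x)
          (≥ x)))

  module _ (𝓕 : MinimalFreeResolution (idealModule gens)) where

    open FromIdeal 𝓕

    -- Homological degree i of the ideal is degree i + 1 of R/I, hence the `suc i`.
    βᵈ-good : ∀ i b → Good (lookup b) → MinimalFreeResolution.βᵈ 𝓕 i b ≡ predicted k (τ (lookup b)) (suc i)
    βᵈ-good i b good = ≡.trans (count-degrees (MinimalFreeResolution.degrees 𝓕 i) b)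
        (good-count complex resolves complex-minimal good (suc i))

    βᵈ-bad : ∀ i b → Bad (lookup b) → MinimalFreeResolution.βᵈ 𝓕 i b ≡ 0
    βᵈ-bad i b bad = ≡.trans (count-degrees (MinimalFreeResolution.degrees 𝓕 i) b)
        (bad-count complex resolves complex-minimal bad (suc i))

  module _ (𝓖 : MinimalFreeResolution (quotientModule gens)) where

    open FromQuotient 𝓖

    βᵈ-quotient-good : ∀ i b → Good (lookup b) → MinimalFreeResolution.βᵈ 𝓖 i b ≡ predicted k (τ (lookup b)) i
    βᵈ-quotient-good i b good = ≡.trans (count-degrees (MinimalFreeResolution.degrees 𝓖 i) b)
        (good-count complex resolves complex-minimal good i)

    βᵈ-quotient-bad : ∀ i b → Bad (lookup b) → MinimalFreeResolution.βᵈ 𝓖 i b ≡ 0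
    βᵈ-quotient-bad i b bad = ≡.trans (count-degrees (MinimalFreeResolution.degrees 𝓖 i) b)
        (bad-count complex resolves complex-minimal bad i)

-- Dual isolated subsets

at : ∀ {n} → Subset n → ℕ → Bool
at Vec.[]      _       = false
at (s Vec.∷ J) zero    = s
at (s Vec.∷ J) (suc m) = at J m

-- Members are numbers as in [n]; position 0 never belongs to J, matching j₀ = 0.
mem : ∀ {n} → Subset n → ℕ → Bool
mem J zero    = false
mem J (suc m) = at J m

at-toℕ : ∀ {n} (J : Subset n) x → at J (Fin.toℕ x) ≡ lookup J x
at-toℕ (s Vec.∷ J) zero    = ≡.refl
at-toℕ (s Vec.∷ J) (suc x) = at-toℕ J x

at-≤ : ∀ {n} (J : Subset n) m → at J m ≡ true → m < n
at-≤ (s Vec.∷ J) zero    _  = s≤s z≤n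
at-≤ (s Vec.∷ J) (suc m) eq = s≤s (at-≤ J m eq)

mem-≤ : ∀ {n} (J : Subset n) m → mem J m ≡ true → m ≤ n
mem-≤ J (suc m) = at-≤ J m

at-injective : ∀ {n} (J J′ : Subset n) → (∀ m → at J m ≡ at J′ m) → J ≡ J′
at-injective Vec.[]      Vec.[]        eq = ≡.refl
at-injective (s Vec.∷ J) (s′ Vec.∷ J′) eq = ≡.cong₂ Vec._∷_ (eq 0) (at-injective J J′ (eq ∘ suc))

-- The default 0 for an empty range plays the part of j₀ and makes the thresholds of a degree start
-- at 0.
floor : (ℕ → Bool) → ℕ → ℕ
floor μ zero    = 0
floor μ (suc a) = if μ (suc a) then suc a else floor μ a

floor-≤ : ∀ μ a → floor μ a ≤ a
floor-≤ μ zero    = z≤n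
floor-≤ μ (suc a) with μ (suc a)
... | true  = ℕₚ.≤-refl
... | false = ℕₚ.m≤n⇒m≤1+n (floor-≤ μ a)

floor-step : ∀ μ a → floor μ (suc a) ≡ floor μ a ⊎ floor μ (suc a) ≡ suc a
floor-step μ a with μ (suc a)
... | true  = inj₂ ≡.refl
... | false = inj₁ ≡.refl

floor⁺ : ∀ μ {j a m} → μ j ≡ true → m ≤ j → j ≤ a → m ≤ floor μ a
floor⁺ μ {j} {zero}  {m} μj m≤j j≤a = ℕₚ.≤-trans m≤j j≤a
floor⁺ μ {j} {suc a} {m} μj m≤j j≤1+a with μ (suc a) in eq
... | true  = ℕₚ.≤-trans m≤j j≤1+a
... | false = floor⁺ μ μj m≤j (ℕₚ.≤-pred
    (ℕₚ.≤∧≢⇒< j≤1+a λ { ≡.refl → contradiction (≡.trans (≡.sym μj) eq) λ () }))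

floor⁻ : ∀ μ a {m} → 1 ≤ m → m ≤ floor μ a → ∃ λ j → μ j ≡ true × m ≤ j × j ≤ a
floor⁻ μ zero    1≤m m≤0 = contradiction (ℕₚ.≤-trans 1≤m m≤0) λ ()
floor⁻ μ (suc a) 1≤m m≤ with μ (suc a) in eq
... | true  = suc a , eq , m≤ , ℕₚ.≤-refl
... | false = let j , μj , m≤j , j≤a = floor⁻ μ a 1≤m m≤ in j , μj , m≤j , ℕₚ.m≤n⇒m≤1+n j≤a

floor-mono : ∀ μ {a a′} → a ≤ a′ → floor μ a ≤ floor μ a′
floor-mono μ {a} {a′} a≤a′ with floor μ a in eq
... | zero  = z≤n
... | suc f = let j , μj , ≤j , j≤a = floor⁻ μ a {suc f} (s≤s z≤n) (ℕₚ.≤-reflexive (≡.sym eq)) in floor⁺ μ μj ≤j (ℕₚ.≤-trans j≤a a≤a′)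

floor-mem : ∀ μ a → 1 ≤ floor μ a → μ (floor μ a) ≡ true
floor-mem μ (suc a) 1≤ with μ (suc a) in eq
... | true  = eq
... | false = floor-mem μ a 1≤

consIf : Bool → ℕ → List ℕ → List ℕ
consIf true  j js = j ∷ js
consIf false j js = js

-- The j ∈ (c, c + a] with μ j, in increasing order.
members : (ℕ → Bool) → ℕ → ℕ → List ℕ
members μ c zero    = []
members μ c (suc a) = consIf (μ (suc c)) (suc c) (members μ (suc c) a)

elements-members : ∀ {n} (J : Subset n) → elements J ≡ members (mem J) 0 n
elements-members {n} J = go n 0 id λ _ → ≡.refl
  where
  open Subsetₚ using (_∈?_)
  go : ∀ m c (g : Fin m → Fin n) → (∀ i → Fin.toℕ (g i) ≡ c + Fin.toℕ i) →
       List.map pos (List.filter (_∈? J) (List.tabulate g)) ≡ members (mem J) c m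
  go zero    c g g≡ = ≡.refl
  go (suc m) c g g≡ with c≡ ← ≡.trans (g≡ zero) (ℕₚ.+-identityʳ c) | ih ← go m (suc c) (g ∘ suc) (λ i → ≡.trans (g≡ (suc i)) (ℕₚ.+-suc c _))
    with g zero ∈? J
  ... | yes g∈J rewrite ≡.trans (≡.sym (≡.cong (at J) c≡)) (≡.trans (at-toℕ J (g zero)) (Vecₚ.[]=⇒lookup g∈J)) = ≡.cong₂ _∷_ (≡.cong suc c≡) ih
  ... | no  g∉J with at J c in eq
  ...   | false = ih
  ...   | true  = contradiction (Vecₚ.lookup⇒[]= (g zero) J
      (≡.trans (≡.sym (at-toℕ J (g zero))) (≡.trans (≡.cong (at J) c≡) eq))) g∉J

∈-members⁻ : ∀ μ c a {j} → j ∈ members μ c a → μ j ≡ true × c < j × j ≤ c + a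
∈-members⁻ μ c (suc a) {j} j∈ with μ (suc c) in eq
... | false = let μj , c<j , j≤ = ∈-members⁻ μ (suc c) a j∈ in μj , ℕₚ.<⇒≤ c<j , ℕₚ.≤-trans j≤ (ℕₚ.≤-reflexive (≡.sym (ℕₚ.+-suc c a)))
∈-members⁻ μ c (suc a) (here ≡.refl) | true = eq , ℕₚ.≤-refl , ℕₚ.≤-trans (s≤s (ℕₚ.m≤m+n c a))
    (ℕₚ.≤-reflexive (≡.sym (ℕₚ.+-suc c a)))
∈-members⁻ μ c (suc a) (there j∈)    | true = let μj , c<j , j≤ = ∈-members⁻ μ (suc c) a j∈ in μj , ℕₚ.<⇒≤ c<j , ℕₚ.≤-trans j≤ (ℕₚ.≤-reflexive (≡.sym (ℕₚ.+-suc c a)))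

∈-members⁺ : ∀ μ c a {j} → μ j ≡ true → c < j → j ≤ c + a → j ∈ members μ c a
∈-members⁺ μ c zero    μj c<j j≤ = contradiction (ℕₚ.≤-trans j≤ (ℕₚ.≤-reflexive (ℕₚ.+-identityʳ c))) (ℕₚ.<⇒≱ c<j)
∈-members⁺ μ c (suc a) {j} μj c<j j≤ with j ℕ.≟ suc c
... | yes ≡.refl rewrite μj = here ≡.refl
... | no j≢1+c with ih ← ∈-members⁺ μ (suc c) a μj (ℕₚ.≤∧≢⇒< c<j (j≢1+c ∘ ≡.sym)) (ℕₚ.≤-trans j≤ (ℕₚ.≤-reflexive (ℕₚ.+-suc c a))) with μ (suc c)
...   | true  = there ih
...   | false = ih

snocIf : Bool → List ℕ → ℕ → List ℕ
snocIf true  js j = js List.∷ʳ j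
snocIf false js j = js

-- `members` recurses from below, like `elements`, whereas floors, jumps and binomial chains recurse
-- from above.
members-snoc : ∀ μ c a → members μ c (suc a) ≡ snocIf (μ (suc (c + a))) (members μ c a) (suc (c + a))
members-snoc μ c zero rewrite ℕₚ.+-identityʳ c with μ (suc c)
... | true  = ≡.refl
... | false = ≡.refl
members-snoc μ c (suc a) rewrite members-snoc μ (suc c) a | ℕₚ.+-suc c a with μ (suc c) | μ (suc (suc (c + a)))
... | true  | true  = ≡.refl
... | true  | false = ≡.refl
... | false | true  = ≡.refl
... | false | false = ≡.refl

Asc : ℕ → List ℕ → Set
Asc p []       = Data.Unit.⊤
Asc p (j ∷ js) = p < j × Asc j js

Asc-≤ : ∀ {p p′} js → p ≤ p′ → Asc p′ js → Asc p js
Asc-≤ []       _    _          = _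
Asc-≤ (j ∷ js) p≤p′ (p′<j , asc) = ℕₚ.≤-<-trans p≤p′ p′<j , asc

Asc-members : ∀ μ c a → Asc c (members μ c a)
Asc-members μ c zero    = _
Asc-members μ c (suc a) with μ (suc c)
... | true  = ℕₚ.≤-refl , Asc-members μ (suc c) a
... | false = Asc-≤ (members μ (suc c) a) (ℕₚ.n≤1+n c) (Asc-members μ (suc c) a)

-- entry e p js α is the α-th element of js, counted from 1, with p in position 0 and e beyond the end.
entry : ℕ → ℕ → List ℕ → ℕ → ℕ
entry e p js zero    = p
entry e p js (suc α) = fromMaybe e (List.head (List.drop α js))

j-entry : ∀ {n} (J : Subset n) α → j J α ≡ entry n 0 (elements J) α
j-entry J zero    = ≡.refl
j-entry J (suc α) = ≡.refl

entry-∷ : ∀ e p j js α → entry e p (j ∷ js) (suc α) ≡ entry e j js α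
entry-∷ e p j js zero    = ≡.refl
entry-∷ e p j js (suc α) = ≡.refl

lastOr : ℕ → List ℕ → ℕ
lastOr p []       = p
lastOr p (j ∷ js) = lastOr j js

entry-init : ∀ e p js m → entry e p (js List.∷ʳ m) (length js) ≡ lastOr p js
entry-init e p []       m = ≡.refl
entry-init e p (j ∷ js) m = ≡.trans (entry-∷ e p j (js List.∷ʳ m) (length js)) (entry-init e j js m)

entry-length : ∀ e p js → entry e p js (length js) ≡ lastOr p js
entry-length e p []       = ≡.refl
entry-length e p (j ∷ js) = ≡.trans (entry-∷ e p j js (length js)) (entry-length e j js)

lastOr-∷ʳ : ∀ p js m → lastOr p (js List.∷ʳ m) ≡ m
lastOr-∷ʳ p []       m = ≡.refl
lastOr-∷ʳ p (j ∷ js) m = lastOr-∷ʳ j js m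

lastOr-members : ∀ μ a → lastOr 0 (members μ 0 a) ≡ floor μ a
lastOr-members μ zero    = ≡.refl
lastOr-members μ (suc a) rewrite members-snoc μ 0 a with μ (suc a)
... | true  = lastOr-∷ʳ 0 (members μ 0 a) (suc a)
... | false = lastOr-members μ a

applyUpTo-cong : ∀ {ℓ} {A : Set ℓ} {f g : ℕ → A} m → (∀ α → f α ≡ g α) → List.applyUpTo f m ≡ List.applyUpTo g m
applyUpTo-cong zero    eq = ≡.refl
applyUpTo-cong (suc m) eq = ≡.cong₂ _∷_ (eq 0) (applyUpTo-cong m (eq ∘ suc))

steps : ∀ {ℓ} {A : Set ℓ} → (ℕ → ℕ → A) → ℕ → List ℕ → List A
steps F p []       = []
steps F p (j ∷ js) = F p j ∷ steps F j js

steps-entry : ∀ {ℓ} {A : Set ℓ} (F : ℕ → ℕ → A) e p js →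
              List.applyUpTo (λ α → F (entry e p js α) (entry e p js (suc α))) (length js) ≡ steps F p js
steps-entry F e p []       = ≡.refl
steps-entry F e p (j ∷ js) = ≡.cong (F p j ∷_) (≡.trans
  (applyUpTo-cong (length js) λ α → ≡.cong₂ F (entry-∷ e p j js α) (entry-∷ e p j js (suc α)))
  (steps-entry F e j js))

∣∣≡length : ∀ {n} (J : Subset n) → ∣ J ∣ ≡ length (elements J)
∣∣≡length {n} J = ≡.sym (≡.trans (Listₚ.length-map pos (List.filter (_∈? J) (List.allFin n)))
  (≡.trans (count-filter (_∈? J) id) (≡.trans (count-cong at-x) (≡.sym (∣∣≡count J)))))
  where
  open Subsetₚ using (_∈?_)
  at-x : ∀ x → does (x ∈? J) ≡ lookup J x
  at-x x with x ∈? J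
  ... | yes x∈J = ≡.sym (Vecₚ.[]=⇒lookup x∈J)
  ... | no  x∉J with lookup J x in eq
  ...   | false = ≡.refl
  ...   | true  = contradiction (Vecₚ.lookup⇒[]= x J eq) x∉J

module DualIsolated (n k : ℕ) (k<n : k < n) where

  open Isolated n k
  open Thresholds n

  max-floor : ∀ (J : Subset n) → max J ≡ floor (mem J) n
  max-floor J = ≡.trans (j-entry J ∣ J ∣) (≡.trans (≡.cong (entry n 0 (elements J)) (∣∣≡length J))
    (≡.trans (entry-length n 0 (elements J))
        (≡.trans (≡.cong (lastOr 0) (elements-members J)) (lastOr-members (mem J) n))))

  𝐛-steps : ∀ (J : Subset n) → 𝐛 J ≡ List.foldr _⊕_ 𝟎 (steps (λ p j → λ[ j ] ⊙ ε⟨ p , j ⟩) 0 (elements J))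
  𝐛-steps J = ≡.cong (List.foldr _⊕_ 𝟎) (≡.trans (Listₚ.map-applyUpTo id _ ∣ J ∣) (≡.trans
    (≡.cong (List.applyUpTo _) (∣∣≡length J)) (≡.trans
    (applyUpTo-cong (length (elements J)) λ α → ≡.cong₂ (λ p j → λ[ j ] ⊙ ε⟨ p , j ⟩) (j-entry J α)
        (j-entry J (suc α)))
    (steps-entry _ n 0 (elements J)))))

  -- Coordinate m of the degree. The intervals (p, j] of an ascending list are disjoint, so at most
  -- one summand is non-zero.
  value : ℕ → List ℕ → ℕ → ℕ
  value p []       m = 0
  value p (j ∷ js) m = λ[ j ] * (if (p ℕ.<ᵇ m) ∧ (m ℕ.≤ᵇ j) then 1 else 0) + value j js m

  lookup-steps : ∀ p js x → lookup (List.foldr _⊕_ 𝟎 (steps (λ p j → λ[ j ] ⊙ ε⟨ p , j ⟩) p js)) x ≡ value p js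
      (pos x)
  lookup-steps p []       x = lookup-𝟎 x
  lookup-steps p (j ∷ js) x = ≡.trans (lookup-⊕ (λ[ j ] ⊙ ε⟨ p , j ⟩) _ x) (≡.cong₂ _+_
    (≡.trans (Vecₚ.lookup-map x _ ε⟨ p , j ⟩) (≡.cong (λ[ j ] *_) (Vecₚ.lookup∘tabulate _ x)))
        (lookup-steps j js x))

  λ-low : ∀ {j} → j ≤ k → λ[ j ] ≡ n ∸ j + 1
  λ-low {j} j≤k = ≡.cong (if_then n ∸ j + 1 else n ∸ k) (dec-true (j ℕ.≤? k) j≤k)

  λ-high : ∀ {j} → k < j → λ[ j ] ≡ n ∸ k
  λ-high {j} k<j = ≡.cong (if_then n ∸ j + 1 else n ∸ k) (dec-false (j ℕ.≤? k) (ℕₚ.<⇒≱ k<j))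

  λ-antitone : ∀ {j j′} → j ≤ j′ → λ[ j′ ] ≤ λ[ j ]
  λ-antitone {j} {j′} j≤j′ with j′ ℕ.≤? k | j ℕ.≤? k
  ... | yes j′≤k | _ rewrite λ-low j′≤k | λ-low (ℕₚ.≤-trans j≤j′ j′≤k) = ℕₚ.+-monoˡ-≤ 1 (ℕₚ.∸-monoʳ-≤ n j≤j′)
  ... | no j′≰k | yes j≤k rewrite λ-high (ℕₚ.≰⇒> j′≰k) | λ-low j≤k = ℕₚ.≤-trans (ℕₚ.∸-monoʳ-≤ n j≤k) (ℕₚ.m≤m+n _ 1)
  ... | no j′≰k | no j≰k  rewrite λ-high (ℕₚ.≰⇒> j′≰k) | λ-high (ℕₚ.≰⇒> j≰k) = ℕₚ.≤-refl

  λ-top⁺ : ∀ {j a} → j ≤ a → suc n ≤ λ[ j ] + a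
  λ-top⁺ {j} {a} j≤a with j ℕ.≤? k
  ... | yes j≤k rewrite λ-low j≤k = ℕₚ.≤-trans (s≤s (ℕₚ.≤-trans (ℕₚ.m≤n+m∸n n j) (ℕₚ.≤-trans (ℕₚ.≤-reflexive (ℕₚ.+-comm j _)) (ℕₚ.+-monoʳ-≤ (n ∸ j) j≤a))))
                      (ℕₚ.≤-reflexive (≡.trans (≡.sym (ℕₚ.+-suc (n ∸ j) a)) (≡.sym (ℕₚ.+-assoc (n ∸ j) 1 a))))
  ... | no j≰k rewrite λ-high (ℕₚ.≰⇒> j≰k) = ℕₚ.≤-trans (s≤s (ℕₚ.≤-reflexive (≡.sym (ℕₚ.m∸n+n≡m (ℕₚ.<⇒≤ k<n)))))
                      (ℕₚ.≤-trans (ℕₚ.≤-reflexive (≡.sym (ℕₚ.+-suc (n ∸ k) k)))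
                          (ℕₚ.+-monoʳ-≤ (n ∸ k) (ℕₚ.≤-trans (ℕₚ.≰⇒> j≰k) j≤a)))

  λ-top-high : ∀ j {a} → k < a → suc n ≤ λ[ j ] + a
  λ-top-high j {a} k<a with j ℕ.≤? k
  ... | yes j≤k = λ-top⁺ (ℕₚ.≤-trans j≤k (ℕₚ.<⇒≤ k<a))
  ... | no j≰k rewrite λ-high (ℕₚ.≰⇒> j≰k) = ℕₚ.≤-trans (s≤s (ℕₚ.≤-reflexive (≡.sym (ℕₚ.m∸n+n≡m (ℕₚ.<⇒≤ k<n)))))
                      (ℕₚ.≤-trans (ℕₚ.≤-reflexive (≡.sym (ℕₚ.+-suc (n ∸ k) k))) (ℕₚ.+-monoʳ-≤ (n ∸ k) k<a))

  λ-top⁻ : ∀ {j a} → j ≤ n → a ≤ k → suc n ≤ λ[ j ] + a → j ≤ a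
  λ-top⁻ {j} {a} j≤n a≤k le with j ℕ.≤? k
  ... | yes j≤k rewrite λ-low j≤k = ℕₚ.+-cancelˡ-≤ (n ∸ j) _ _ (ℕₚ.≤-trans (ℕₚ.≤-reflexive (ℕₚ.m∸n+n≡m j≤n))
                      (ℕₚ.≤-pred (ℕₚ.≤-trans le (ℕₚ.≤-reflexive
                          (≡.trans (ℕₚ.+-assoc (n ∸ j) 1 a) (ℕₚ.+-suc (n ∸ j) a))))))
  ... | no j≰k rewrite λ-high (ℕₚ.≰⇒> j≰k) = contradiction (ℕₚ.≤-trans le (ℕₚ.≤-trans (ℕₚ.+-monoʳ-≤ (n ∸ k) a≤k) (ℕₚ.≤-reflexive (ℕₚ.m∸n+n≡m (ℕₚ.<⇒≤ k<n))))) ℕₚ.1+n≰n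

  value-low : ∀ {p} js {m} → Asc p js → m ≤ p → value p js m ≡ 0
  value-low []       asc m≤p = ≡.refl
  value-low {p} (j ∷ js) {m} (p<j , asc) m≤p = ≡.cong₂ _+_
    (≡.trans (≡.cong (λ s → λ[ j ] * (if s ∧ (m ℕ.≤ᵇ j) then 1 else 0)) (dec-false (p ℕ.<? m) (ℕₚ.≤⇒≯ m≤p)))
        (ℕₚ.*-zeroʳ λ[ j ]))
    (value-low js asc (ℕₚ.≤-trans m≤p (ℕₚ.<⇒≤ p<j)))

  value-hit : ∀ {p} j js {m} → p < m → m ≤ j → Asc j js → value p (j ∷ js) m ≡ λ[ j ]
  value-hit {p} j js {m} p<m m≤j asc = ≡.trans (≡.cong₂ _+_
    (≡.trans (≡.cong₂ (λ s t → λ[ j ] * (if s ∧ t then 1 else 0)) (dec-true (p ℕ.<? m) p<m)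
        (dec-true (m ℕ.≤? j) m≤j)) (ℕₚ.*-identityʳ λ[ j ]))
    (value-low js asc m≤j)) (ℕₚ.+-identityʳ _)

  value-miss : ∀ {p} j js {m} → p < m → j < m → value p (j ∷ js) m ≡ value j js m
  value-miss {p} j js {m} p<m j<m = ≡.cong (_+ value j js m)
    (≡.trans (≡.cong₂ (λ s t → λ[ j ] * (if s ∧ t then 1 else 0)) (dec-true (p ℕ.<? m) p<m)
        (dec-false (m ℕ.≤? j) (ℕₚ.<⇒≱ j<m))) (ℕₚ.*-zeroʳ λ[ j ]))

  value⁻ : ∀ {p} js {m a} → Asc p js → p < m → a ≤ n → suc n ≤ value p js m + a →
           ∃ λ j → j ∈ js × m ≤ j × suc n ≤ λ[ j ] + a
  value⁻ []       asc p<m a≤n le = contradiction (ℕₚ.≤-trans le a≤n) ℕₚ.1+n≰n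
  value⁻ {p} (j ∷ js) {m} {a} (p<j , asc) p<m a≤n le with m ℕ.≤? j
  ... | yes m≤j = j , here ≡.refl , m≤j , ≡.subst (λ v → suc n ≤ v + a) (value-hit j js p<m m≤j asc) le
  ... | no  m≰j = let j′ , j′∈ , rest = value⁻ js asc (ℕₚ.≰⇒> m≰j) a≤n (≡.subst (λ v → suc n ≤ v + a) (value-miss j js p<m (ℕₚ.≰⇒> m≰j)) le) in
                  j′ , there j′∈ , rest

  Asc-head-≤ : ∀ {p} js {j} → Asc p js → j ∈ js → p < j
  Asc-head-≤ (j ∷ js) (p<j , asc) (here ≡.refl) = p<j
  Asc-head-≤ (j ∷ js) (p<j , asc) (there j∈)    = ℕₚ.<-trans p<j (Asc-head-≤ js asc j∈)

  -- The value at m is λ at the first element ≥ m, and λ is antitone: if a later j reaches the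
  -- threshold, so does the first one.
  value⁺ : ∀ {p} js {m a j} → Asc p js → p < m → j ∈ js → m ≤ j → suc n ≤ λ[ j ] + a → suc n ≤ value p js m + a
  value⁺ {p} (i ∷ js) {m} {a} {j} (p<i , asc) p<m j∈ m≤j le with m ℕ.≤? i
  ... | yes m≤i rewrite value-hit {p} i js p<m m≤i asc = ℕₚ.≤-trans le (ℕₚ.+-monoˡ-≤ a (λ-antitone (i≤j j∈)))
    where
    i≤j : j ∈ i ∷ js → i ≤ j
    i≤j (here ≡.refl) = ℕₚ.≤-refl
    i≤j (there j∈js)  = ℕₚ.<⇒≤ (Asc-head-≤ js asc j∈js)
  ... | no m≰i rewrite value-miss {p} i js p<m (ℕₚ.≰⇒> m≰i) = value⁺ js asc (ℕₚ.≰⇒> m≰i) (j∈js j∈) m≤j le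
    where
    j∈js : j ∈ i ∷ js → j ∈ js
    j∈js (here ≡.refl) = contradiction m≤j m≰i
    j∈js (there j∈js)  = j∈js

  -- λ never falls below n - k, so every threshold a > k counts all positions up to the maximum of
  -- J.
  tᴶ : Subset n → ℕ → ℕ
  tᴶ J a = if does (a ℕ.≤? k) then floor (mem J) a else floor (mem J) n

  tᴶ-low : ∀ J {a} → a ≤ k → tᴶ J a ≡ floor (mem J) a
  tᴶ-low J {a} a≤k = ≡.cong (if_then _ else _) (dec-true (a ℕ.≤? k) a≤k)

  tᴶ-high : ∀ J {a} → k < a → tᴶ J a ≡ floor (mem J) n
  tᴶ-high J {a} k<a = ≡.cong (if_then _ else _) (dec-false (a ℕ.≤? k) (ℕₚ.<⇒≱ k<a))

  count-pos : ∀ {m N} → N ≤ m → count (λ (x : Fin m) → does (pos x ℕ.≤? N)) ≡ N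
  count-pos {m} {zero} z≤n = count-false {m} λ x → dec-false (pos x ℕ.≤? 0) λ ()
  count-pos {suc m} {suc N} (s≤s N≤m) = ≡.cong suc (≡.trans
    (count-cong {m} λ x → does-⇔ (pos {suc m} (suc x) ℕ.≤? suc N) (pos {m} x ℕ.≤? N) ℕₚ.≤-pred s≤s)
        (count-pos {m} N≤m))

  -- The entries of 𝐛 J decrease weakly, so those reaching a threshold fill an initial segment.
  -- Position m counts iff some j ≥ m in J has λ_j ≥ n + 1 - a, which for a ≤ k says j ≤ a.
  τ-𝐛 : ∀ J a → a ≤ n → τ (lookup (𝐛 J)) a ≡ tᴶ J a
  τ-𝐛 J a a≤n = ≡.trans (count-cong λ x → does-⇔ (suc n ℕ.≤? lookup (𝐛 J) x + a) (pos x ℕ.≤? tᴶ J a) (to x)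
      (from x)) (count-pos tᴶ≤n)
    where
    μ : ℕ → Bool
    μ = mem J
    tᴶ≤n : tᴶ J a ≤ n
    tᴶ≤n with a ℕ.≤? k
    ... | yes a≤k rewrite tᴶ-low J a≤k = ℕₚ.≤-trans (floor-≤ μ a) a≤n
    ... | no  a≰k rewrite tᴶ-high J (ℕₚ.≰⇒> a≰k) = floor-≤ μ n
    lookup-𝐛 : ∀ x → lookup (𝐛 J) x ≡ value 0 (members μ 0 n) (pos x)
    lookup-𝐛 x = ≡.trans (≡.cong (λ b → lookup b x) (𝐛-steps J))
        (≡.trans (lookup-steps 0 (elements J) x) (≡.cong (λ js → value 0 js (pos x)) (elements-members J)))
    to : ∀ x → suc n ≤ lookup (𝐛 J) x + a → pos x ≤ tᴶ J a
    to x le with j , j∈ , x≤j , top ← value⁻ (members μ 0 n) (Asc-members μ 0 n) (s≤s z≤n) a≤n (≡.subst (λ v → suc n ≤ v + a) (lookup-𝐛 x) le)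
            with μj , _ , j≤n ← ∈-members⁻ μ 0 n j∈ with a ℕ.≤? k
    ... | yes a≤k rewrite tᴶ-low J a≤k = floor⁺ μ μj x≤j (λ-top⁻ j≤n a≤k top)
    ... | no  a≰k rewrite tᴶ-high J (ℕₚ.≰⇒> a≰k) = floor⁺ μ μj x≤j j≤n
    from : ∀ x → pos x ≤ tᴶ J a → suc n ≤ lookup (𝐛 J) x + a
    from x x≤ = ≡.subst (λ v → suc n ≤ v + a) (≡.sym (lookup-𝐛 x)) (by-case (a ℕ.≤? k))
      where
      by-case : Dec (a ≤ k) → suc n ≤ value 0 (members μ 0 n) (pos x) + a
      by-case (yes a≤k) with j , μj , x≤j , j≤a ← floor⁻ μ a (s≤s z≤n) (≡.subst (pos x ≤_) (tᴶ-low J a≤k) x≤) =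
        value⁺ (members μ 0 n) (Asc-members μ 0 n) (s≤s z≤n)
            (∈-members⁺ μ 0 n μj (ℕₚ.≤-trans (s≤s z≤n) x≤j) (ℕₚ.≤-trans j≤a a≤n)) x≤j (λ-top⁺ j≤a)
      by-case (no a≰k) with j , μj , x≤j , j≤n ← floor⁻ μ n (s≤s z≤n) (≡.subst (pos x ≤_) (tᴶ-high J (ℕₚ.≰⇒> a≰k)) x≤) =
        value⁺ (members μ 0 n) (Asc-members μ 0 n) (s≤s z≤n)
            (∈-members⁺ μ 0 n μj (ℕₚ.≤-trans (s≤s z≤n) x≤j) j≤n) x≤j (λ-top-high j (ℕₚ.≰⇒> a≰k))

-- Binomial chains along thresholds.

open import Data.Nat.Combinatorics using (_C_; nCn≡1; nCk≡nC[n∸k]; nCk+nC[k+1]≡[n+1]C[k+1]; k>n⇒nCk≡0)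

nC0≡1 : ∀ m → m C 0 ≡ 1
nC0≡1 m = ≡.trans (nCk≡nC[n∸k] {k = 0} {n = m} z≤n) (nCn≡1 m)

topFaces-C : ∀ v r → topFaces (suc v) (suc r) ≡ v C r
topFaces-C zero    zero    = ≡.refl
topFaces-C zero    (suc r) = ≡.sym (k>n⇒nCk≡0 {n = 0} {k = suc r} (s≤s z≤n))
topFaces-C (suc v) zero    = ≡.trans (ℕₚ.+-identityʳ _)
    (≡.trans (topFaces-C v 0) (≡.trans (nC0≡1 v) (≡.sym (nC0≡1 (suc v)))))
topFaces-C (suc v) (suc r) = ≡.trans (≡.cong₂ _+_ (topFaces-C v (suc r)) (topFaces-C v r))
  (≡.trans (ℕₚ.+-comm (v C suc r) (v C r)) (nCk+nC[k+1]≡[n+1]C[k+1] v r))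

nextProduct : ℕ → List ℕ → ℕ
nextProduct e js = ℕL.product (List.applyUpTo (λ α → entry e 0 js (suc (suc α)) C entry e 0 js (suc α))
    (length js))

nextProduct-∷ʳ : ∀ e js m → nextProduct e (js List.∷ʳ m) ≡ nextProduct m js * (e C m)
nextProduct-∷ʳ e []       m = ℕₚ.*-comm (e C m) 1
nextProduct-∷ʳ e (j ∷ js) m = ≡.trans (≡.cong₂ (λ x y → (x C j) * y) (first js) (nextProduct-∷ʳ e js m))
  (≡.sym (ℕₚ.*-assoc (entry m 0 js 1 C j) (nextProduct m js) (e C m)))
  where
  first : ∀ js → entry e 0 (js List.∷ʳ m) 1 ≡ entry m 0 js 1
  first []      = ≡.refl
  first (_ ∷ _) = ≡.refl

-- The number of chains of subsets of an e-element set with sizes t a, ..., t 1.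
chainDown : ℕ → (ℕ → ℕ) → ℕ → ℕ
chainDown e t zero    = 1
chainDown e t (suc a) = (e C t (suc a)) * chainDown (t (suc a)) t a

-- A repeated size contributes C(t a, t a) = 1; at the bottom t 0 = 0 leaves C(e, 0) = 1.
chainDown-collapse : ∀ e t a → t 0 ≡ 0 → (e C t a) * chainDown (t a) t a ≡ chainDown e t a
chainDown-collapse e t zero    t0 rewrite t0 = ≡.trans (ℕₚ.*-identityʳ _) (nC0≡1 e)
chainDown-collapse e t (suc a) t0 = ≡.cong ((e C t (suc a)) *_)
  (≡.trans (≡.cong (_* chainDown (t (suc a)) t a) (nCn≡1 (t (suc a)))) (ℕₚ.*-identityˡ _))

chainDown-cong : ∀ e {t u} a → (∀ a′ → a′ ≤ a → t a′ ≡ u a′) → chainDown e t a ≡ chainDown e u a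
chainDown-cong e zero    t≗u = ≡.refl
chainDown-cong e {t} {u} (suc a) t≗u rewrite t≗u (suc a) ℕₚ.≤-refl =
  ≡.cong ((e C u (suc a)) *_) (chainDown-cong (u (suc a)) a λ a′ a′≤a → t≗u a′ (ℕₚ.m≤n⇒m≤1+n a′≤a))

chainDown-constant : ∀ m t k d → (∀ a → k < a → t a ≡ m) → chainDown m t (k + d) ≡ chainDown m t k
chainDown-constant m t k zero    const = ≡.cong (chainDown m t) (ℕₚ.+-identityʳ k)
chainDown-constant m t k (suc d) const rewrite ℕₚ.+-suc k d | const (suc (k + d)) (s≤s (ℕₚ.m≤m+n k d)) | nCn≡1 m =
  ≡.trans (ℕₚ.*-identityˡ _) (chainDown-constant m t k d const)

nextProduct-members : ∀ e μ a → nextProduct e (members μ 0 a) ≡ chainDown e (floor μ) a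
nextProduct-members e μ zero    = ≡.refl
nextProduct-members e μ (suc a) rewrite members-snoc μ 0 a with μ (suc a)
... | true  = ≡.trans (nextProduct-∷ʳ e (members μ 0 a) (suc a))
                (≡.trans (ℕₚ.*-comm _ (e C suc a)) (≡.cong ((e C suc a) *_) (nextProduct-members (suc a) μ a)))
... | false = ≡.trans (nextProduct-members e μ a) (≡.sym (chainDown-collapse e (floor μ) a ≡.refl))

jumps-floor : ∀ μ a → jumps (floor μ) a ≡ length (members μ 0 a)
jumps-floor μ zero    = ≡.refl
jumps-floor μ (suc a) rewrite members-snoc μ 0 a with μ (suc a)
... | true  rewrite dec-false (suc a ℕ.≟ floor μ a) (λ eq → ℕₚ.1+n≰n (≡.subst (_≤ a) (≡.sym eq) (floor-≤ μ a))) =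
  ≡.trans (≡.cong suc (jumps-floor μ a)) (≡.trans (ℕₚ.+-comm 1 _) (≡.sym (Listₚ.length-++ (members μ 0 a))))
... | false rewrite dec-true (floor μ a ℕ.≟ floor μ a) ≡.refl = jumps-floor μ a

members-none : ∀ μ k d → (∀ j → k < j → j ≤ k + d → μ j ≢ true) → members μ 0 (k + d) ≡ members μ 0 k
members-none μ k zero    none = ≡.cong (members μ 0) (ℕₚ.+-identityʳ k)
members-none μ k (suc d) none rewrite ℕₚ.+-suc k d | members-snoc μ 0 (k + d) with μ (suc (k + d)) in eq
... | true  = contradiction eq (none _ (s≤s (ℕₚ.m≤m+n k d)) ℕₚ.≤-refl)
... | false = members-none μ k d λ j k<j j≤ → none j k<j (ℕₚ.m≤n⇒m≤1+n j≤)

members-one : ∀ μ k d m → k < m → m ≤ k + d → μ m ≡ true → (∀ j → k < j → μ j ≡ true → j ≡ m) →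
          members μ 0 (k + d) ≡ members μ 0 k List.∷ʳ m
members-one μ k zero    m k<m m≤ μm only = contradiction (ℕₚ.≤-trans m≤ (ℕₚ.≤-reflexive (ℕₚ.+-identityʳ k)))
    (ℕₚ.<⇒≱ k<m)
members-one μ k (suc d) m k<m m≤ μm only rewrite ℕₚ.+-suc k d | members-snoc μ 0 (k + d) with μ (suc (k + d)) in eq
... | true with ≡.refl ← only _ (s≤s (ℕₚ.m≤m+n k d)) eq =
  ≡.cong (List._∷ʳ m) (members-none μ k d λ j k<j j≤ μj → ℕₚ.1+n≰n
      (ℕₚ.≤-trans (ℕₚ.≤-reflexive (≡.sym (only j k<j μj))) j≤))
... | false = members-one μ k d m k<m
    (ℕₚ.≤-pred (ℕₚ.≤∧≢⇒< m≤ λ { ≡.refl → contradiction (≡.trans (≡.sym μm) eq) λ () })) μm only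

predicted-cong : ∀ k {t u} i → (∀ a → a ≤ suc k → t a ≡ u a) → predicted k t i ≡ predicted k u i
predicted-cong k {t} {u} i t≗u
  rewrite t≗u (suc k) ℕₚ.≤-refl | t≗u k (ℕₚ.n≤1+n k) | jumps-cong {t} {u} k (λ a a≤k → t≗u a (ℕₚ.m≤n⇒m≤1+n a≤k)) = ≡.refl

-- Isolated subsets and their thresholds.

module IsolatedThresholds (n k : ℕ) (k<n : k < n) where

  open Isolated n k
  open DualIsolated n k k<n public

  -- What both types share: at most one element exceeds k, and it is the maximum. The empty set is
  -- included, for the degree 𝟎.
  Tame : Subset n → Set
  Tame J = ∀ j → k < j → mem J j ≡ true → j ≡ floor (mem J) n

  -- Both dual weights in one formula: in type 1 the maximum is at most k + 1 and the truncated
  -- difference is 0.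
  weight : Subset n → ℕ
  weight J = (∣ J ∣ ∸ 1) + (floor (mem J) n ∸ suc k)

  topBetti : Subset n → ℕ
  topBetti J = topFaces (floor (mem J) n ∸ floor (mem J) k) (floor (mem J) n ∸ k)

  k+[n∸k] : k + (n ∸ k) ≡ n
  k+[n∸k] = ℕₚ.m+[n∸m]≡n (ℕₚ.<⇒≤ k<n)

  ∈⇒mem : ∀ {J : Subset n} {x} → x Subset.∈ J → mem J (pos x) ≡ true
  ∈⇒mem {J} {x} x∈J = ≡.trans (at-toℕ J x) (Vecₚ.[]=⇒lookup x∈J)

  mem⇒∈ : ∀ (J : Subset n) j → mem J j ≡ true → ∃ λ x → x Subset.∈ J × pos x ≡ j
  mem⇒∈ J (suc m) eq = x , Vecₚ.lookup⇒[]= x J (≡.trans (≡.sym (at-toℕ J x)) (≡.trans (≡.cong (at J) x≡m) eq)) ,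
      ≡.cong suc x≡m
    where
    x : Fin n
    x = Fin.fromℕ< (at-≤ J m eq)
    x≡m : Fin.toℕ x ≡ m
    x≡m = Finₚ.toℕ-fromℕ< (at-≤ J m eq)

  nonempty⇒floor : ∀ {J : Subset n} → Nonempty J → 1 ≤ floor (mem J) n
  nonempty⇒floor {J} (x , x∈J) = floor⁺ (mem J) (∈⇒mem x∈J) (s≤s z≤n) (Finₚ.toℕ<n x)

  nonempty⇒∣∣ : ∀ {J : Subset n} → Nonempty J → 1 ≤ ∣ J ∣
  nonempty⇒∣∣ {J} (x , x∈J) = ≡.subst (1 ≤_) (≡.sym (∣∣≡count J)) (∃⇒0<count (lookup J) x (Vecₚ.[]=⇒lookup x∈J))

  pos≤floor : ∀ {J : Subset n} {x} → x Subset.∈ J → pos x ≤ floor (mem J) n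
  pos≤floor {J} {x} x∈J = floor⁺ (mem J) (∈⇒mem x∈J) ℕₚ.≤-refl (Finₚ.toℕ<n x)

  type1-max : ∀ {J} → Type1 J → floor (mem J) n ≤ suc k
  type1-max {J} (nonempty , ≤1+k) with x , x∈J , eq ← mem⇒∈ J _ (floor-mem (mem J) n (nonempty⇒floor nonempty)) =
    ℕₚ.≤-trans (ℕₚ.≤-reflexive (≡.sym eq)) (ℕₚ.≤-trans (≤1+k x∈J) (ℕₚ.≤-reflexive (ℕₚ.+-comm k 1)))

  type2-max : ∀ {J} → Type2 J → suc k < floor (mem J) n
  type2-max {J} (_ , _ , k+1<max) = ≡.subst₂ _<_ (ℕₚ.+-comm k 1) (max-floor J) k+1<max

  type1⇒tame : ∀ {J} → Type1 J → Tame J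
  type1⇒tame {J} ty@(_ , ≤1+k) j k<j μj with x , x∈J , ≡.refl ← mem⇒∈ J j μj =
    ℕₚ.≤-antisym (pos≤floor x∈J) (ℕₚ.≤-trans (type1-max ty) k<j)

  type2⇒tame : ∀ {J} → Type2 J → Tame J
  type2⇒tame {J} (_ , ≤k , _) j k<j μj with x , x∈J , ≡.refl ← mem⇒∈ J j μj with pos x ℕ.≟ max J
  ... | yes eq = ≡.trans eq (max-floor J)
  ... | no neq = contradiction (≤k x∈J neq) (ℕₚ.<⇒≱ k<j)

  isolated⇒tame : ∀ {w J} → 𝓘⟨ w ⟩ J → Nonempty J × Tame J × weight J ≡ w
  isolated⇒tame {w} {J} (inj₁ (ty , dwt)) = proj₁ ty , type1⇒tame ty ,
    ≡.trans (≡.cong (∣ J ∣ ∸ 1 +_) (ℕₚ.m≤n⇒m∸n≡0 (type1-max ty))) (≡.trans (ℕₚ.+-identityʳ _) dwt)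
  isolated⇒tame {w} {J} (inj₂ (ty , dwt)) = proj₁ ty , type2⇒tame ty ,
    ≡.trans (≡.cong₂ (λ m l → ∣ J ∣ ∸ 1 + (m ∸ l)) (≡.sym (max-floor J)) (ℕₚ.+-comm 1 k)) dwt

  tame⇒isolated : ∀ {w J} → Nonempty J → Tame J → weight J ≡ w → 𝓘⟨ w ⟩ J
  tame⇒isolated {w} {J} nonempty tame wt with floor (mem J) n ℕ.≤? suc k
  ... | yes ≤1+k = inj₁ ((nonempty , λ x∈J → ℕₚ.≤-trans (pos≤floor x∈J)
      (ℕₚ.≤-trans ≤1+k (ℕₚ.≤-reflexive (ℕₚ.+-comm 1 k)))) ,
                         ≡.trans (≡.sym (≡.trans (≡.cong (∣ J ∣ ∸ 1 +_) (ℕₚ.m≤n⇒m∸n≡0 ≤1+k))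
                             (ℕₚ.+-identityʳ _))) wt)
  ... | no ≰1+k = inj₂ ((nonempty , ≤k , ≡.subst₂ _<_ (ℕₚ.+-comm 1 k) (≡.sym (max-floor J)) (ℕₚ.≰⇒> ≰1+k)) ,
                        ≡.trans (≡.cong₂ (λ m l → ∣ J ∣ ∸ 1 + (m ∸ l)) (max-floor J) (ℕₚ.+-comm k 1)) wt)
    where
    ≤k : ∀ {x} → x Subset.∈ J → pos x ≢ max J → pos x ≤ k
    ≤k {x} x∈J ≢max = ℕₚ.≮⇒≥ λ k<x → ≢max (≡.trans (tame (pos x) k<x (∈⇒mem x∈J)) (≡.sym (max-floor J)))

  floor-low : ∀ (J : Subset n) → floor (mem J) n ≤ k → floor (mem J) n ≡ floor (mem J) k
  floor-low J T≤k = ℕₚ.≤-antisym (by-zero (floor (mem J) n) ≡.refl) (floor-mono (mem J) (ℕₚ.<⇒≤ k<n))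
    where
    by-zero : ∀ m → floor (mem J) n ≡ m → floor (mem J) n ≤ floor (mem J) k
    by-zero zero    eq = ≡.subst (_≤ floor (mem J) k) (≡.sym eq) z≤n
    by-zero (suc m) eq = floor⁺ (mem J) (floor-mem (mem J) n (≡.subst (1 ≤_) (≡.sym eq) (s≤s z≤n))) ℕₚ.≤-refl T≤k

  module _ (J : Subset n) (tame : Tame J) where

    private
      μ : ℕ → Bool
      μ = mem J
      F T : ℕ
      F = floor μ k
      T = floor μ n

    elements-low : T ≤ k → elements J ≡ members μ 0 k
    elements-low T≤k = ≡.trans (elements-members J) (≡.trans (≡.cong (members μ 0) (≡.sym k+[n∸k]))
      (members-none μ k (n ∸ k) λ j k<j j≤n μj → ℕₚ.<⇒≱ k<j (ℕₚ.≤-trans (ℕₚ.≤-reflexive (tame j k<j μj)) T≤k)))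

    elements-high : k < T → elements J ≡ members μ 0 k List.∷ʳ T
    elements-high k<T = ≡.trans (elements-members J) (≡.trans (≡.cong (members μ 0) (≡.sym k+[n∸k]))
      (members-one μ k (n ∸ k) T k<T (ℕₚ.≤-trans (floor-≤ μ n) (ℕₚ.≤-reflexive (≡.sym k+[n∸k])))
          (floor-mem μ n (ℕₚ.≤-trans (s≤s z≤n) k<T)) tame))

    jumps-tᴶ : jumps (tᴶ J) k ≡ length (members μ 0 k)
    jumps-tᴶ = ≡.trans (jumps-cong k λ a a≤k → tᴶ-low J a≤k) (jumps-floor μ k)

    -- The jumps are the elements of J up to k. A maximum T > k is not among them, but T - k exceeds
    -- T - (k + 1) by one and makes up for it.
    homological-degree : Nonempty J → jumps (tᴶ J) k + (T ∸ k) ≡ suc (weight J)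
    homological-degree nonempty with T ℕ.≤? k
    ... | yes T≤k rewrite ℕₚ.m≤n⇒m∸n≡0 T≤k | ℕₚ.m≤n⇒m∸n≡0 (ℕₚ.m≤n⇒m≤1+n T≤k) | ℕₚ.+-identityʳ (jumps (tᴶ J) k) | ℕₚ.+-identityʳ (∣ J ∣ ∸ 1) =
      ≡.trans jumps-tᴶ (≡.trans (≡.sym (≡.trans (∣∣≡length J) (≡.cong length (elements-low T≤k))))
        (≡.sym (ℕₚ.m+[n∸m]≡n (nonempty⇒∣∣ nonempty))))
    ... | no T≰k = ≡.trans (≡.cong₂ _+_ jumps-tᴶ (ℕₚ.+-∸-assoc 1 (ℕₚ.≰⇒> T≰k)))
        (≡.trans (ℕₚ.+-suc _ _) (≡.cong (λ m → suc (m + (T ∸ suc k))) (≡.sym ∣J∣∸1)))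
      where
      ∣J∣∸1 : ∣ J ∣ ∸ 1 ≡ length (members μ 0 k)
      ∣J∣∸1 = ≡.cong (_∸ 1) (≡.trans (∣∣≡length J) (≡.trans (≡.cong length (elements-high (ℕₚ.≰⇒> T≰k)))
        (≡.trans (Listₚ.length-++ (members μ 0 k)) (ℕₚ.+-comm _ 1))))

    predicted-tᴶ : ∀ i → Nonempty J → predicted k (tᴶ J) i ≡
        (if does (i ℕ.≟ suc (weight J)) then topBetti J else 0)
    predicted-tᴶ i nonempty = ≡.trans
      (≡.cong₂ (λ t f → if does (i ℕ.≟ jumps (tᴶ J) k + (t ∸ k)) then topFaces (t ∸ f) (t ∸ k) else 0)
          (tᴶ-high J ℕₚ.≤-refl) (tᴶ-low J ℕₚ.≤-refl))
      (≡.cong (λ m → if does (i ℕ.≟ m) then topBetti J else 0) (homological-degree nonempty))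

    topBetti-type1 : T ≤ suc k → topBetti J ≡ 1
    topBetti-type1 T≤1+k with T ℕ.≤? k
    ... | yes T≤k = ≡.cong₂ topFaces (≡.trans (≡.cong (_∸ F) (floor-low J T≤k)) (ℕₚ.n∸n≡0 F)) (ℕₚ.m≤n⇒m∸n≡0 T≤k)
    ... | no T≰k = ≡.trans (≡.cong₂ topFaces
        (≡.trans (≡.cong (_∸ F) T≡1+k) (ℕₚ.+-∸-assoc 1 (floor-≤ μ k)))
        (≡.trans (≡.cong (_∸ k) T≡1+k) (ℕₚ.m+n∸n≡m 1 k)))
        (≡.trans (topFaces-C (k ∸ F) 0) (nC0≡1 (k ∸ F)))
      where
      T≡1+k : T ≡ suc k
      T≡1+k = ℕₚ.≤-antisym T≤1+k (ℕₚ.≰⇒> T≰k)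

    -- `topFaces-C` gives C(T - F - 1, T - k - 1), which symmetry turns into the stated binomial; F
    -- is the penultimate element, or j₀ = 0.
    topBetti-type2 : k < T → topBetti J ≡ lastBinomial J
    topBetti-type2 k<T = ≡.trans (≡.cong₂ topFaces T∸F T∸k) (≡.trans (topFaces-C (T ∸ F ∸ 1) (T ∸ suc k))
      (≡.trans (nCk≡nC[n∸k] r≤v) (≡.trans (≡.cong ((T ∸ F ∸ 1) C_) v∸r) (≡.sym last))))
      where
      F≤k : F ≤ k
      F≤k = floor-≤ μ k
      T∸F : T ∸ F ≡ suc (T ∸ F ∸ 1)
      T∸F = ≡.sym (ℕₚ.m+[n∸m]≡n (ℕₚ.m<n⇒0<n∸m (ℕₚ.≤-<-trans F≤k k<T)))
      T∸k : T ∸ k ≡ suc (T ∸ suc k)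
      T∸k = ℕₚ.+-∸-assoc 1 k<T
      v≡ : T ∸ F ∸ 1 ≡ (k ∸ F) + (T ∸ suc k)
      v≡ = ≡.trans (ℕₚ.∸-+-assoc T F 1) (≡.trans (≡.cong (_∸ (F + 1)) (≡.sym (ℕₚ.m+[n∸m]≡n k<T)))
        (≡.trans (≡.cong (suc k + (T ∸ suc k) ∸_) (ℕₚ.+-comm F 1)) (ℕₚ.+-∸-comm (T ∸ suc k) F≤k)))
      r≤v : T ∸ suc k ≤ T ∸ F ∸ 1
      r≤v = ℕₚ.≤-trans (ℕₚ.m≤n+m _ (k ∸ F)) (ℕₚ.≤-reflexive (≡.sym v≡))
      v∸r : T ∸ F ∸ 1 ∸ (T ∸ suc k) ≡ k ∸ F
      v∸r = ≡.trans (≡.cong (_∸ (T ∸ suc k)) v≡) (ℕₚ.m+n∸n≡m (k ∸ F) (T ∸ suc k))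
      penultimate : j J (∣ J ∣ ∸ 1) ≡ F
      penultimate = ≡.trans (j-entry J (∣ J ∣ ∸ 1)) (≡.trans
        (≡.cong₂ (entry n 0) (elements-high k<T)
            (≡.cong (_∸ 1) (≡.trans (∣∣≡length J) (≡.trans (≡.cong length (elements-high k<T))
          (≡.trans (Listₚ.length-++ (members μ 0 k)) (ℕₚ.+-comm _ 1))))))
        (≡.trans (entry-init n 0 (members μ 0 k) T) (lastOr-members μ k)))
      last : lastBinomial J ≡ (T ∸ F ∸ 1) C (k ∸ F)
      last = ≡.cong₂ (λ m p → (m ∸ p ∸ 1) C (k ∸ p)) (max-floor J) penultimate

    βᴶ₁-nextProduct : βᴶ₁ J ≡ nextProduct n (elements J)
    βᴶ₁-nextProduct = ≡.cong ℕL.product (≡.trans (Listₚ.map-applyUpTo id _ ∣ J ∣)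
      (≡.cong (List.applyUpTo (λ α → entry n 0 (elements J) (suc (suc α)) C entry n 0 (elements J) (suc α)))
          (∣∣≡length J)))

    -- Passing from the elements of J to all thresholds 1, ..., n only inserts repeated sizes, whose
    -- factors are 1.
    βᴶ₁-chain : βᴶ₁ J ≡ chainDown n (tᴶ J) n
    βᴶ₁-chain = ≡.trans βᴶ₁-nextProduct (≡.trans (by-case (T ℕ.≤? k)) (≡.sym chain))
      where
      chain : chainDown n (tᴶ J) n ≡ (n C T) * chainDown T (floor μ) k
      chain = ≡.trans (≡.cong (chainDown n (tᴶ J)) n≡) (≡.cong₂ _*_
        (≡.cong (n C_) top) (≡.trans (≡.cong (λ m → chainDown m (tᴶ J) (k + (n ∸ suc k))) top)
          (≡.trans (chainDown-constant T (tᴶ J) k (n ∸ suc k) λ a k<a → tᴶ-high J k<a)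
            (chainDown-cong T k λ a a≤k → tᴶ-low J a≤k))))
        where
        n≡ : n ≡ suc (k + (n ∸ suc k))
        n≡ = ≡.sym (ℕₚ.m+[n∸m]≡n k<n)
        top : tᴶ J (suc (k + (n ∸ suc k))) ≡ T
        top = tᴶ-high J (s≤s (ℕₚ.m≤m+n k _))
      by-case : Dec (T ≤ k) → nextProduct n (elements J) ≡ (n C T) * chainDown T (floor μ) k
      by-case (yes T≤k) = ≡.trans (≡.cong (nextProduct n) (elements-low T≤k)) (≡.trans (nextProduct-members n μ k)
        (≡.trans (≡.sym (chainDown-collapse n (floor μ) k ≡.refl))
            (≡.cong (λ m → (n C m) * chainDown m (floor μ) k) (≡.sym (floor-low J T≤k)))))
      by-case (no T≰k) = ≡.trans (≡.cong (nextProduct n) (elements-high (ℕₚ.≰⇒> T≰k)))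
          (≡.trans (nextProduct-∷ʳ n (members μ 0 k) T)
        (≡.trans (ℕₚ.*-comm _ (n C T)) (≡.cong ((n C T) *_) (nextProduct-members T μ k))))

-- Permutation orbits of degrees.

count-punchIn : ∀ {m} (P : Fin (suc m) → Bool) y → count P ≡ ⟦ P y ⟧ + count (P ∘ Fin.punchIn y)
count-punchIn P zero = ≡.refl
count-punchIn {suc m} P (suc y) = ≡.trans (≡.cong (⟦ P zero ⟧ +_) (count-punchIn (P ∘ suc) y))
    (x∙yz≈y∙xz ⟦ P zero ⟧ ⟦ P (suc y) ⟧ (count (P ∘ suc ∘ Fin.punchIn y)))
  where open import Algebra.Properties.CommutativeSemigroup ℕₚ.+-commutativeSemigroup using (x∙yz≈y∙xz)

count-permute : ∀ {m} (P : Fin m → Bool) (π : Permutation′ m) → count (P ∘ (π ⟨$⟩ʳ_)) ≡ count P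
count-permute P π = ≡.trans (count≡sum (P ∘ (π ⟨$⟩ʳ_)))
    (≡.trans (≡.sym (sum-permute (⟦_⟧ ∘ P) π)) (≡.sym (count≡sum P)))
  where
  open import Algebra.Properties.CommutativeMonoid.Sum ℕₚ.+-0-commutativeMonoid using (sum; sum-permute)
  count≡sum : ∀ {m} (P : Fin m → Bool) → count P ≡ sum (⟦_⟧ ∘ P)
  count≡sum {zero}  P = ≡.refl
  count≡sum {suc m} P = ≡.cong (⟦ P zero ⟧ +_) (count≡sum (P ∘ suc))

count-⊆-≡ : ∀ {m} {P Q : Fin m → Bool} → (∀ i → P i ≡ true → Q i ≡ true) → count P ≡ count Q → ∀ i → Q i ≡ true
    → P i ≡ true
count-⊆-≡ {P = P} {Q} P⊆Q eq i Qi with P i in Pi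
... | true  = ≡.refl
... | false = contradiction (count-mono P⊆Q∖i)
    (ℕₚ.<⇒≱ (ℕₚ.≤-reflexive (≡.trans (≡.sym (count-∖ Q i Qi)) (≡.sym eq))))
  where
  P⊆Q∖i : ∀ x → P x ≡ true → (Q ∖ i) x ≡ true
  P⊆Q∖i x Px = ∖-true Q i x (P⊆Q x Px) λ { ≡.refl → contradiction (≡.trans (≡.sym Px) Pi) λ () }

thr : ∀ {m} → (Fin m → ℕ) → ℕ → ℕ
thr f v = count λ x → does (v ℕ.≤? f x)

-- If u = f zero were not a value of g, the counts at u and u + 1 would agree for g but differ for
-- f. Pairing zero with such a position and removing both leaves equal counts.
thr⇒permutation : ∀ {m} (f g : Fin m → ℕ) → (∀ v → thr f v ≡ thr g v) → ∃ λ (π : Permutation′ m) → ∀ x → f x ≡ g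
    (π ⟨$⟩ʳ x)
thr⇒permutation {zero}  f g eq = Perm.id , λ ()
thr⇒permutation {suc m} f g eq with Finₚ.any? (λ y → g y ℕ.≟ f zero)
... | no none = contradiction
      (ℕₚ.≤-trans (ℕₚ.≤-reflexive (eq u)) (ℕₚ.≤-trans (count-mono skip) (ℕₚ.≤-reflexive (≡.sym (eq (suc u))))))
      (ℕₚ.<⇒≱ (≡.subst₂ (λ s t → ⟦ s ⟧ + thr (f ∘ suc) (suc u) < ⟦ t ⟧ + thr (f ∘ suc) u)
        (≡.sym (dec-false (suc u ℕ.≤? u) ℕₚ.1+n≰n)) (≡.sym (dec-true (u ℕ.≤? u) ℕₚ.≤-refl))
        (s≤s (count-mono λ x → dec-true (u ℕ.≤? f (suc x)) ∘ ℕₚ.<⇒≤ ∘ true⇒ (suc u ℕ.≤? f (suc x))))))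
  where
  u : ℕ
  u = f zero
  skip : ∀ y → does (u ℕ.≤? g y) ≡ true → does (suc u ℕ.≤? g y) ≡ true
  skip y le = dec-true (suc u ℕ.≤? g y) (ℕₚ.≤∧≢⇒< (true⇒ (u ℕ.≤? g y) le) λ eq′ → none (y , ≡.sym eq′))
... | yes (y , gy≡u) = let π , f≗ = thr⇒permutation (f ∘ suc) (g ∘ Fin.punchIn y) rest in Perm.insert zero y π , λ
      { zero → ≡.sym gy≡u
      ; (suc x) → ≡.trans (f≗ x) (≡.cong g (≡.sym (Perm.insert-punchIn zero y π x))) }
  where
  rest : ∀ v → thr (f ∘ suc) v ≡ thr (g ∘ Fin.punchIn y) v
  rest v = ℕₚ.+-cancelˡ-≡ ⟦ does (v ℕ.≤? f zero) ⟧ _ _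
      (≡.trans (eq v) (≡.trans (count-punchIn (λ x → does (v ℕ.≤? g x)) y)
    (≡.cong (λ w → ⟦ does (v ℕ.≤? w) ⟧ + thr (g ∘ Fin.punchIn y) v) gy≡u)))

bool-⇔ : ∀ {p q} → (p ≡ true → q ≡ true) → (q ≡ true → p ≡ true) → p ≡ q
bool-⇔ {false} {false} f g = ≡.refl
bool-⇔ {true}  {true}  f g = ≡.refl
bool-⇔ {true}  {false} f g = ≡.sym (f ≡.refl)
bool-⇔ {false} {true}  f g = g ≡.refl

module Orbits (n k : ℕ) (k<n : k < n) where

  open Isolated n k
  open Thresholds n
  open Skeletal k
  open IsolatedThresholds n k k<n public

  τ-permute : ∀ π b a → τ (lookup (permute π b)) a ≡ τ (lookup b) a
  τ-permute π b a = ≡.trans (τ-cong {b′ = λ x → lookup b (π ⟨$⟩ʳ x)} (Vecₚ.lookup∘tabulate _) a)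
      (count-permute (above (lookup b) a) π)

  thr-τ : ∀ (b : Degree n) v a → v + a ≡ suc n → thr b v ≡ τ b a
  thr-τ b v a eq = count-cong λ x → does-⇔ (v ℕ.≤? b x) (suc n ℕ.≤? b x + a)
    (λ le → ≡.subst (_≤ b x + a) eq (ℕₚ.+-monoˡ-≤ a le))
    (λ le → ℕₚ.+-cancelʳ-≤ a v (b x) (≡.subst (_≤ b x + a) (≡.sym eq) le))

  Match : (ℕ → ℕ) → (ℕ → ℕ) → Set
  Match t u = ∀ a → a ≤ n → t a ≡ u a

  -- The thresholds a ≤ n give the number of entries ≥ v for 1 ≤ v ≤ n + 1; `τ₀` takes care of
  -- larger v.
  match⇒permutation : ∀ b b′ → τ (lookup b) 0 ≡ 0 → Match (τ (lookup b)) (τ (lookup b′)) → ∃ λ π → b ≡ permute π b′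
  match⇒permutation b b′ τ₀ match =
    let π , eq = thr⇒permutation (lookup b) (lookup b′) same in
    π , vec-ext λ x → ≡.trans (eq x) (≡.sym (Vecₚ.lookup∘tabulate _ x))
    where
    large : ∀ b → τ (lookup b) 0 ≡ 0 → ∀ {v} → n < v → thr (lookup b) v ≡ 0
    large b τ₀ {v} n<v = ℕₚ.n≤0⇒n≡0 (≡.subst (thr (lookup b) v ≤_) τ₀ (count-mono λ x le →
      above⁺ (lookup b) 0 x (ℕₚ.≤-trans n<v
          (ℕₚ.≤-trans (true⇒ (v ℕ.≤? lookup b x) le) (ℕₚ.≤-reflexive (≡.sym (ℕₚ.+-identityʳ _)))))))
    same : ∀ v → thr (lookup b) v ≡ thr (lookup b′) v
    same zero = ≡.refl
    same (suc v) with suc v ℕ.≤? n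
    ... | no v≰n = ≡.trans (large b τ₀ (ℕₚ.≰⇒> v≰n))
        (≡.sym (large b′ (≡.trans (≡.sym (match 0 z≤n)) τ₀) (ℕₚ.≰⇒> v≰n)))
    ... | yes v≤n = ≡.trans (thr-τ (lookup b) (suc v) (n ∸ v) eq)
        (≡.trans (match (n ∸ v) (ℕₚ.m∸n≤m n v)) (≡.sym (thr-τ (lookup b′) (suc v) (n ∸ v) eq)))
      where
      eq : suc v + (n ∸ v) ≡ suc n
      eq = ≡.cong suc (ℕₚ.m+[n∸m]≡n (ℕₚ.<⇒≤ v≤n))

  match⇒good : ∀ {b} J → Match (τ b) (tᴶ J) → Good b
  match⇒good {b} J match = record
    { τ₀ = ≡.trans (match 0 z≤n) (tᴶ-low J {0} z≤n)
    ; support = support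
    ; lower-levels = λ a a<k → lower-level a a<k (floor-step (mem J) a)
    ; top-level = top (floor (mem J) n ℕ.≤? k) }
    where
    t₁ : τ b (suc k) ≡ floor (mem J) n
    t₁ = ≡.trans (match (suc k) k<n) (tᴶ-high J ℕₚ.≤-refl)
    t₀ : ∀ {a} → a ≤ k → τ b a ≡ floor (mem J) a
    t₀ {a} a≤k = ≡.trans (match a (ℕₚ.≤-trans a≤k (ℕₚ.<⇒≤ k<n))) (tᴶ-low J a≤k)
    support : ∀ x → b x ≡ 0 ⊎ suc n ≤ b x + suc k
    support x with b x ℕ.≟ 0
    ... | yes bx≡0 = inj₁ bx≡0
    -- The entries counted at k + 1 are among those counted at n, and the two counts agree; a
    -- positive entry is counted at n, hence at k + 1.
    ... | no  bx≢0 = inj₂ (above⁻ b (suc k) x (count-⊆-≡ {P = above b (suc k)} {above b n}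
      (λ y ab → above⁺ b n y (ℕₚ.≤-trans (above⁻ b (suc k) y ab) (ℕₚ.+-monoʳ-≤ (b y) k<n)))
      (≡.trans t₁ (≡.sym (≡.trans (match n ℕₚ.≤-refl) (tᴶ-high J k<n)))) x
      (above⁺ b n x (ℕₚ.+-monoˡ-≤ n (ℕₚ.n≢0⇒n>0 bx≢0)))))
    lower-level : ∀ a → a < k → floor (mem J) (suc a) ≡ floor (mem J) a ⊎ floor (mem J) (suc a) ≡ suc a → τ b
        (suc a) ≡ τ b a ⊎ τ b (suc a) ≡ suc a
    lower-level a a<k (inj₁ eq) = inj₁ (≡.trans (t₀ a<k) (≡.trans eq (≡.sym (t₀ (ℕₚ.<⇒≤ a<k)))))
    lower-level a a<k (inj₂ eq) = inj₂ (≡.trans (t₀ a<k) eq)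
    top : Dec (floor (mem J) n ≤ k) → τ b (suc k) ≡ τ b k ⊎ suc k ≤ τ b (suc k)
    top (no T≰k)  = inj₂ (ℕₚ.≤-trans (ℕₚ.≰⇒> T≰k) (ℕₚ.≤-reflexive (≡.sym t₁)))
    top (yes T≤k) = inj₁ (≡.trans t₁ (≡.trans (floor-low J T≤k) (≡.sym (t₀ ℕₚ.≤-refl))))

  -- Up to k, j is a member iff the floor at j equals j; above k a tame set has at most its maximum.
  -- Both are read off the thresholds.
  match-unique : ∀ {J J′} → Tame J → Tame J′ → Match (tᴶ J) (tᴶ J′) → J ≡ J′
  match-unique {J} {J′} tame tame′ match = at-injective J J′ λ m → bool-⇔ (half tame match m)
      (half tame′ (λ a a≤n → ≡.sym (match a a≤n)) m)
    where
    half : ∀ {J J′} → Tame J → Match (tᴶ J) (tᴶ J′) → ∀ m → mem J (suc m) ≡ true → mem J′ (suc m) ≡ true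
    half {J} {J′} tame match m μj with suc m ℕ.≤? k
    ... | yes j≤k = ≡.subst (λ j → mem J′ j ≡ true) fl≡
        (floor-mem (mem J′) (suc m) (≡.subst (1 ≤_) (≡.sym fl≡) (s≤s z≤n)))
      where
      fl≡ : floor (mem J′) (suc m) ≡ suc m
      fl≡ = ≡.trans (≡.sym (≡.trans (match (suc m) (mem-≤ J (suc m) μj)) (tᴶ-low J′ j≤k)))
        (≡.trans (tᴶ-low J j≤k) (≡.cong (if_then suc m else floor (mem J) m) μj))
    ... | no j≰k = ≡.subst (λ j → mem J′ j ≡ true) fl≡
        (floor-mem (mem J′) n (≡.subst (1 ≤_) (≡.sym fl≡) (s≤s z≤n)))
      where
      fl≡ : floor (mem J′) n ≡ suc m
      fl≡ = ≡.trans (≡.sym (≡.trans (match n ℕₚ.≤-refl) (tᴶ-high J′ k<n)))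
          (≡.trans (tᴶ-high J k<n) (≡.sym (tame (suc m) (ℕₚ.≰⇒> j≰k) μj)))

  module _ {b : Degree n} (good : Good b) where

    open Good good

    private
      -- Inverts J ↦ tᴶ J: up to k the members are the a with τ b a = a, and above k the only
      -- candidate is the final count τ b (k + 1).
      selected : ℕ → Bool
      selected a = if does (a ℕ.≤? k) then does (τ b a ℕ.≟ a) else does (τ b (suc k) ℕ.≟ a)

    orbitSubset : Subset n
    orbitSubset = tabulate (selected ∘ pos)

    private
      μ : ℕ → Bool
      μ = mem orbitSubset

      μ-selected : ∀ {m} → m < n → μ (suc m) ≡ selected (suc m)
      μ-selected {m} m<n = ≡.trans (≡.cong (at orbitSubset) (≡.sym x≡m))
          (≡.trans (at-toℕ orbitSubset (Fin.fromℕ< m<n))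
        (≡.trans (Vecₚ.lookup∘tabulate _ (Fin.fromℕ< m<n)) (≡.cong (selected ∘ suc) x≡m)))
        where
        x≡m : Fin.toℕ (Fin.fromℕ< m<n) ≡ m
        x≡m = Finₚ.toℕ-fromℕ< m<n

      μ-low : ∀ {m} → suc m ≤ k → μ (suc m) ≡ does (τ b (suc m) ℕ.≟ suc m)
      μ-low {m} j≤k = ≡.trans (μ-selected (ℕₚ.≤-trans j≤k (ℕₚ.<⇒≤ k<n)))
          (≡.cong (if_then does (τ b (suc m) ℕ.≟ suc m) else does (τ b (suc k) ℕ.≟ suc m))
              (dec-true (suc m ℕ.≤? k) j≤k))

      μ-high : ∀ {m} → m < n → k < suc m → μ (suc m) ≡ does (τ b (suc k) ℕ.≟ suc m)
      μ-high {m} m<n k<j = ≡.trans (μ-selected m<n)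
          (≡.cong (if_then does (τ b (suc m) ℕ.≟ suc m) else does (τ b (suc k) ℕ.≟ suc m))
              (dec-false (suc m ℕ.≤? k) (ℕₚ.<⇒≱ k<j)))

      μ-high⁻ : ∀ j → k < j → μ j ≡ true → τ b (suc k) ≡ j
      μ-high⁻ (suc m) k<j μj = true⇒ (τ b (suc k) ℕ.≟ suc m)
          (≡.trans (≡.sym (μ-high (mem-≤ orbitSubset (suc m) μj) k<j)) μj)

      floor-τ : ∀ a → a ≤ k → floor μ a ≡ τ b a
      floor-τ zero    _   = ≡.sym τ₀
      floor-τ (suc a) a<k with τ b (suc a) ℕ.≟ suc a
      ... | yes eq = ≡.trans (≡.cong (if_then suc a else floor μ a)
          (≡.trans (μ-low a<k) (dec-true (τ b (suc a) ℕ.≟ suc a) eq))) (≡.sym eq)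
      ... | no neq = ≡.trans (≡.cong (if_then suc a else floor μ a)
          (≡.trans (μ-low a<k) (dec-false (τ b (suc a) ℕ.≟ suc a) neq)))
                       (≡.trans (floor-τ a (ℕₚ.<⇒≤ a<k)) (≡.sym (flat (lower-levels a a<k))))
        where
        flat : τ b (suc a) ≡ τ b a ⊎ τ b (suc a) ≡ suc a → τ b (suc a) ≡ τ b a
        flat (inj₁ eq) = eq
        flat (inj₂ eq) = contradiction eq neq

      floor-top : floor μ n ≡ τ b (suc k)
      floor-top with floor μ n ℕ.≤? k
      ... | no T≰k = ≡.sym (μ-high⁻ (floor μ n) (ℕₚ.≰⇒> T≰k) (floor-mem μ n (ℕₚ.≤-trans (s≤s z≤n) (ℕₚ.≰⇒> T≰k))))
      ... | yes T≤k = ≡.trans (floor-low orbitSubset T≤k) (≡.trans (floor-τ k ℕₚ.≤-refl) (≡.sym (flat top-level)))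
        where
        flat : τ b (suc k) ≡ τ b k ⊎ suc k ≤ τ b (suc k) → τ b (suc k) ≡ τ b k
        flat (inj₁ eq) = eq
        flat (inj₂ le) = contradiction (member (τ b (suc k)) ≡.refl le) (ℕₚ.<⇒≱ (ℕₚ.≤-<-trans T≤k le))
          where
          member : ∀ m → τ b (suc k) ≡ m → k < m → m ≤ floor μ n
          member (suc m) eq k<m = floor⁺ μ
              (≡.trans (μ-high m<n k<m) (dec-true (τ b (suc k) ℕ.≟ suc m) eq)) ℕₚ.≤-refl m<n
            where
            m<n : suc m ≤ n
            m<n = ≡.subst (_≤ n) eq (count-≤ (above b (suc k)))

    orbitSubset-tame : Tame orbitSubset
    orbitSubset-tame j k<j μj = ≡.trans (≡.sym (μ-high⁻ j k<j μj)) (≡.sym floor-top)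

    orbitSubset-match : Match (τ b) (tᴶ orbitSubset)
    orbitSubset-match a a≤n with a ℕ.≤? k
    ... | yes a≤k = ≡.trans (≡.sym (floor-τ a a≤k)) (≡.sym (tᴶ-low orbitSubset a≤k))
    ... | no a≰k = ≡.trans (ℕₚ.≤-antisym (τ-mono b b a (suc k) λ x le → grow x le (support x))
                                         (τ-mono b b (suc k) a λ x le → ℕₚ.≤-trans le
                                             (ℕₚ.+-monoʳ-≤ (b x) (ℕₚ.≰⇒> a≰k))))
                    (≡.trans (≡.sym floor-top) (≡.sym (tᴶ-high orbitSubset (ℕₚ.≰⇒> a≰k))))
      where
      grow : ∀ x → suc n ≤ b x + a → b x ≡ 0 ⊎ suc n ≤ b x + suc k → suc n ≤ b x + suc k
      grow x le (inj₂ le′)  = le′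
      grow x le (inj₁ bx≡0) = contradiction (ℕₚ.≤-trans (≡.subst (λ m → suc n ≤ m + a) bx≡0 le) a≤n) ℕₚ.1+n≰n

  -- The types exclude each other, so at most one summand is non-zero and both can be summed
  -- together.
  multiplicity : ℕ → Subset n → ℕ
  multiplicity w J = (if does (𝓘₁? w J) then 1 else 0) + (if does (𝓘₂? w J) then lastBinomial J else 0)

  multiplicity-zero : ∀ {w J} → ¬ 𝓘⟨ w ⟩ J → multiplicity w J ≡ 0
  multiplicity-zero {w} {J} none = ≡.cong₂ (λ s t → (if s then 1 else 0) + (if t then lastBinomial J else 0))
    (dec-false (𝓘₁? w J) (none ∘ inj₁)) (dec-false (𝓘₂? w J) (none ∘ inj₂))

  multiplicity-type1 : ∀ {w J} → 𝓘₁⟨ w ⟩ J → multiplicity w J ≡ 1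
  multiplicity-type1 {w} {J} p = ≡.cong₂ (λ s t → (if s then 1 else 0) + (if t then lastBinomial J else 0))
    (dec-true (𝓘₁? w J) p) (dec-false (𝓘₂? w J) λ q → ℕₚ.<⇒≱ (type2-max (proj₁ q)) (type1-max (proj₁ p)))

  multiplicity-type2 : ∀ {w J} → 𝓘₂⟨ w ⟩ J → multiplicity w J ≡ lastBinomial J
  multiplicity-type2 {w} {J} q = ≡.cong₂ (λ s t → (if s then 1 else 0) + (if t then lastBinomial J else 0))
    (dec-false (𝓘₁? w J) λ p → ℕₚ.<⇒≱ (type2-max (proj₁ q)) (type1-max (proj₁ p))) (dec-true (𝓘₂? w J) q)

  predicted-isolated : ∀ w {J} → 𝓘⟨ w ⟩ J → predicted k (tᴶ J) (suc w) ≡ multiplicity w J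
  predicted-isolated w {J} iso with nonempty , tame , wt ← isolated⇒tame iso =
    ≡.trans (predicted-tᴶ J tame (suc w) nonempty) (≡.trans
      (≡.cong (if_then topBetti J else 0) (dec-true (suc w ℕ.≟ suc (weight J)) (≡.cong suc (≡.sym wt))))
          (by-type iso))
    where
    by-type : 𝓘⟨ w ⟩ J → topBetti J ≡ multiplicity w J
    by-type (inj₁ p) = ≡.trans (topBetti-type1 J tame (type1-max (proj₁ p))) (≡.sym (multiplicity-type1 p))
    by-type (inj₂ q) = ≡.trans (topBetti-type2 J tame (ℕₚ.<-trans (ℕₚ.n<1+n k) (type2-max (proj₁ q))))
        (≡.sym (multiplicity-type2 q))

  predicted-other : ∀ w {J} → Tame J → ¬ 𝓘⟨ w ⟩ J → predicted k (tᴶ J) (suc w) ≡ 0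
  predicted-other w {J} tame none with nonempty? J
    where open Subsetₚ using (nonempty?)
  ... | yes nonempty = ≡.trans (predicted-tᴶ J tame (suc w) nonempty)
    (≡.cong (if_then topBetti J else 0)
        (dec-false (suc w ℕ.≟ suc (weight J)) λ eq → none
            (tame⇒isolated nonempty tame (≡.sym (ℕₚ.suc-injective eq)))))
  -- The empty set belongs to homological degree 0 of R/I, never to suc w.
  ... | no empty = ≡.cong (if_then topFaces (tᴶ J (suc k) ∸ tᴶ J k) (tᴶ J (suc k) ∸ k) else 0)
      (dec-false (suc w ℕ.≟ jumps (tᴶ J) k + (tᴶ J (suc k) ∸ k)) λ eq → ℕₚ.0≢1+n
          (≡.trans (≡.sym zero-degree) (≡.sym eq)))
    where
    no-mem : ∀ j → mem J j ≢ true
    no-mem j μj with x , x∈J , _ ← mem⇒∈ J j μj = empty (x , x∈J)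
    fl≡0 : floor (mem J) n ≡ 0
    fl≡0 = ℕₚ.n≤0⇒n≡0 (ℕₚ.≮⇒≥ λ 0<fl → no-mem (floor (mem J) n) (floor-mem (mem J) n 0<fl))
    members≡[] : ∀ js → (∀ {j} → j ∈ js → mem J j ≡ true) → length js ≡ 0
    members≡[] []       _  = ≡.refl
    members≡[] (j ∷ js) ∈μ = contradiction (∈μ (here ≡.refl)) (no-mem j)
    zero-degree : jumps (tᴶ J) k + (tᴶ J (suc k) ∸ k) ≡ 0
    zero-degree = ≡.cong₂ _+_
      (≡.trans (jumps-tᴶ J tame) (members≡[] (members (mem J) 0 k) λ {j} j∈ → proj₁
          (∈-members⁻ (mem J) 0 k {j} j∈)))
      (≡.trans (≡.cong (_∸ k) (≡.trans (tᴶ-high J ℕₚ.≤-refl) fl≡0)) (ℕₚ.0∸n≡0 k))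

-- Counting vectors by thresholds

Σ< : ℕ → (ℕ → ℕ) → ℕ
Σ< zero    g = 0
Σ< (suc N) g = g 0 + Σ< N (g ∘ suc)

Σbox : ℕ → ∀ m → (Vec ℕ m → ℕ) → ℕ
Σbox N zero    f = f Vec.[]
Σbox N (suc m) f = Σ< (suc N) λ u → Σbox N m λ b → f (u Vec.∷ b)

InBox : ∀ {m} → ℕ → Vec ℕ m → Set
InBox N b = ∀ x → lookup b x ≤ N

open import Algebra.Properties.CommutativeSemigroup ℕₚ.+-commutativeSemigroup
  using () renaming (interchange to +-interchange)

Σ<-cong : ∀ N {g h : ℕ → ℕ} → (∀ u → u < N → g u ≡ h u) → Σ< N g ≡ Σ< N h
Σ<-cong zero    eq = ≡.refl
Σ<-cong (suc N) eq = ≡.cong₂ _+_ (eq 0 (s≤s z≤n)) (Σ<-cong N λ u u<N → eq (suc u) (s≤s u<N))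

Σ<-+ : ∀ N g h → Σ< N (λ u → g u + h u) ≡ Σ< N g + Σ< N h
Σ<-+ zero    g h = ≡.refl
Σ<-+ (suc N) g h = ≡.trans (≡.cong (g 0 + h 0 +_) (Σ<-+ N (g ∘ suc) (h ∘ suc))) (+-interchange (g 0) (h 0) _ _)

Σ<-* : ∀ N g c → Σ< N (λ u → c * g u) ≡ c * Σ< N g
Σ<-* zero    g c = ≡.sym (ℕₚ.*-zeroʳ c)
Σ<-* (suc N) g c = ≡.trans (≡.cong (c * g 0 +_) (Σ<-* N (g ∘ suc) c)) (≡.sym (ℕₚ.*-distribˡ-+ c (g 0) _))

Σ<-zero : ∀ N {g : ℕ → ℕ} → (∀ u → u < N → g u ≡ 0) → Σ< N g ≡ 0
Σ<-zero zero    eq = ≡.refl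
Σ<-zero (suc N) eq = ≡.cong₂ _+_ (eq 0 (s≤s z≤n)) (Σ<-zero N λ u u<N → eq (suc u) (s≤s u<N))

Σ<-single : ∀ N {g : ℕ → ℕ} {v} → v < N → (∀ u → u ≢ v → g u ≡ 0) → Σ< N g ≡ g v
Σ<-single (suc N) {v = zero}  _         off = ≡.trans (≡.cong (_ +_) (Σ<-zero N λ u _ → off (suc u) λ ()))
    (ℕₚ.+-identityʳ _)
Σ<-single (suc N) {v = suc v} (s≤s v<N) off = ≡.cong₂ _+_ (off 0 λ ())
    (Σ<-single N v<N λ u u≢v → off (suc u) (u≢v ∘ ℕₚ.suc-injective))

Σbox-cong : ∀ N m {f g : Vec ℕ m → ℕ} → (∀ b → InBox N b → f b ≡ g b) → Σbox N m f ≡ Σbox N m g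
Σbox-cong N zero    eq = eq Vec.[] λ ()
Σbox-cong N (suc m) eq = Σ<-cong (suc N) λ u u≤N → Σbox-cong N m λ b b∈ → eq (u Vec.∷ b)
    λ { zero → ℕₚ.≤-pred u≤N ; (suc x) → b∈ x }

Σbox-+ : ∀ N m f g → Σbox N m (λ b → f b + g b) ≡ Σbox N m f + Σbox N m g
Σbox-+ N zero    f g = ≡.refl
Σbox-+ N (suc m) f g = ≡.trans (Σ<-cong (suc N) λ u _ → Σbox-+ N m (f ∘ (u Vec.∷_)) (g ∘ (u Vec.∷_)))
    (Σ<-+ (suc N) (λ u → Σbox N m (f ∘ (u Vec.∷_))) (λ u → Σbox N m (g ∘ (u Vec.∷_))))

Σbox-* : ∀ N m f c → Σbox N m (λ b → f b * c) ≡ Σbox N m f * c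
Σbox-* N zero    f c = ≡.refl
Σbox-* N (suc m) f c = ≡.trans
  (Σ<-cong (suc N) λ u _ → ≡.trans (Σbox-* N m (f ∘ (u Vec.∷_)) c) (ℕₚ.*-comm (Σbox N m (f ∘ (u Vec.∷_))) c))
  (≡.trans (Σ<-* (suc N) (λ u → Σbox N m (f ∘ (u Vec.∷_))) c) (ℕₚ.*-comm c (Σbox N (suc m) f)))

Σbox-zero : ∀ N m {f : Vec ℕ m → ℕ} → (∀ b → f b ≡ 0) → Σbox N m f ≡ 0
Σbox-zero N zero    eq = eq Vec.[]
Σbox-zero N (suc m) eq = Σ<-zero (suc N) λ u _ → Σbox-zero N m λ b → eq (u Vec.∷ b)

Σbox-single : ∀ N m {f : Vec ℕ m → ℕ} {b} → InBox N b → (∀ b′ → b′ ≢ b → f b′ ≡ 0) → Σbox N m f ≡ f b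
Σbox-single N zero    {b = Vec.[]}    _  off = ≡.refl
Σbox-single N (suc m) {b = u Vec.∷ b} b∈ off = ≡.trans
  (Σ<-single (suc N) (s≤s (b∈ zero)) λ v v≢u → Σbox-zero N m λ b′ → off (v Vec.∷ b′) λ { ≡.refl → v≢u ≡.refl })
  (Σbox-single N m (b∈ ∘ suc) λ b′ b′≢b → off (u Vec.∷ b′) λ { ≡.refl → b′≢b ≡.refl })

Σbox-sum : ∀ {ℓ} {A : Set ℓ} N m (g : Vec ℕ m → A → ℕ) L →
           Σbox N m (λ b → ℕL.sum (List.map (g b) L)) ≡ ℕL.sum (List.map (λ J → Σbox N m (λ b → g b J)) L)
Σbox-sum N m g []      = Σbox-zero N m λ _ → ≡.refl
Σbox-sum N m g (J ∷ L) = ≡.trans (Σbox-+ N m (λ b → g b J) _)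
    (≡.cong (Σbox N m (λ b → g b J) +_) (Σbox-sum N m g L))

length-filter : ∀ {ℓ ℓ′} {A : Set ℓ} {P : A → Set ℓ′} (P? : ∀ x → Dec (P x)) x L →
                length (List.filter P? (x ∷ L)) ≡ ⟦ does (P? x) ⟧ + length (List.filter P? L)
length-filter P? x L with P? x
... | yes _ = ≡.refl
... | no  _ = ≡.refl

length-Σbox : ∀ {n} N (L : List (Multidegree n)) → (∀ {b} → b ∈ L → InBox N b) →
              length L ≡ Σbox N n (λ b → length (List.filter (_≟ᵈ b) L))
length-Σbox {n} N []      _   = ≡.sym (Σbox-zero N n λ _ → ≡.refl)
length-Σbox {n} N (a ∷ L) L⊆ = ≡.sym (≡.trans (Σbox-cong N n λ b _ → length-filter (_≟ᵈ b) a L)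
  (≡.trans (Σbox-+ N n (λ b → ⟦ does (a ≟ᵈ b) ⟧) _) (≡.cong₂ _+_
    (≡.trans (Σbox-single N n (L⊆ (here ≡.refl)) λ b b≢a → ≡.cong ⟦_⟧ (dec-false (a ≟ᵈ b) (b≢a ∘ ≡.sym)))
        (≡.cong ⟦_⟧ (dec-true (a ≟ᵈ a) ≡.refl)))
    (≡.sym (length-Σbox N L (L⊆ ∘ there))))))

sum-filter : ∀ {ℓ ℓ′} {A : Set ℓ} {P : A → Set ℓ′} (P? : ∀ x → Dec (P x)) (f : A → ℕ) L →
             ℕL.sum (List.map f (List.filter P? L)) ≡ ℕL.sum (List.map (λ x → if does (P? x) then f x else 0) L)
sum-filter P? f []      = ≡.refl
sum-filter P? f (x ∷ L) with P? x
... | yes _ = ≡.cong (f x +_) (sum-filter P? f L)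
... | no  _ = sum-filter P? f L

sum-map-+ : ∀ {ℓ} {A : Set ℓ} (f g : A → ℕ) L →
            ℕL.sum (List.map f L) + ℕL.sum (List.map g L) ≡ ℕL.sum (List.map (λ x → f x + g x) L)
sum-map-+ f g []      = ≡.refl
sum-map-+ f g (x ∷ L) = ≡.trans (+-interchange (f x) _ (g x) _) (≡.cong (f x + g x +_) (sum-map-+ f g L))

sum-map-cong : ∀ {ℓ} {A : Set ℓ} {f g : A → ℕ} L → (∀ x → f x ≡ g x) → ℕL.sum (List.map f L) ≡ ℕL.sum
    (List.map g L)
sum-map-cong L eq = ≡.cong ℕL.sum (Listₚ.map-cong eq L)

sum-map-zero : ∀ {ℓ} {A : Set ℓ} {f : A → ℕ} L → (∀ x → f x ≡ 0) → ℕL.sum (List.map f L) ≡ 0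
sum-map-zero []      eq = ≡.refl
sum-map-zero (x ∷ L) eq = ≡.cong₂ _+_ (eq x) (sum-map-zero L eq)

sum-subsets : ∀ n (f : Subset n → ℕ) J → (∀ J′ → J′ ≢ J → f J′ ≡ 0) → ℕL.sum (List.map f (subsets n)) ≡ f J
sum-subsets zero    f Vec.[]      off = ℕₚ.+-identityʳ _
sum-subsets (suc n) f (s Vec.∷ J) off = ≡.trans split (by-side s off)
  where
  L : List (Subset n)
  L = subsets n
  split : ℕL.sum (List.map f (subsets (suc n))) ≡
          ℕL.sum (List.map (λ J → f (outside Vec.∷ J)) L) + ℕL.sum (List.map (λ J → f (inside Vec.∷ J)) L)
  split = ≡.trans (≡.cong ℕL.sum (≡.trans (Listₚ.map-++ f (List.map (outside Vec.∷_) L) _)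
      (≡.cong₂ List._++_ (≡.sym (Listₚ.map-∘ L)) (≡.sym (Listₚ.map-∘ L)))))
    (sum-++ (List.map (λ J → f (outside Vec.∷ J)) L) _)
    where
    sum-++ : ∀ (xs ys : List ℕ) → ℕL.sum (xs List.++ ys) ≡ ℕL.sum xs + ℕL.sum ys
    sum-++ []       ys = ≡.refl
    sum-++ (x ∷ xs) ys = ≡.trans (≡.cong (x +_) (sum-++ xs ys)) (≡.sym (ℕₚ.+-assoc x _ _))
  by-side : ∀ s → (∀ J′ → J′ ≢ s Vec.∷ J → f J′ ≡ 0) →
            ℕL.sum (List.map (λ J → f (outside Vec.∷ J)) L) + ℕL.sum (List.map (λ J → f (inside Vec.∷ J)) L) ≡ f
                (s Vec.∷ J)
  by-side false off = ≡.trans (≡.cong₂ _+_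
    (sum-subsets n (f ∘ (outside Vec.∷_)) J λ J′ J′≢J → off _ λ { ≡.refl → J′≢J ≡.refl })
    (sum-map-zero L λ J′ → off _ λ ())) (ℕₚ.+-identityʳ _)
  by-side true off = ≡.cong₂ _+_
    (sum-map-zero L λ J′ → off _ λ ())
    (sum-subsets n (f ∘ (inside Vec.∷_)) J λ J′ J′≢J → off _ λ { ≡.refl → J′≢J ≡.refl })

-- Vectors b with prescribed numbers T₁, T₂, … of entries ≥ 1, ≥ 2, … are counted by
-- C(m,T₁) C(T₁,T₂) ⋯, by a Pascal recursion over the first entry u, which removes 1 from T₁,…,T_u.
thrs : ∀ {m} → ℕ → Vec ℕ m → List ℕ
thrs N b = List.applyUpTo (λ i → thr (lookup b) (suc i)) N

-- The effect of prepending an entry u on the list of counts; the list is cut off at N, so an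
-- overrun is dropped.
bump : ℕ → List ℕ → List ℕ
bump zero    Ts       = Ts
bump (suc u) []       = []
bump (suc u) (t ∷ Ts) = suc t ∷ bump u Ts

unbump : ℕ → List ℕ → Maybe (List ℕ)
unbump zero    Ts           = just Ts
unbump (suc u) []           = just []
unbump (suc u) (zero ∷ Ts)  = nothing
unbump (suc u) (suc t ∷ Ts) = Maybe.map (t ∷_) (unbump u Ts)

allZero : List ℕ → ℕ
allZero []           = 1
allZero (zero ∷ Ts)  = allZero Ts
allZero (suc _ ∷ Ts) = 0

-- A 0-1 indicator in recursive form, so that summing over the first entry unfolds along `unbump`.
matches : ∀ {m} → Vec ℕ m → List ℕ → ℕ
matches Vec.[]      Ts = allZero Ts
matches (u Vec.∷ b) Ts = maybe′ (matches b) 0 (unbump u Ts)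

unbump-bump : ∀ u Ts → unbump u (bump u Ts) ≡ just Ts
unbump-bump zero    Ts       = ≡.refl
unbump-bump (suc u) []       = ≡.refl
unbump-bump (suc u) (t ∷ Ts) = ≡.cong (Maybe.map (t ∷_)) (unbump-bump u Ts)

bump-unbump : ∀ u Ts {X} → unbump u Ts ≡ just X → bump u X ≡ Ts × length X ≡ length Ts
bump-unbump zero    Ts           ≡.refl = ≡.refl , ≡.refl
bump-unbump (suc u) []           ≡.refl = ≡.refl , ≡.refl
bump-unbump (suc u) (suc t ∷ Ts) eq with unbump u Ts in eq′ | eq
... | just X | ≡.refl = let b≡ , l≡ = bump-unbump u Ts eq′ in ≡.cong (suc t ∷_) b≡ , ≡.cong suc l≡

thrs-∷ : ∀ {m} N u (b : Vec ℕ m) → thrs N (u Vec.∷ b) ≡ bump u (thrs N b)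
thrs-∷ N u b = go N u λ i → thr (lookup b) (suc i)
  where
  go : ∀ N u (h : ℕ → ℕ) → List.applyUpTo (λ i → ⟦ does (suc i ℕ.≤? u) ⟧ + h i) N ≡ bump u (List.applyUpTo h N)
  go zero    zero    h = ≡.refl
  go zero    (suc u) h = ≡.refl
  go (suc N) zero    h = ≡.cong (h 0 ∷_) (go N zero (h ∘ suc))
  go (suc N) (suc u) h = ≡.cong (suc (h 0) ∷_) (go N u (h ∘ suc))

matches⁺ : ∀ {m} N (b : Vec ℕ m) → matches b (thrs N b) ≡ 1
matches⁺ zero    Vec.[] = ≡.refl
matches⁺ (suc N) Vec.[] = matches⁺ N Vec.[]
matches⁺ N (u Vec.∷ b) = ≡.trans
  (≡.cong (maybe′ (matches b) 0) (≡.trans (≡.cong (unbump u) (thrs-∷ N u b)) (unbump-bump u (thrs N b))))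
      (matches⁺ N b)

matches⁻ : ∀ {m} (b : Vec ℕ m) Ts → matches b Ts ≡ 0 ⊎ Ts ≡ thrs (length Ts) b
matches⁻ Vec.[] [] = inj₂ ≡.refl
matches⁻ Vec.[] (zero ∷ Ts) with matches⁻ Vec.[] Ts
... | inj₁ ≡0 = inj₁ ≡0
... | inj₂ eq = inj₂ (≡.cong (0 ∷_) eq)
matches⁻ Vec.[] (suc _ ∷ Ts) = inj₁ ≡.refl
matches⁻ (u Vec.∷ b) Ts with unbump u Ts in eq
... | nothing = inj₁ ≡.refl
... | just X with matches⁻ b X | bump-unbump u Ts eq
...   | inj₁ ≡0 | _        = inj₁ ≡0
...   | inj₂ X≡ | b≡ , l≡ = inj₂
    (≡.trans (≡.sym b≡) (≡.trans (≡.cong (bump u) (≡.trans X≡ (≡.cong (λ N → thrs N b) l≡)))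
                                (≡.sym (thrs-∷ (length Ts) u b))))

chain : ℕ → List ℕ → ℕ
chain m []       = 1
chain m (t ∷ Ts) = (m C t) * chain t Ts

-- For a first count t + 1, the entry 0 contributes C(m, t + 1) and the positive entries together
-- C(m, t), each times the same remaining chain by induction; Pascal's rule adds them. A first count
-- 0 admits only the entry 0.
chain-suc : ∀ m Ts → Σ< (suc (length Ts)) (λ u → maybe′ (chain m) 0 (unbump u Ts)) ≡ chain (suc m) Ts
chain-suc m []           = ≡.refl
chain-suc m (zero ∷ Ts)  = ≡.trans (≡.cong ((m C 0) * chain 0 Ts +_) (Σ<-zero (suc (length Ts)) λ _ _ → ≡.refl))
  (≡.trans (ℕₚ.+-identityʳ _) (≡.cong (_* chain 0 Ts) (≡.trans (nC0≡1 m) (≡.sym (nC0≡1 (suc m))))))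
chain-suc m (suc t ∷ Ts) = ≡.trans (≡.cong ((m C suc t) * chain (suc t) Ts +_) (≡.trans
    (Σ<-cong (suc (length Ts)) λ u _ → term (unbump u Ts))
        (≡.trans (Σ<-* (suc (length Ts)) (λ u → maybe′ (chain t) 0 (unbump u Ts)) (m C t))
            (≡.cong ((m C t) *_) (chain-suc t Ts)))))
  (≡.trans (≡.sym (ℕₚ.*-distribʳ-+ (chain (suc t) Ts) (m C suc t) (m C t)))
    (≡.cong (_* chain (suc t) Ts) (≡.trans (ℕₚ.+-comm (m C suc t) (m C t)) (nCk+nC[k+1]≡[n+1]C[k+1] m t))))
  where
  term : ∀ X → maybe′ (chain m) 0 (Maybe.map (t ∷_) X) ≡ (m C t) * maybe′ (chain t) 0 X
  term (just X) = ≡.refl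
  term nothing  = ≡.sym (ℕₚ.*-zeroʳ (m C t))

Σbox-matches : ∀ N m Ts → length Ts ≡ N → Σbox N m (λ b → matches b Ts) ≡ chain m Ts
Σbox-matches N zero Ts _ = go Ts
  where
  go : ∀ Ts → allZero Ts ≡ chain 0 Ts
  go []           = ≡.refl
  go (zero ∷ Ts)  = ≡.trans (go Ts) (≡.sym (ℕₚ.+-identityʳ _))
  go (suc t ∷ Ts) = ≡.sym (≡.cong (_* chain (suc t) Ts) (k>n⇒nCk≡0 {n = 0} {k = suc t} (s≤s z≤n)))
Σbox-matches N (suc m) Ts ≡.refl = ≡.trans (Σ<-cong (suc N) λ u _ → by-tail u (unbump u Ts) ≡.refl)
    (chain-suc m Ts)
  where
  by-tail : ∀ u X → unbump u Ts ≡ X → Σbox N m (λ b → maybe′ (matches b) 0 X) ≡ maybe′ (chain m) 0 X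
  by-tail u nothing  eq = Σbox-zero N m λ _ → ≡.refl
  by-tail u (just X) eq = Σbox-matches N m X (proj₂ (bump-unbump u Ts eq))

applyUpTo-injective : ∀ {f g : ℕ → ℕ} N → List.applyUpTo f N ≡ List.applyUpTo g N → ∀ i → i < N → f i ≡ g i
applyUpTo-injective (suc N) eq zero    _         = Listₚ.∷-injectiveˡ eq
applyUpTo-injective (suc N) eq (suc i) (s≤s i<N) = applyUpTo-injective N (Listₚ.∷-injectiveʳ eq) i i<N

chain-applyUpTo : ∀ e t a → chain e (List.applyUpTo (λ i → t (a ∸ i)) a) ≡ chainDown e t a
chain-applyUpTo e t zero    = ≡.refl
chain-applyUpTo e t (suc a) = ≡.cong ((e C t (suc a)) *_) (chain-applyUpTo (t (suc a)) t a)

-- Summation over degrees and orbits.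

module BettiSum (n k : ℕ) (k<n : k < n) where

  open Isolated n k
  open Thresholds n
  open Skeletal k
  open Orbits n k k<n public

  -- Entry i counts the coordinates ≥ i + 1, which is threshold n - i; hence the reversed order.
  orbitThrs : Subset n → List ℕ
  orbitThrs J = List.applyUpTo (λ i → tᴶ J (n ∸ i)) n

  length-orbitThrs : ∀ J → length (orbitThrs J) ≡ n
  length-orbitThrs J = Listₚ.length-applyUpTo _ n

  suc-i+n∸i : ∀ {i} → i < n → suc i + (n ∸ i) ≡ suc n
  suc-i+n∸i i<n = ≡.cong suc (ℕₚ.m+[n∸m]≡n (ℕₚ.<⇒≤ i<n))

  matches-match : ∀ b J → Match (τ (lookup b)) (tᴶ J) → matches b (orbitThrs J) ≡ 1
  matches-match b J match = ≡.trans (≡.cong (matches b) (go n λ i i<n →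
      ≡.trans (≡.sym (match (n ∸ i) (ℕₚ.m∸n≤m n i))) (≡.sym (thr-τ (lookup b) (suc i) (n ∸ i) (suc-i+n∸i i<n)))))
          (matches⁺ n b)
    where
    go : ∀ N {f g : ℕ → ℕ} → (∀ i → i < N → f i ≡ g i) → List.applyUpTo f N ≡ List.applyUpTo g N
    go zero    eq = ≡.refl
    go (suc N) eq = ≡.cong₂ _∷_ (eq 0 (s≤s z≤n)) (go N λ i i<N → eq (suc i) (s≤s i<N))

  matches-zero : ∀ b J → InBox n b → matches b (orbitThrs J) ≡ 0 ⊎ Match (τ (lookup b)) (tᴶ J)
  matches-zero b J b∈ with matches⁻ b (orbitThrs J)
  ... | inj₁ ≡0 = inj₁ ≡0
  ... | inj₂ eq = inj₂ match
    where
    τ₀ : τ (lookup b) 0 ≡ 0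
    τ₀ = count-false λ x → dec-false (suc n ℕ.≤? lookup b x + 0)
        (ℕₚ.<⇒≱ (s≤s (ℕₚ.≤-trans (ℕₚ.≤-reflexive (ℕₚ.+-identityʳ _)) (b∈ x))))
    eq′ : orbitThrs J ≡ thrs n b
    eq′ = ≡.trans eq (≡.cong (λ N → thrs N b) (length-orbitThrs J))
    match : Match (τ (lookup b)) (tᴶ J)
    match zero    _     = ≡.trans τ₀ (≡.sym (tᴶ-low J {0} z≤n))
    match (suc a) 1+a≤n = ≡.trans (≡.sym (thr-τ (lookup b) (suc i) (suc a) i+a)) (≡.trans
      (≡.sym (applyUpTo-injective n eq′ i i<n)) (≡.cong (tᴶ J) (ℕₚ.m∸[m∸n]≡n 1+a≤n)))
      where
      i : ℕ
      i = n ∸ suc a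
      i<n : i < n
      i<n = ℕₚ.∸-monoʳ-< {n} {suc a} {0} (s≤s z≤n) 1+a≤n
      i+a : suc i + suc a ≡ suc n
      i+a = ≡.cong suc (ℕₚ.m∸n+n≡m 1+a≤n)

  Σbox-orbit : ∀ J → Tame J → Σbox n n (λ b → matches b (orbitThrs J)) ≡ βᴶ₁ J
  Σbox-orbit J tame = ≡.trans (Σbox-matches n n (orbitThrs J) (length-orbitThrs J))
    (≡.trans (chain-applyUpTo n (tᴶ J) n) (≡.sym (βᴶ₁-chain J tame)))

  -- Stated for a bare list of degrees, so that it applies to step w of a resolution of the ideal
  -- and to step w + 1 of one of the quotient.
  module Multiplicities (L : List (Multidegree n)) (w : ℕ)
                        (on-good : ∀ b → Good (lookup b) → length (List.filter (_≟ᵈ b) L) ≡ predicted k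
                            (τ (lookup b)) (suc w))
                        (on-bad  : ∀ b → Bad (lookup b) → length (List.filter (_≟ᵈ b) L) ≡ 0) where

    inBox : ∀ {b} → b ∈ L → InBox n b
    inBox {b} b∈L with good-or-bad (lookup b)
    ... | inj₂ bad  = contradiction (on-bad b bad) (ℕₚ.m<n⇒n≢0 (nonempty (∈ₚ.∈-filter⁺ (_≟ᵈ b) b∈L ≡.refl)))
      where
      nonempty : ∀ {xs : List (Multidegree n)} → b ∈ xs → 0 < length xs
      nonempty (here _)  = s≤s z≤n
      nonempty (there _) = s≤s z≤n
    ... | inj₁ good = λ x → ℕₚ.≮⇒≥ λ n<bx → contradiction
      (≡.trans (≡.sym (above⁺ (lookup b) 0 x (ℕₚ.≤-trans n<bx (ℕₚ.≤-reflexive (≡.sym (ℕₚ.+-identityʳ _))))))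
               (count≡0⇒false (above (lookup b) 0) (Good.τ₀ good) x)) λ ()

    on-match : ∀ b J → 𝓘⟨ w ⟩ J → Match (τ (lookup b)) (tᴶ J) → length (List.filter (_≟ᵈ b) L) ≡ multiplicity w J
    on-match b J iso match = ≡.trans (on-good b (match⇒good J match))
      (≡.trans (predicted-cong k (suc w) λ a a≤1+k → match a (ℕₚ.≤-trans a≤1+k k<n)) (predicted-isolated w iso))

    isolated? : ∀ J → Dec (𝓘⟨ w ⟩ J)
    isolated? J = 𝓘₁? w J ⊎-dec 𝓘₂? w J

    -- A good degree matches exactly one tame set, its `orbitSubset`, so a single summand can
    -- survive.
    pointwise : ∀ b → InBox n b → length (List.filter (_≟ᵈ b) L) ≡
                ℕL.sum (List.map (λ J → matches b (orbitThrs J) * multiplicity w J) (subsets n))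
    pointwise b b∈ with good-or-bad (lookup b)
    ... | inj₁ good = ≡.sym (≡.trans (sum-subsets n _ J off) (≡.trans
        (≡.cong (_* multiplicity w J) (matches-match b J (orbitSubset-match good)))
            (≡.trans (ℕₚ.*-identityˡ _) (at-J (isolated? J)))))
      where
      J : Subset n
      J = orbitSubset good
      off : ∀ J′ → J′ ≢ J → matches b (orbitThrs J′) * multiplicity w J′ ≡ 0
      off J′ J′≢J with isolated? J′ | matches-zero b J′ b∈
      ... | no none | _ = ≡.trans (≡.cong (matches b (orbitThrs J′) *_) (multiplicity-zero none))
          (ℕₚ.*-zeroʳ (matches b (orbitThrs J′)))
      ... | yes _   | inj₁ ≡0 = ≡.cong (_* multiplicity w J′) ≡0
      ... | yes iso | inj₂ match = contradiction
          (match-unique (proj₁ (proj₂ (isolated⇒tame iso))) (orbitSubset-tame good)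
              λ a a≤n → ≡.trans (≡.sym (match a a≤n)) (orbitSubset-match good a a≤n)) J′≢J
      at-J : Dec (𝓘⟨ w ⟩ J) → multiplicity w J ≡ length (List.filter (_≟ᵈ b) L)
      at-J (yes iso) = ≡.sym (on-match b J iso (orbitSubset-match good))
      at-J (no none) = ≡.trans (multiplicity-zero none) (≡.sym (≡.trans (on-good b good) (≡.trans
        (predicted-cong k (suc w) λ a a≤1+k → orbitSubset-match good a (ℕₚ.≤-trans a≤1+k k<n))
        (predicted-other w (orbitSubset-tame good) none))))
    ... | inj₂ bad = ≡.trans (on-bad b bad) (≡.sym (sum-map-zero (subsets n) vanish))
      where
      vanish : ∀ J → matches b (orbitThrs J) * multiplicity w J ≡ 0
      vanish J with isolated? J | matches-zero b J b∈
      ... | no none | _ = ≡.trans (≡.cong (matches b (orbitThrs J) *_) (multiplicity-zero none))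
          (ℕₚ.*-zeroʳ (matches b (orbitThrs J)))
      ... | yes _   | inj₁ ≡0 = ≡.cong (_* multiplicity w J) ≡0
      -- By `on-match` the multiplicity equals the number of occurrences of b, which `on-bad` says
      -- is 0.
      ... | yes iso | inj₂ match = ≡.trans
          (≡.cong (matches b (orbitThrs J) *_) (≡.trans (≡.sym (on-match b J iso match)) (on-bad b bad)))
              (ℕₚ.*-zeroʳ (matches b (orbitThrs J)))

    -- After interchanging the sums over degrees and subsets, the degrees matching an isolated J
    -- number `βᴶ₁ J`, all with the same multiplicity.
    total : length L ≡ ∑[ 𝓘₁? w ] βᴶ₁ + ∑[ 𝓘₂? w ] βᴶ₂
    total = ≡.trans (length-Σbox n L inBox) (≡.trans (Σbox-cong n n pointwise) (≡.trans
      (Σbox-sum n n (λ b J → matches b (orbitThrs J) * multiplicity w J) (subsets n)) (≡.sym (≡.trans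
      (≡.cong₂ _+_ (sum-filter (𝓘₁? w) βᴶ₁ (subsets n)) (sum-filter (𝓘₂? w) βᴶ₂ (subsets n))) (≡.trans
      (sum-map-+ (λ J → if does (𝓘₁? w J) then βᴶ₁ J else 0) (λ J → if does (𝓘₂? w J) then βᴶ₂ J else 0)
          (subsets n))
      (sum-map-cong (subsets n) per-J))))))
      where
      weighted : ∀ s t β l → (if s then β else 0) + (if t then β * l else 0) ≡ β *
          ((if s then 1 else 0) + (if t then l else 0))
      weighted false false β l = ≡.sym (ℕₚ.*-zeroʳ β)
      weighted false true  β l = ≡.refl
      weighted true  false β l = ≡.trans (ℕₚ.+-identityʳ β) (≡.sym (ℕₚ.*-identityʳ β))
      weighted true  true  β l = ≡.sym (ℕₚ.*-suc β l)
      by-isolated : ∀ J → Dec (𝓘⟨ w ⟩ J) → βᴶ₁ J * multiplicity w J ≡ Σbox n n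
          (λ b → matches b (orbitThrs J)) * multiplicity w J
      by-isolated J (yes iso) = ≡.cong (_* multiplicity w J)
          (≡.sym (Σbox-orbit J (proj₁ (proj₂ (isolated⇒tame iso)))))
      by-isolated J (no none) = ≡.trans (≡.cong (βᴶ₁ J *_) (multiplicity-zero none)) (≡.trans (ℕₚ.*-zeroʳ (βᴶ₁ J))
        (≡.sym (≡.trans (≡.cong (Σbox n n (λ b → matches b (orbitThrs J)) *_) (multiplicity-zero none))
            (ℕₚ.*-zeroʳ (Σbox n n (λ b → matches b (orbitThrs J)))))))
      per-J : ∀ J → (if does (𝓘₁? w J) then βᴶ₁ J else 0) + (if does (𝓘₂? w J) then βᴶ₂ J else 0) ≡
                    Σbox n n (λ b → matches b (orbitThrs J) * multiplicity w J)
      per-J J = ≡.trans (weighted (does (𝓘₁? w J)) (does (𝓘₂? w J)) (βᴶ₁ J) (lastBinomial J))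
          (≡.trans (by-isolated J (isolated? J))
        (≡.sym (Σbox-* n n (λ b → matches b (orbitThrs J)) (multiplicity w J))))

    orbit : ∀ J π b → 𝓘⟨ w ⟩ J → b ≡ permute π (𝐛 J) → length (List.filter (_≟ᵈ b) L) ≡ multiplicity w J
    orbit J π b iso ≡.refl = on-match b J iso λ a a≤n → ≡.trans (τ-permute π (𝐛 J) a) (τ-𝐛 J a a≤n)

    isolated-degree : ∀ J → 𝓘⟨ w ⟩ J → length (List.filter (_≟ᵈ 𝐛 J) L) ≡ multiplicity w J
    isolated-degree J iso = on-match (𝐛 J) J iso (τ-𝐛 J)

    off-orbits : ∀ b → ¬ (∃ λ J → ∃ λ π → 𝓘⟨ w ⟩ J × b ≡ permute π (𝐛 J)) → length (List.filter (_≟ᵈ b) L) ≡ 0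
    off-orbits b none with good-or-bad (lookup b)
    ... | inj₂ bad  = on-bad b bad
    ... | inj₁ good = ≡.trans (on-good b good) (≡.trans
        (predicted-cong k (suc w) λ a a≤1+k → orbitSubset-match good a (ℕₚ.≤-trans a≤1+k k<n))
        (predicted-other w (orbitSubset-tame good) λ iso → none (J , proj₁ perm , iso , proj₂ perm)))
      where
      J : Subset n
      J = orbitSubset good
      perm : ∃ λ π → b ≡ permute π (𝐛 J)
      perm = match⇒permutation b (𝐛 J) (Good.τ₀ good) λ a a≤n → ≡.trans (orbitSubset-match good a a≤n)
          (≡.sym (τ-𝐛 J a a≤n))

-- Assembly of the four statements.

proposition2p2 :
    ∀ {c ℓ₁ ℓ₂} (K : HeytingField c ℓ₁ ℓ₂) → Decidable (HeytingField._#_ K) →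
    ∀ (n k : ℕ) → k < n →
    let open Graded K n
        open Skeleton K n k
        open Isolated n k
    in
    (𝓕 : MinimalFreeResolution 𝓜) (𝓖 : MinimalFreeResolution R/𝓜) →
    let open MinimalFreeResolution 𝓕 in
    ∀ (i : ℕ) → 1 ≤ i → i ≤ n ∸ 1 →
      (∀ (J : Subset n) → 𝓘₁⟨ i ∸ 1 ⟩ J →
         ∣ J ∣ ≡ i × βᵈ (i ∸ 1) (𝐛 J) ≡ 1)
    × (∀ (J : Subset n) → 𝓘₂⟨ i ∸ 1 ⟩ J →
         ∣ J ∣ + max J ∸ (k + 1) ≡ i × βᵈ (i ∸ 1) (𝐛 J) ≡ lastBinomial J)
    × (∀ (b : Multidegree n) →
         (∀ (J : Subset n) (π : Permutation′ n) → 𝓘⟨ i ∸ 1 ⟩ J → b ≡ permute π (𝐛 J) →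
            βᵈ (i ∸ 1) b ≡ βᵈ (i ∸ 1) (𝐛 J))
       × (¬ (∃[ J ] ∃[ π ] (𝓘⟨ i ∸ 1 ⟩ J × b ≡ permute π (𝐛 J))) →
            βᵈ (i ∸ 1) b ≡ 0))
    × (β (i ∸ 1) ≡ MinimalFreeResolution.β 𝓖 i
       × β (i ∸ 1) ≡ ∑[ 𝓘₁? (i ∸ 1) ] βᴶ₁ + ∑[ 𝓘₂? (i ∸ 1) ] βᴶ₂)
proposition2p2 K _#?_ n k k<n 𝓕 𝓖 (suc w) _ _ =
    (λ J iso → size₁ J iso , ≡.trans (𝓕.isolated-degree J (inj₁ iso)) (multiplicity-type1 iso))
  , (λ J iso → size₂ J iso , ≡.trans (𝓕.isolated-degree J (inj₂ iso)) (multiplicity-type2 iso))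
  , (λ b → (λ J π iso eq → ≡.trans (𝓕.orbit J π b iso eq) (≡.sym (𝓕.isolated-degree J iso))) , 𝓕.off-orbits b)
  , ≡.trans 𝓕.total (≡.sym 𝓖.total) , 𝓕.total
  where
  open Isolated n k
  open BettiSum n k k<n
  open SkeletonBetti K _#?_ n k k<n using (βᵈ-good; βᵈ-bad; βᵈ-quotient-good; βᵈ-quotient-bad)
  module ResF = Graded.MinimalFreeResolution 𝓕
  module ResG = Graded.MinimalFreeResolution 𝓖
  -- Both lists satisfy the same prediction, so their totals coincide; this gives the equality of
  -- the Betti numbers of ideal and quotient.
  module 𝓕 = Multiplicities (ResF.degrees w) w (βᵈ-good 𝓕 w) (βᵈ-bad 𝓕 w)
  module 𝓖 = Multiplicities (ResG.degrees (suc w)) w (βᵈ-quotient-good 𝓖 (suc w)) (βᵈ-quotient-bad 𝓖 (suc w))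
  size₁ : ∀ J → 𝓘₁⟨ w ⟩ J → ∣ J ∣ ≡ suc w
  size₁ J (ty , dwt) = ≡.trans (≡.sym (ℕₚ.m+[n∸m]≡n (nonempty⇒∣∣ {J} (proj₁ ty)))) (≡.cong suc dwt)
  size₂ : ∀ J → 𝓘₂⟨ w ⟩ J → ∣ J ∣ + max J ∸ (k + 1) ≡ suc w
  size₂ J (ty , dwt) = ≡.trans (ℕₚ.+-∸-assoc ∣ J ∣ (ℕₚ.<⇒≤ (proj₂ (proj₂ ty)))) (≡.trans
    (≡.cong (_+ (max J ∸ (k + 1))) (≡.sym (ℕₚ.m+[n∸m]≡n (nonempty⇒∣∣ {J} (proj₁ ty))))) (≡.cong suc dwt))
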